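{- Each of the $L_{\mathcal{O}}^p$-theories $T\big((\vec{0},\vec{0}),(\vec{0},\vec{0})\big)$, $T\big((\vec{0},\vec{\infty}),(\vec{0},\vec{0})\big)$ and $T\big((\vec{0},\vec{\infty}),(\vec{0},\vec{\infty})\big)$ has the VC $2$ property.
   Context: An oriented abelian group is an abelian group $(A,+,-,0)$ with a ternary relation $\mathcal{O}$ which is a translation-invariant cyclic order: for all $a,b,c,d$, $\mathcal{O}(a,b,c)\to\mathcal{O}(b,c,a)$; $\mathcal{O}(a,b,c)\to\neg\mathcal{O}(c,b,a)$; $\mathcal{O}(a,b,c)\wedge\mathcal{O}(a,c,d)\to\mathcal{O}(a,b,d)$; for pairwise distinct $a,b,c$, $\mathcal{O}(a,b,c)\vee\mathcal{O}(c,b,a)$; $\mathcal{O}(a,b,c)\to\mathcal{O}(a+d,b+d,c+d)$. Write $x<_0y$ for $x\neq y\wedge\mathcal{O}(0,x,y)$. Orientation intervals $(a,b)_{\mathcal{O}}=\{x:\mathcal{O}(a,x,b)\}$ form a basis of a group topology; "dense" refers to it. $A$ is regularly dense if for each prime $p$ and all $a,b$ with $\mathcal{O}(0,a,b)$ there is $c$ with $\mathcal{O}(a,pc,b)$ and $ic<_0(i+1)c$ for $i=1,\dots,p-1$. For a prime $p$, $[p]A=|A/pA|$, $\operatorname{Tor}_n(A)=\{a:na=0\}$, and $e(A,p)$ is the least $e\in\mathbb{N}$ with $\operatorname{Tor}_{p^{e+k}}(A)=\operatorname{Tor}_{p^e}(A)$ for all $k$ (where $\operatorname{Tor}_{p^0}(A)=\{0\}$),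 or $\infty$ if none exists. For sequences $\vec d,\vec e$ indexed by primes $p_i$ with values in $\mathbb{N}\cup\{\infty\}$, $T(\vec d,\vec e)$ is the theory in $L_{\mathcal{O}}=\{+,-,0,\mathcal{O}\}$ whose models are regularly dense oriented abelian groups with $[p_i]A=p_i^{d_i}$ and $e(A,p_i)=e_i$; $\vec0,\vec\infty$ are constant sequences. $L^p_{\mathcal{O}}=L_{\mathcal{O}}\cup\{V\}$, $V$ unary. $T\big((\vec d_1,\vec e_1),(\vec d_2,\vec e_2)\big)$ is the (complete) $L^p_{\mathcal{O}}$-theory whose models are pairs $(A,G)$ ($V$ interpreted as $G$) with $A\models T(\vec d_1,\vec e_1)$, $G$ a dense subgroup of $A$ with $G\models T(\vec d_2,\vec e_2)$ in the induced structure, and $A/G$ infinite. UDTFS: a finite set $\Delta(x;\vec y)$ of formulas in a single object variable $x$ has UDTFS with $d$ parameters in a model $M$ if there are finitely many families $(\psi^i_\varphi(\vec y;\vec y_1,\dots,\vec y_d))_{\varphi\in\Delta}$, $i\in I$, such that for every finite $B\subseteq M^{|\vec y|}$ with $|B|\ge2$ and every complete $\Delta$-type $q$ in $x$ over $B$ there are $\vec b_1,\dots,\vec b_d\in B$ and $i\in I$ with: for all $\varphi\in\Delta$, $\vec b\in B$, $\varphi(x;\vec b)\in q$ iff $M\models\psi^i_\varphi(\vec b;\vec b_1,\dots,\vec b_d)$. A complete theory has the VC $d$ property if every finite set of partitioned formulas in a single object variable has UDTFS with $d$ parameters. -}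

module Defs where

open import Level using (Level; _⊔_) renaming (suc to lsuc)
open import Data.Nat as ℕ using (ℕ; zero; suc; _^_; _≤_; _<_)
open import Data.Nat.Primality using (Prime)
open import Data.Fin using (Fin)
open import Data.Product using (Σ; _×_; _,_; proj₁; proj₂)
open import Data.Sum using (_⊎_)
open import Data.Vec.Functional using (Vector; _∷_; _++_; concat)
open import Relation.Binary.PropositionalEquality using (_≡_; _≢_)
open import Relation.Nullary using (¬_)
open import Function using (_∘_)
open import Function.Bundles using (_⇔_)

-- ℕ ∪ {∞} and sequences indexed by the primes
-- (a sequence is a function on ℕ; only its values at primes p matter)

data ℕ∞ : Set where
  fin : ℕ → ℕ∞
  ∞   : ℕ∞

PrimeSeq : Set
PrimeSeq = ℕ → ℕ∞

0⃗ : PrimeSeq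
0⃗ _ = fin 0

∞⃗ : PrimeSeq
∞⃗ _ = ∞

record OStr (ℓ : Level) : Set (lsuc ℓ) where
  infixl 6 _+ᴬ_
  field
    Carrier : Set ℓ
    _+ᴬ_    : Carrier → Carrier → Carrier
    -ᴬ_     : Carrier → Carrier
    0ᴬ      : Carrier
    𝒪       : Carrier → Carrier → Carrier → Set ℓ

module OStrDefs {ℓ : Level} (M : OStr ℓ) where
  open OStr M

  _·_ : ℕ → Carrier → Carrier
  zero  · a = 0ᴬ
  suc n · a = a +ᴬ (n · a)

  _-ᴬ_ : Carrier → Carrier → Carrier
  a -ᴬ b = a +ᴬ (-ᴬ b)

  _<₀_ : Carrier → Carrier → Set ℓ
  x <₀ y = (x ≢ y) × 𝒪 0ᴬ x y

  IsAbelianGroup : Set ℓ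
  IsAbelianGroup =
      (∀ a b c → (a +ᴬ b) +ᴬ c ≡ a +ᴬ (b +ᴬ c))
    × (∀ a b → a +ᴬ b ≡ b +ᴬ a)
    × (∀ a → 0ᴬ +ᴬ a ≡ a)
    × (∀ a → (-ᴬ a) +ᴬ a ≡ 0ᴬ)

  IsTranslationInvariantCyclicOrder : Set ℓ
  IsTranslationInvariantCyclicOrder =
      (∀ a b c → 𝒪 a b c → 𝒪 b c a)
    × (∀ a b c → 𝒪 a b c → ¬ 𝒪 c b a)
    × (∀ a b c d → 𝒪 a b c → 𝒪 a c d → 𝒪 a b d)
    × (∀ a b c → a ≢ b → b ≢ c → a ≢ c → 𝒪 a b c ⊎ 𝒪 c b a)
    × (∀ a b c d → 𝒪 a b c → 𝒪 (a +ᴬ d) (b +ᴬ d) (c +ᴬ d))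

  IsOrientedAbelianGroup : Set ℓ
  IsOrientedAbelianGroup = IsAbelianGroup × IsTranslationInvariantCyclicOrder

  IsRegularlyDense : Set ℓ
  IsRegularlyDense =
    ∀ p → Prime p → ∀ a b → 𝒪 0ᴬ a b →
      Σ Carrier λ c → 𝒪 a (p · c) b
                     × (∀ i → 1 ≤ i → i < p → (i · c) <₀ (suc i · c))

  _∈_·A : Carrier → ℕ → Set ℓ
  x ∈ n ·A = Σ Carrier λ y → n · y ≡ x

  -- [p]A = |A/pA| = p^d   (d ∈ ℕ ∪ {∞}; p^∞ means "infinite")
  IndexIs : ℕ → ℕ∞ → Set ℓ
  IndexIs p (fin d) =
    Σ (Fin (p ^ d) → Carrier) λ c →
        (∀ i j → i ≢ j → ¬ ((c i -ᴬ c j) ∈ p ·A))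
      × (∀ a → Σ (Fin (p ^ d)) λ i → (a -ᴬ c i) ∈ p ·A)
  IndexIs p ∞ =
    ∀ N → Σ (Fin N → Carrier) λ c →
        (∀ i j → i ≢ j → ¬ ((c i -ᴬ c j) ∈ p ·A))

  -- Tor_{p^(e+k)}(A) = Tor_{p^e}(A) for all k
  -- (the inclusion ⊇ always holds, so only ⊆ is stated)
  TorStableAt : ℕ → ℕ → Set ℓ
  TorStableAt p e = ∀ k a → ((p ^ (e ℕ.+ k)) · a ≡ 0ᴬ) → ((p ^ e) · a ≡ 0ᴬ)

  ExpIs : ℕ → ℕ∞ → Set ℓ
  ExpIs p (fin e) = TorStableAt p e × (∀ e′ → e′ < e → ¬ TorStableAt p e′)
  ExpIs p ∞       = ∀ e → ¬ TorStableAt p e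

IsModelT : {ℓ : Level} → PrimeSeq → PrimeSeq → OStr ℓ → Set ℓ
IsModelT d e M =
    IsOrientedAbelianGroup
  × IsRegularlyDense
  × (∀ p → Prime p → IndexIs p (d p))
  × (∀ p → Prime p → ExpIs p (e p))
  where open OStrDefs M

record LpStr (ℓ : Level) : Set (lsuc ℓ) where
  field
    base : OStr ℓ
    V    : OStr.Carrier base → Set ℓ
  open OStr base public

induced : {ℓ : Level} (M : LpStr ℓ) → let open LpStr M in
          V 0ᴬ → (∀ a b → V a → V b → V (a +ᴬ b)) → (∀ a → V a → V (-ᴬ a)) →
          OStr ℓ
induced M v0 v+ v- = record
  { Carrier = Σ Carrier V
  ; _+ᴬ_    = λ { (a , va) (b , vb) → (a +ᴬ b) , v+ a b va vb }
  ; -ᴬ_     = λ { (a , va) → (-ᴬ a) , v- a va }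
  ; 0ᴬ      = 0ᴬ , v0
  ; 𝒪       = λ x y z → 𝒪 (proj₁ x) (proj₁ y) (proj₁ z)
  }
  where open LpStr M

IsModelPair : {ℓ : Level} → PrimeSeq → PrimeSeq → PrimeSeq → PrimeSeq → LpStr ℓ → Set ℓ
IsModelPair d₁ e₁ d₂ e₂ M =
    IsModelT d₁ e₁ base
  -- V is a genuine subset (proof-irrelevant membership)
  × (∀ a (u v : V a) → u ≡ v)
  × Σ (V 0ᴬ) λ v0 →
    Σ (∀ a b → V a → V b → V (a +ᴬ b)) λ v+ →
    Σ (∀ a → V a → V (-ᴬ a)) λ v- →
        IsModelT d₂ e₂ (induced M v0 v+ v-)
      × (∀ a b → Σ Carrier (λ x → 𝒪 a x b) → Σ Carrier (λ g → V g × 𝒪 a g b))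
      × (∀ N → Σ (Fin N → Carrier) λ c → ∀ i j → i ≢ j → ¬ V (c i -ᴬ c j))
  where
    open LpStr M
    open OStrDefs base

data Term (n : ℕ) : Set where
  var  : Fin n → Term n
  _⊕_  : Term n → Term n → Term n
  ⊝_   : Term n → Term n
  𝟎    : Term n

data Formula (n : ℕ) : Set where
  _≐_  : Term n → Term n → Formula n
  𝒪ᶠ   : Term n → Term n → Term n → Formula n
  Vᶠ   : Term n → Formula n
  ¬ᶠ_  : Formula n → Formula n
  _∧ᶠ_ : Formula n → Formula n → Formula n
  ∃ᶠ   : Formula (suc n) → Formula n

module Semantics {ℓ : Level} (M : LpStr ℓ) where
  open LpStr M

  ⟦_⟧ₜ : ∀ {n} → Term n → Vector Carrier n → Carrier
  ⟦ var i ⟧ₜ  ρ = ρ i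
  ⟦ s ⊕ t ⟧ₜ  ρ = ⟦ s ⟧ₜ ρ +ᴬ ⟦ t ⟧ₜ ρ
  ⟦ ⊝ t ⟧ₜ    ρ = -ᴬ ⟦ t ⟧ₜ ρ
  ⟦ 𝟎 ⟧ₜ      ρ = 0ᴬ

  Sat : ∀ {n} → Formula n → Vector Carrier n → Set ℓ
  Sat (s ≐ t)     ρ = ⟦ s ⟧ₜ ρ ≡ ⟦ t ⟧ₜ ρ
  Sat (𝒪ᶠ s t u)  ρ = 𝒪 (⟦ s ⟧ₜ ρ) (⟦ t ⟧ₜ ρ) (⟦ u ⟧ₜ ρ)
  Sat (Vᶠ t)      ρ = V (⟦ t ⟧ₜ ρ)
  Sat (¬ᶠ φ)      ρ = ¬ (Sat φ ρ)
  Sat (φ ∧ᶠ ψ)    ρ = Sat φ ρ × Sat ψ ρ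
  Sat (∃ᶠ φ)      ρ = Σ Carrier λ a → Sat φ (a ∷ ρ)

  -- A partitioned formula φ(x; y⃗) with |y⃗| = m is a Formula (suc m):
  -- variable 0 is x, variable (suc i) is y_i.  A finite set Δ(x; y⃗) of
  -- such formulas is given as Δ : Fin r → Formula (suc m).
  -- A finite set B ⊆ M^m is given by an enumeration B : Fin s → M^m.

  AtLeastTwo : ∀ {m s} → (Fin s → Vector Carrier m) → Set ℓ
  AtLeastTwo {s = s} B =
    Σ (Fin s) λ t → Σ (Fin s) λ t′ → ¬ (∀ u → B t u ≡ B t′ u)

  -- q (a predicate on Δ × B, "φ(x; b) ∈ q") is a complete Δ-type in x
  -- over B in M (by finiteness of Δ and B, such a type is realised in M)
  IsCompleteΔType : ∀ {m r s} → (Fin r → Formula (suc m)) →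
                    (Fin s → Vector Carrier m) → (Fin r → Fin s → Set ℓ) → Set ℓ
  IsCompleteΔType Δ B q =
    Σ Carrier λ a → ∀ j t → q j t ⇔ Sat (Δ j) (a ∷ B t)

  -- Δ(x; y⃗) has UDTFS with d parameters in M.
  -- ψ i j is ψ^i_{Δ j}(y⃗; y⃗₁, …, y⃗_d), a formula in m + d·m variables.
  UDTFS : ∀ {m r} → ℕ → (Fin r → Formula (suc m)) → Set (lsuc ℓ)
  UDTFS {m} {r} d Δ =
    Σ ℕ λ k → Σ (Fin k → Fin r → Formula (m ℕ.+ d ℕ.* m)) λ ψ →
      ∀ s (B : Fin s → Vector Carrier m) → AtLeastTwo B →
      ∀ (q : Fin r → Fin s → Set ℓ) → IsCompleteΔType Δ B q →
        Σ (Fin d → Fin s) λ b⃗ → Σ (Fin k) λ i →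
          ∀ j t → q j t ⇔ Sat (ψ i j) (B t ++ concat (B ∘ b⃗))

-- A (complete) L^p_O-theory, given by its class of models, has the
-- VC d property: every finite set of partitioned formulas in a single
-- object variable has UDTFS with d parameters (in every model).
HasVCProperty : (ℓ : Level) → ℕ → (LpStr ℓ → Set ℓ) → Set (lsuc ℓ)
HasVCProperty ℓ d IsModel =
  ∀ (M : LpStr ℓ) → IsModel M →
  ∀ {m r} (Δ : Fin r → Formula (suc m)) → Semantics.UDTFS M d Δ

{-# OPTIONS --safe #-}

-- Cutting the cyclic order of A open at 0 and stacking ℤ copies of it gives a linearly ordered abelian group L
-- with a distinguished u > 0 such that A is [0 , u), added modulo u.  L and the preimage G̃ of G in L are divisible
-- up to multiples of u; for every k ≥ 1, k G̃ is dense in L, and G̃ has infinite index.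
-- An Ehrenfeucht–Fraïssé argument in L then shows that the truth of a formula at a tuple x depends only on the signs
-- of the combinations l·x + m u with bounded integer coefficients, and on their divisibility by bounded integers
-- in L and in G̃.
-- Hence, for a suitable K, the type of x over B is decided by two pieces of data: the root of some K x + f(b₁)
-- equal to x or nearest to x on the left, and a coset K x + f(b₂) ∈ K² G̃ or, if no combination with parameters
-- in B lies in G̃, the residue of x modulo K L.  If θ(x; y, y₁, y₂) expresses this, φ(x; b) is equivalent
-- to ∃ x′ (θ(x′; b, b₁, b₂) ∧ φ(x′; b)).
module Submission where

open import Defs
open import Level using (Level; Lift; lift) renaming (suc to lsuc)
open import Axiom.ExcludedMiddle using (ExcludedMiddle)
open import Data.Bool using (Bool; true; false)
open import Data.Empty using (⊥; ⊥-elim)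
open import Data.Fin as Fin using (Fin; zero; suc)
import Data.Fin.Properties as Finₚ
open import Data.Integer as ℤ using (ℤ; -[1+_]) renaming (+_ to pos; ∣_∣ to abs)
open import Data.Integer.Divisibility.Signed using () renaming (_∣?_ to _∣ᶻ?_; _∣_ to _∣ᶻ_; divides to dividesᶻ)
import Data.Integer.DivMod as ℤ÷
import Data.Integer.Properties as ℤₚ
open import Data.Integer.Solver using (module +-*-Solver)
open import Data.List as List using (List; []; _∷_)
open import Data.List.Membership.Propositional using (_∈_)
open import Data.List.Membership.Propositional.Properties
  using (∈-map⁺; ∈-map⁻; ∈-++⁺ˡ; ∈-++⁺ʳ; ∈-++⁻; ∈-upTo⁺; ∈-upTo⁻; ∈-allFin; ∈-tabulate⁺;
         ∈-cartesianProductWith⁺; ∈-cartesianProductWith⁻; ∈-cartesianProduct⁺; ∈-cartesianProduct⁻)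
open import Data.List.Relation.Unary.All using (All; []; _∷_)
open import Data.List.Relation.Unary.Any as Any using (here; there)
open import Data.List.Relation.Unary.Any.Properties using (lookup-index)
open import Data.Nat as ℕ using (ℕ; zero; suc; z≤n; s≤s; _≤_; _!)
open import Data.Nat.Divisibility as ℕ∣ using (_∣_; divides)
open import Data.Nat.ListAction using (sum; product)
open import Data.Nat.Primality using (Prime; prime⇒nonZero; prime[2])
open import Data.Nat.Primality.Factorisation using (factorise; PrimeFactorisation)
import Data.Nat.Properties as ℕₚ
open import Data.Product using (Σ; _×_; _,_; proj₁; proj₂)
open import Data.Sum using (_⊎_; inj₁; inj₂)
open import Data.Unit using (⊤; tt)
open import Data.Vec using (Vec; []; _∷_; lookup)
open import Data.Vec.Functional as VF using (Vector)
open import Function using (_∘_)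
open import Function.Bundles using (_⇔_; mk⇔; Equivalence)
open import Function.Properties.Equivalence using () renaming (refl to ⇔-refl; sym to ⇔-sym; trans to ⇔-trans)
open import Relation.Nullary using (¬_; Dec; yes; no)
open import Relation.Binary.PropositionalEquality
  using (_≡_; _≢_; refl; sym; trans; cong; cong₂; subst; subst₂; module ≡-Reasoning)

open Equivalence using (to; from)

-- Integer combinations in abelian groups

-- The torsion of `A` and `G` shows in L as divisibility of multiples m u. The tuples compared in
-- the game live in one model, where these constants have the same value on both sides, so one
-- argument serves all three theories. The constant `K` is N!. A form k x + f(y) with 0 < |k| ≤ N,
-- multiplied by K/|k|, gets leading coefficient K or -K, so the points -f(y)/K alone govern all
-- signs. The modulus K² comes from divisibility. If K x + f(b) = K² g with g in G̃, then K (k x +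
-- f'(y)) is K f'(y) - k f(b) plus a multiple of K² g. Every j ≤ N divides K, so divisibility of k x
-- + f'(y) by j becomes a condition on y and b alone. One root thus settles all signs and one coset
-- all divisibility: one parameter each. Two obstacles come from cutting the circle open. Whether a
-- + b passes 0 is not visibly symmetric in a and b, so commutativity of L needs an argument. And
-- the number of turns made by a term depends on the tuple; it is recovered from signs, because a
-- representative lies in [0 , u).

record AbGroup (ℓ : Level) : Set (lsuc ℓ) where
  infixl 6 _+_
  infix  8 -_
  field
    Carrier : Set ℓ
    _+_     : Carrier → Carrier → Carrier
    -_      : Carrier → Carrier
    𝟘       : Carrier
    assoc   : ∀ a b c → (a + b) + c ≡ a + (b + c)
    comm    : ∀ a b → a + b ≡ b + a
    idˡ     : ∀ a → 𝟘 + a ≡ a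
    invˡ    : ∀ a → - a + a ≡ 𝟘

module ScalarMult {ℓ : Level} (A : AbGroup ℓ) where
  open AbGroup A
  open ≡-Reasoning

  infixr 7 _·ℕ_ _·_

  _·ℕ_ : ℕ → Carrier → Carrier
  zero  ·ℕ a = 𝟘
  suc n ·ℕ a = a + n ·ℕ a

  _·_ : ℤ → Carrier → Carrier
  (pos n)    · a = n ·ℕ a
  -[1+ n ] · a = - (suc n ·ℕ a)

  idʳ : ∀ a → a + 𝟘 ≡ a
  idʳ a = trans (comm a 𝟘) (idˡ a)

  invʳ : ∀ a → a + - a ≡ 𝟘
  invʳ a = trans (comm a (- a)) (invˡ a)

  cancelˡ : ∀ a {b c} → a + b ≡ a + c → b ≡ c
  cancelˡ a {b} {c} eq = begin
    b             ≡⟨ idˡ b ⟨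
    𝟘 + b         ≡⟨ cong (_+ b) (invˡ a) ⟨
    - a + a + b   ≡⟨ assoc (- a) a b ⟩
    - a + (a + b) ≡⟨ cong (λ z → - a + z) eq ⟩
    - a + (a + c) ≡⟨ assoc (- a) a c ⟨
    - a + a + c   ≡⟨ cong (_+ c) (invˡ a) ⟩
    𝟘 + c         ≡⟨ idˡ c ⟩
    c             ∎

  swap-middle : ∀ a b c d → (a + b) + (c + d) ≡ (a + c) + (b + d)
  swap-middle a b c d = begin
    (a + b) + (c + d) ≡⟨ assoc a b (c + d) ⟩
    a + (b + (c + d)) ≡⟨ cong (a +_) (assoc b c d) ⟨
    a + ((b + c) + d) ≡⟨ cong (λ z → a + (z + d)) (comm b c) ⟩
    a + ((c + b) + d) ≡⟨ cong (a +_) (assoc c b d) ⟩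
    a + (c + (b + d)) ≡⟨ assoc a c (b + d) ⟨
    (a + c) + (b + d) ∎

  neg-unique : ∀ a b → a + b ≡ 𝟘 → b ≡ - a
  neg-unique a b eq = cancelˡ a (trans eq (sym (invʳ a)))

  neg-neg : ∀ a → - (- a) ≡ a
  neg-neg a = sym (neg-unique (- a) a (invˡ a))

  neg-+ : ∀ a b → - (a + b) ≡ - a + - b
  neg-+ a b = sym (neg-unique (a + b) (- a + - b) (begin
    (a + b) + (- a + - b) ≡⟨ swap-middle a b (- a) (- b) ⟩
    (a + - a) + (b + - b) ≡⟨ cong₂ _+_ (invʳ a) (invʳ b) ⟩
    𝟘 + 𝟘                 ≡⟨ idˡ 𝟘 ⟩
    𝟘                     ∎))

  neg-𝟘 : - 𝟘 ≡ 𝟘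
  neg-𝟘 = sym (neg-unique 𝟘 𝟘 (idˡ 𝟘))

  ·ℕ-+ : ∀ m n a → (m ℕ.+ n) ·ℕ a ≡ m ·ℕ a + n ·ℕ a
  ·ℕ-+ zero    n a = sym (idˡ _)
  ·ℕ-+ (suc m) n a = trans (cong (a +_) (·ℕ-+ m n a)) (sym (assoc a (m ·ℕ a) (n ·ℕ a)))

  ·ℕ-distrib : ∀ n a b → n ·ℕ (a + b) ≡ n ·ℕ a + n ·ℕ b
  ·ℕ-distrib zero    a b = sym (idˡ 𝟘)
  ·ℕ-distrib (suc n) a b = trans (cong (a + b +_) (·ℕ-distrib n a b)) (swap-middle a b _ _)

  ⊖-· : ∀ m n a → (m ℤ.⊖ n) · a ≡ m ·ℕ a + - (n ·ℕ a)
  ⊖-· m       zero    a = sym (trans (cong (m ·ℕ a +_) neg-𝟘) (idʳ _))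
  ⊖-· zero    (suc n) a = sym (idˡ _)
  ⊖-· (suc m) (suc n) a = begin
    (suc m ℤ.⊖ suc n) · a               ≡⟨ cong (_· a) (ℤₚ.[1+m]⊖[1+n]≡m⊖n m n) ⟩
    (m ℤ.⊖ n) · a                       ≡⟨ ⊖-· m n a ⟩
    m ·ℕ a + - (n ·ℕ a)                 ≡⟨ idˡ _ ⟨
    𝟘 + (m ·ℕ a + - (n ·ℕ a))           ≡⟨ cong (_+ (m ·ℕ a + - (n ·ℕ a))) (invʳ a) ⟨
    (a + - a) + (m ·ℕ a + - (n ·ℕ a))   ≡⟨ swap-middle a (- a) _ _ ⟩
    (a + m ·ℕ a) + (- a + - (n ·ℕ a))   ≡⟨ cong (a + m ·ℕ a +_) (neg-+ a _) ⟨
    (a + m ·ℕ a) + - (a + n ·ℕ a)       ∎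

  ·-+ : ∀ i j a → (i ℤ.+ j) · a ≡ i · a + j · a
  ·-+ (pos m)    (pos n)    a = ·ℕ-+ m n a
  ·-+ (pos m)    -[1+ n ] a = ⊖-· m (suc n) a
  ·-+ -[1+ m ] (pos n)    a = trans (⊖-· n (suc m) a) (comm _ _)
  ·-+ -[1+ m ] -[1+ n ] a = begin
    - (suc (suc (m ℕ.+ n)) ·ℕ a)        ≡⟨ cong (λ z → - (a + z)) (·ℕ-+ (suc m) n a) ⟩
    - (a + (suc m ·ℕ a + n ·ℕ a))       ≡⟨ cong -_ (assoc a _ _) ⟨
    - ((a + suc m ·ℕ a) + n ·ℕ a)       ≡⟨ cong (λ z → - (z + n ·ℕ a)) (comm a _) ⟩
    - ((suc m ·ℕ a + a) + n ·ℕ a)       ≡⟨ cong -_ (assoc _ a _) ⟩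
    - (suc m ·ℕ a + suc n ·ℕ a)         ≡⟨ neg-+ _ _ ⟩
    - (suc m ·ℕ a) + - (suc n ·ℕ a)     ∎

  ·-distrib : ∀ i a b → i · (a + b) ≡ i · a + i · b
  ·-distrib (pos n)    a b = ·ℕ-distrib n a b
  ·-distrib -[1+ n ] a b = trans (cong -_ (·ℕ-distrib (suc n) a b)) (neg-+ _ _)

  1· : ∀ a → ℤ.1ℤ · a ≡ a
  1· a = idʳ a

  ·-𝟘 : ∀ i → i · 𝟘 ≡ 𝟘
  ·-𝟘 i = cancelˡ (i · 𝟘) (trans (sym (·-distrib i 𝟘 𝟘)) (trans (cong (i ·_) (idˡ 𝟘)) (sym (idʳ _))))

  ·-neg : ∀ i a → i · (- a) ≡ - (i · a)
  ·-neg i a = neg-unique (i · a) _ (trans (sym (·-distrib i a (- a))) (trans (cong (i ·_) (invʳ a)) (·-𝟘 i)))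

  neg-· : ∀ i a → (ℤ.- i) · a ≡ - (i · a)
  neg-· i a = neg-unique (i · a) _ (trans (sym (·-+ i (ℤ.- i) a)) (cong (_· a) (ℤₚ.+-inverseʳ i)))

  ·-* : ∀ i j a → (i ℤ.* j) · a ≡ i · (j · a)
  ·-* (pos n)    j a = go n
    where
    go : ∀ n → ((pos n) ℤ.* j) · a ≡ n ·ℕ (j · a)
    go zero    = refl
    go (suc n) = begin
      ((pos (suc n)) ℤ.* j) · a       ≡⟨ cong (_· a) (ℤₚ.suc-* (pos n) j) ⟩
      (j ℤ.+ (pos n) ℤ.* j) · a     ≡⟨ ·-+ j ((pos n) ℤ.* j) a ⟩
      j · a + ((pos n) ℤ.* j) · a   ≡⟨ cong (j · a +_) (go n) ⟩
      j · a + n ·ℕ (j · a)        ∎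
  ·-* -[1+ n ] j a = begin
    (-[1+ n ] ℤ.* j) · a          ≡⟨ cong (_· a) (ℤₚ.neg-distribˡ-* (pos (suc n)) j) ⟨
    (ℤ.- ((pos (suc n)) ℤ.* j)) · a   ≡⟨ neg-· ((pos (suc n)) ℤ.* j) a ⟩
    - (((pos (suc n)) ℤ.* j) · a)     ≡⟨ cong -_ (·-* (pos (suc n)) j a) ⟩
    - ((pos (suc n)) · (j · a))       ∎

  lin : ∀ {n} → Vector ℤ n → Vector Carrier n → Carrier
  lin {zero}  l x = 𝟘
  lin {suc n} l x = l zero · x zero + lin (l ∘ suc) (x ∘ suc)

  lin-cong : ∀ {n} {l l′ : Vector ℤ n} {x x′ : Vector Carrier n} →
             (∀ i → l i ≡ l′ i) → (∀ i → x i ≡ x′ i) → lin l x ≡ lin l′ x′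
  lin-cong {zero}  p q = refl
  lin-cong {suc n} p q = cong₂ _+_ (cong₂ _·_ (p zero) (q zero)) (lin-cong (p ∘ suc) (q ∘ suc))

  lin-+ : ∀ {n} (l l′ : Vector ℤ n) x → lin (λ i → l i ℤ.+ l′ i) x ≡ lin l x + lin l′ x
  lin-+ {zero}  l l′ x = sym (idˡ 𝟘)
  lin-+ {suc n} l l′ x = trans (cong₂ _+_ (·-+ (l zero) (l′ zero) (x zero)) (lin-+ (l ∘ suc) (l′ ∘ suc) (x ∘ suc)))
                               (swap-middle _ _ _ _)

  lin-· : ∀ {n} k (l : Vector ℤ n) x → lin (λ i → k ℤ.* l i) x ≡ k · lin l x
  lin-· {zero}  k l x = sym (·-𝟘 k)
  lin-· {suc n} k l x = trans (cong₂ _+_ (·-* k (l zero) (x zero)) (lin-· k (l ∘ suc) (x ∘ suc)))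
                              (sym (·-distrib k _ _))

  lin-0 : ∀ {n} (x : Vector Carrier n) → lin (λ _ → ℤ.0ℤ) x ≡ 𝟘
  lin-0 {zero}  x = refl
  lin-0 {suc n} x = trans (idˡ _) (lin-0 (x ∘ suc))

  δ : ∀ {n} → Fin n → Vector ℤ n
  δ zero    zero    = ℤ.1ℤ
  δ zero    (suc _) = ℤ.0ℤ
  δ (suc i) zero    = ℤ.0ℤ
  δ (suc i) (suc j) = δ i j

  lin-δ : ∀ {n} (i : Fin n) x → lin (δ i) x ≡ x i
  lin-δ zero    x = trans (cong₂ _+_ (1· (x zero)) (lin-0 (x ∘ suc))) (idʳ _)
  lin-δ (suc i) x = trans (idˡ _) (lin-δ i (x ∘ suc))

  -- Linear identities decided by comparing coefficients

  module Solver where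
    open +-*-Solver public using (Polynomial; con; _:+_; _:*_; :-_) renaming (var to ivar)
    open +-*-Solver using (⟦_⟧; ⟦_⟧↓; prove)

    infixl 6 _⊞_
    infix  8 ⊟_
    infixr 7 _⊡_

    data Expr (k n : ℕ) : Set where
      var : Fin n → Expr k n
      _⊞_ : Expr k n → Expr k n → Expr k n
      ⊟_  : Expr k n → Expr k n
      _⊡_ : Polynomial k → Expr k n → Expr k n
      ∅   : Expr k n

    eval : ∀ {k n} → Expr k n → Vec ℤ k → Vec Carrier n → Carrier
    eval (var i)   ρ x = lookup x i
    eval (e ⊞ e′)  ρ x = eval e ρ x + eval e′ ρ x
    eval (⊟ e)     ρ x = - eval e ρ x
    eval (p ⊡ e)   ρ x = ⟦ p ⟧ ρ · eval e ρ x
    eval ∅         ρ x = 𝟘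

    coef : ∀ {k n} → Expr k n → Fin n → Polynomial k
    coef (var i)   j = con (δ i j)
    coef (e ⊞ e′)  j = coef e j :+ coef e′ j
    coef (⊟ e)     j = con -[1+ 0 ] :* coef e j
    coef (p ⊡ e)   j = p :* coef e j
    coef ∅         j = con ℤ.0ℤ

    eval-lin : ∀ {k n} (e : Expr k n) ρ x → eval e ρ x ≡ lin (λ j → ⟦ coef e j ⟧ ρ) (lookup x)
    eval-lin (var i)  ρ x = sym (lin-δ i (lookup x))
    eval-lin (e ⊞ e′) ρ x = trans (cong₂ _+_ (eval-lin e ρ x) (eval-lin e′ ρ x)) (sym (lin-+ _ _ (lookup x)))
    eval-lin (⊟ e)    ρ x = trans (cong -_ (trans (eval-lin e ρ x) (sym (1· _))))
                            (trans (sym (neg-· ℤ.1ℤ _)) (sym (lin-· -[1+ 0 ] (λ j → ⟦ coef e j ⟧ ρ) (lookup x))))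
    eval-lin (p ⊡ e)  ρ x = trans (cong (⟦ p ⟧ ρ ·_) (eval-lin e ρ x)) (sym (lin-· (⟦ p ⟧ ρ) (λ j → ⟦ coef e j ⟧ ρ) (lookup x)))
    eval-lin ∅        ρ x = sym (lin-0 (lookup x))

    SameCoefs : ∀ {k} n → (Fin n → Polynomial k) → (Fin n → Polynomial k) → Vec ℤ k → Set
    SameCoefs zero    p q ρ = ⊤
    SameCoefs (suc n) p q ρ = ⟦ p zero ⟧↓ ρ ≡ ⟦ q zero ⟧↓ ρ × SameCoefs n (p ∘ suc) (q ∘ suc) ρ

    -- Both sides are linear combinations of the group variables with polynomial coefficients in the
    -- integer variables. Each `refl` in a call certifies, through the ring normal form, the
    -- coefficient of one group variable.
    solve : ∀ {k n} (ρ : Vec ℤ k) (x : Vec Carrier n) (e e′ : Expr k n) →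
            SameCoefs n (coef e) (coef e′) ρ → eval e ρ x ≡ eval e′ ρ x
    solve {n = n} ρ x e e′ same =
      trans (eval-lin e ρ x) (trans (lin-cong (equal n _ _ same) (λ _ → refl)) (sym (eval-lin e′ ρ x)))
      where
      equal : ∀ n (p q : Fin n → Polynomial _) → SameCoefs n p q ρ → ∀ j → ⟦ p j ⟧ ρ ≡ ⟦ q j ⟧ ρ
      equal (suc n) p q (eq , _)  zero    = prove ρ (p zero) (q zero) eq
      equal (suc n) p q (_ , eqs) (suc j) = equal n (p ∘ suc) (q ∘ suc) eqs j

    pattern k₀ = ivar zero
    pattern k₁ = ivar (suc zero)
    pattern k₂ = ivar (suc (suc zero))
    pattern v₀ = var zero
    pattern v₁ = var (suc zero)
    pattern v₂ = var (suc (suc zero))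
    pattern v₃ = var (suc (suc (suc zero)))
    pattern v₄ = var (suc (suc (suc (suc zero))))

-- Ordered groups with a distinguished subgroup

≡⇒⇔ : ∀ {a p} {A : Set a} (P : A → Set p) {x y : A} → x ≡ y → P x ⇔ P y
≡⇒⇔ P refl = ⇔-refl

-- The flag selects between the distinguished subgroup and the whole group.
OrAll : ∀ {a ℓ} {A : Set a} → (A → Set ℓ) → Bool → A → Set ℓ
OrAll P true  = P
OrAll P false = λ _ → Lift _ ⊤

record OrderedGroup (ℓ : Level) : Set (lsuc ℓ) where
  field
    group : AbGroup ℓ
  open AbGroup group public
  open ScalarMult group public
  field
    Pos      : Carrier → Set ℓ
    pos-+    : ∀ {a b} → Pos a → Pos b → Pos (a + b)
    pos-asym : ∀ {a} → Pos a → ¬ Pos (- a)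
    pos-irr  : ¬ Pos 𝟘
    pos-tri  : ∀ a → Pos a ⊎ a ≡ 𝟘 ⊎ Pos (- a)
    u        : Carrier
    pos-u    : Pos u

record OrderedPair (ℓ : Level) : Set (lsuc ℓ) where
  field
    orderedGroup : OrderedGroup ℓ
  open OrderedGroup orderedGroup public
  field
    G        : Carrier → Set ℓ
    G-𝟘      : G 𝟘
    G-+      : ∀ {a b} → G a → G b → G (a + b)
    G-neg    : ∀ {a} → G a → G (- a)
    G-u      : G u

  H : Bool → Carrier → Set ℓ
  H = OrAll G

  field
    divisible : ∀ h k → 1 ≤ k → ∀ {a} → H h a →
                Σ ℤ λ j → Σ Carrier λ b → H h b × a + j · u ≡ pos k · b
    dense     : ∀ k → 1 ≤ k → ∀ s t → Pos (t + - s) →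
                Σ Carrier λ g → G g × Pos (pos k · g + - s) × Pos (t + - (pos k · g))
    infinite  : ∀ n → Σ (Fin n → Carrier) λ c → ∀ i j → i ≢ j → ¬ G (c i + - c j)

module OrderedGroupLemmas {ℓ : Level} (L : OrderedGroup ℓ) where
  open OrderedGroup L
  open Solver

  pos-scale : ∀ k → 1 ≤ k → ∀ {a} → Pos a → Pos (pos k · a)
  pos-scale (suc zero)    _ p = subst Pos (sym (1· _)) p
  pos-scale (suc (suc k)) _ p = pos-+ p (pos-scale (suc k) (s≤s z≤n) p)

  pos-unscale : ∀ k → 1 ≤ k → ∀ {a} → Pos (pos k · a) → Pos a
  pos-unscale k k≥1 {a} p with pos-tri a
  ... | inj₁ q           = q
  ... | inj₂ (inj₁ refl) = ⊥-elim (pos-irr (subst Pos (·-𝟘 (pos k)) p))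
  ... | inj₂ (inj₂ q)    = ⊥-elim (pos-asym p (subst Pos (·-neg (pos k) a) (pos-scale k k≥1 q)))

  pos-scale⇔ : ∀ k → 1 ≤ k → ∀ a → Pos a ⇔ Pos (pos k · a)
  pos-scale⇔ k k≥1 a = mk⇔ (pos-scale k k≥1) (pos-unscale k k≥1)

  torsion-free : ∀ k → 1 ≤ k → ∀ {a} → pos k · a ≡ 𝟘 → a ≡ 𝟘
  torsion-free k k≥1 {a} eq with pos-tri a
  ... | inj₁ q        = ⊥-elim (pos-irr (subst Pos eq (pos-scale k k≥1 q)))
  ... | inj₂ (inj₁ e) = e
  ... | inj₂ (inj₂ q) = ⊥-elim (pos-irr (subst Pos (trans (·-neg (pos k) a) (trans (cong -_ eq) neg-𝟘))
                                                  (pos-scale k k≥1 q)))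

  ≡-from-diff : ∀ {a b} → a + - b ≡ 𝟘 → a ≡ b
  ≡-from-diff {a} {b} eq =
    trans (solve [] (a ∷ b ∷ []) v₀ ((v₀ ⊞ ⊟ v₁) ⊞ v₁) (refl , refl , tt)) (trans (cong (_+ b) eq) (idˡ b))

  ·-cancel : ∀ k → 1 ≤ k → ∀ {a b} → pos k · a ≡ pos k · b → a ≡ b
  ·-cancel k k≥1 {a} {b} eq = ≡-from-diff (torsion-free k k≥1 (trans
    (solve (pos k ∷ []) (a ∷ b ∷ []) (k₀ ⊡ (v₀ ⊞ ⊟ v₁)) (k₀ ⊡ v₀ ⊞ ⊟ (k₀ ⊡ v₁)) (refl , refl , tt))
    (trans (cong (_+ - (pos k · b)) eq) (invʳ _))))

  infix 4 _<_

  _<_ : Carrier → Carrier → Set ℓ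
  a < b = Pos (b + - a)

  <-trans : ∀ {a b c} → a < b → b < c → a < c
  <-trans {a} {b} {c} p q = subst Pos
    (solve [] (a ∷ b ∷ c ∷ []) ((v₂ ⊞ ⊟ v₁) ⊞ (v₁ ⊞ ⊟ v₀)) (v₂ ⊞ ⊟ v₀) (refl , refl , refl , tt)) (pos-+ q p)

  <-irrefl : ∀ {a} → ¬ a < a
  <-irrefl {a} p = pos-irr (subst Pos (invʳ a) p)

  <-asym : ∀ {a b} → a < b → ¬ b < a
  <-asym p q = <-irrefl (<-trans p q)

  <-tri : ∀ a b → a < b ⊎ a ≡ b ⊎ b < a
  <-tri a b with pos-tri (b + - a)
  ... | inj₁ p        = inj₁ p
  ... | inj₂ (inj₁ e) = inj₂ (inj₁ (sym (≡-from-diff e)))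
  ... | inj₂ (inj₂ p) = inj₂ (inj₂ (subst Pos (solve [] (a ∷ b ∷ []) (⊟ (v₁ ⊞ ⊟ v₀)) (v₀ ⊞ ⊟ v₁) (refl , refl , tt)) p))

  <-shift : ∀ c {a b} → a < b → a + c < b + c
  <-shift c {a} {b} = subst Pos
    (solve [] (a ∷ b ∷ c ∷ []) (v₁ ⊞ ⊟ v₀) ((v₁ ⊞ v₂) ⊞ ⊟ (v₀ ⊞ v₂)) (refl , refl , refl , tt))

-- Divisibility, linear forms and equivalence of tuples

module OrderLemmas {ℓ : Level} (S : OrderedPair ℓ) where
  open OrderedPair S
  open OrderedGroupLemmas orderedGroup public
  open Solver

  H-𝟘 : ∀ h → H h 𝟘
  H-𝟘 true  = G-𝟘
  H-𝟘 false = lift tt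

  H-+ : ∀ h {a b} → H h a → H h b → H h (a + b)
  H-+ true  p q = G-+ p q
  H-+ false _ _ = lift tt

  H-neg : ∀ h {a} → H h a → H h (- a)
  H-neg true  p = G-neg p
  H-neg false _ = lift tt

  H-·ℕ : ∀ h n {a} → H h a → H h (pos n · a)
  H-·ℕ h zero    p = H-𝟘 h
  H-·ℕ h (suc n) p = H-+ h p (H-·ℕ h n p)

  H-· : ∀ h i {a} → H h a → H h (i · a)
  H-· h (pos n)    p = H-·ℕ h n p
  H-· h (-[1+ n ]) p = H-neg h (H-·ℕ h (suc n) p)

  G⇒H : ∀ h {a} → G a → H h a
  G⇒H true  p = p
  G⇒H false _ = lift tt

  -- For k = 1 and `h` = `true` this is membership in `G`, so divisibility conditions also cover the
  -- predicate `V`.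
  record Div (h : Bool) (k : ℕ) (a : Carrier) : Set ℓ where
    constructor quot
    field
      quotient : Carrier
      H-quot   : H h quotient
      equality : a ≡ pos k · quotient

  Div-+ : ∀ {h k a b} → Div h k a → Div h k b → Div h k (a + b)
  Div-+ {h} {k} (quot x p refl) (quot y q refl) = quot (x + y) (H-+ h p q) (sym (·-distrib (pos k) x y))

  Div-neg : ∀ {h k a} → Div h k a → Div h k (- a)
  Div-neg {h} {k} (quot x p refl) = quot (- x) (H-neg h p) (sym (·-neg (pos k) x))

  Div-shift : ∀ {h k} a b → Div h k b → Div h k a ⇔ Div h k (a + b)
  Div-shift {h} {k} a b d = mk⇔ (λ e → Div-+ e d)
    (λ e → subst (Div h k) (solve [] (a ∷ b ∷ []) ((v₀ ⊞ v₁) ⊞ ⊟ v₁) v₀ (refl , refl , tt)) (Div-+ e (Div-neg d)))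

  Div-scale : ∀ {h} k j → 1 ≤ k → ∀ a → Div h j a ⇔ Div h (k ℕ.* j) (pos k · a)
  Div-scale {h} k j k≥1 a = mk⇔
    (λ { (quot b p eq) → quot b p (trans (cong (pos k ·_) eq) (sym (scalars b))) })
    (λ { (quot b p eq) → quot b p (·-cancel k k≥1 (trans eq (scalars b))) })
    where
    scalars : ∀ b → pos (k ℕ.* j) · b ≡ pos k · pos j · b
    scalars b = trans (cong (_· b) (ℤₚ.pos-* k j)) (·-* (pos k) (pos j) b)

  Div-multiple : ∀ h {j k} → j ∣ k → ∀ {g} → H h g → Div h j (pos k · g)
  Div-multiple h {j} (divides q refl) {g} p = quot (pos q · g) (H-·ℕ h q p)
    (trans (cong (_· g) (trans (ℤₚ.pos-* q j) (ℤₚ.*-comm (pos q) (pos j)))) (·-* (pos j) (pos q) g))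

  Div-· : ∀ {h k} i {a} → Div h k a → Div h k (i · a)
  Div-· {h} {k} i (quot b p refl) = quot (i · b) (H-· h i p)
    (solve (i ∷ pos k ∷ []) (b ∷ []) (k₀ ⊡ k₁ ⊡ v₀) (k₁ ⊡ k₀ ⊡ v₀) (refl , tt))

  Div⇒H : ∀ {h k a} → Div h k a → H h a
  Div⇒H {h} {k} (quot b p refl) = H-·ℕ h k p

  -- The remainder j in a + j u ∈ k H may be reduced modulo k, as u ∈ H.
  divisible% : ∀ h k → 1 ≤ k → ∀ {a} → H h a →
               Σ ℕ λ j → j ≤ k × Div h k (a + pos j · u)
  divisible% h k@(suc _) k≥1 {a} p with divisible h k k≥1 p
  ... | j , b , q , eq = r , ℕₚ.<⇒≤ (ℤ÷.n%ℕd<d j k) , quot (b + - (d · u)) (H-+ h q (H-neg h (H-· h d (G⇒H h G-u)))) (begin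
    a + pos r · u                             ≡⟨ solve (pos r ∷ d ∷ pos k ∷ []) (a ∷ u ∷ [])
                                                   (v₀ ⊞ k₀ ⊡ v₁)
                                                   ((v₀ ⊞ (k₀ :+ k₁ :* k₂) ⊡ v₁) ⊞ ⊟ (k₂ ⊡ k₁ ⊡ v₁))
                                                   (refl , refl , tt) ⟩
    a + (pos r ℤ.+ d ℤ.* pos k) · u + - (pos k · d · u)
                                              ≡⟨ cong (λ i → a + i · u + - (pos k · d · u)) (ℤ÷.a≡a%ℕn+[a/ℕn]*n j k) ⟨
    a + j · u + - (pos k · d · u)             ≡⟨ cong (_+ - (pos k · d · u)) eq ⟩
    pos k · b + - (pos k · d · u)             ≡⟨ solve (d ∷ pos k ∷ []) (b ∷ u ∷ [])
                                                   (k₁ ⊡ v₀ ⊞ ⊟ (k₁ ⊡ k₀ ⊡ v₁)) (k₁ ⊡ (v₀ ⊞ ⊟ (k₀ ⊡ v₁)))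
                                                   (refl , refl , tt) ⟩
    pos k · (b + - (d · u))                   ∎)
    where
    open ≡-Reasoning
    r = j ℤ÷.%ℕ k
    d = j ℤ÷./ℕ k

  Form : ℕ → Set
  Form n = Vector ℤ n × ℤ

  val : ∀ {n} → Form n → Vector Carrier n → Carrier
  val (l , m) x = lin l x + m · u

  infixl 6 _+ᶠ_
  infixr 7 _*ᶠ_

  _+ᶠ_ : ∀ {n} → Form n → Form n → Form n
  (l , m) +ᶠ (l′ , m′) = (λ i → l i ℤ.+ l′ i) , m ℤ.+ m′

  _*ᶠ_ : ∀ {n} → ℤ → Form n → Form n
  k *ᶠ (l , m) = (λ i → k ℤ.* l i) , k ℤ.* m

  const : ∀ {n} → ℤ → Form n
  const m = (λ _ → ℤ.0ℤ) , m

  tail : ∀ {n} → Form (suc n) → Form n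
  tail (l , m) = l ∘ suc , m

  val-+ : ∀ {n} (f g : Form n) x → val (f +ᶠ g) x ≡ val f x + val g x
  val-+ (l , m) (l′ , m′) x = trans (cong₂ _+_ (lin-+ l l′ x) (·-+ m m′ u)) (swap-middle _ _ _ _)

  val-* : ∀ {n} k (f : Form n) x → val (k *ᶠ f) x ≡ k · val f x
  val-* k (l , m) x = trans (cong₂ _+_ (lin-· k l x) (·-* k m u)) (sym (·-distrib k _ _))

  val-const : ∀ {n} m (x : Vector Carrier n) → val (const m) x ≡ m · u
  val-const m x = trans (cong (_+ m · u) (lin-0 x)) (idˡ _)

  val-∷ : ∀ {n} (f : Form (suc n)) a x → val f (a VF.∷ x) ≡ proj₁ f zero · a + val (tail f) x
  val-∷ f a x = assoc _ _ _

  Bounded : ∀ {n} → ℕ → Form n → Set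
  Bounded N (l , m) = (∀ i → abs (l i) ≤ N) × abs m ≤ N

  abs-+-≤ : ∀ i j {M N} → abs i ≤ M → abs j ≤ N → abs (i ℤ.+ j) ≤ M ℕ.+ N
  abs-+-≤ i j p q = ℕₚ.≤-trans (ℤₚ.∣i+j∣≤∣i∣+∣j∣ i j) (ℕₚ.+-mono-≤ p q)

  abs-*-≤ : ∀ i j {M N} → abs i ≤ M → abs j ≤ N → abs (i ℤ.* j) ≤ M ℕ.* N
  abs-*-≤ i j {M} {N} p q = subst (_≤ M ℕ.* N) (sym (ℤₚ.abs-* i j)) (ℕₚ.*-mono-≤ p q)

  bounded-+ : ∀ {n M N} (f g : Form n) → Bounded M f → Bounded N g → Bounded (M ℕ.+ N) (f +ᶠ g)
  bounded-+ (l , m) (l′ , m′) (p , q) (p′ , q′) = (λ i → abs-+-≤ (l i) (l′ i) (p i) (p′ i)) , abs-+-≤ m m′ q q′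

  bounded-* : ∀ {n M N} k (f : Form n) → abs k ≤ M → Bounded N f → Bounded (M ℕ.* N) (k *ᶠ f)
  bounded-* k (l , m) r (p , q) = (λ i → abs-*-≤ k (l i) r (p i)) , abs-*-≤ k m r q

  bounded-const : ∀ {n N} m → abs m ≤ N → Bounded {n} N (const m)
  bounded-const m p = (λ _ → z≤n) , p

  bounded-mono : ∀ {n M N} (f : Form n) → M ≤ N → Bounded M f → Bounded N f
  bounded-mono f r (p , q) = (λ i → ℕₚ.≤-trans (p i) r) , ℕₚ.≤-trans q r

  bounded-tail : ∀ {n N} (f : Form (suc n)) → Bounded N f → Bounded N (tail f)
  bounded-tail f (p , q) = p ∘ suc , q

  -- Vanishing of a form is covered as well: bounded forms are closed under negation, and a form
  -- vanishes exactly when neither it nor its negative is positive.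
  Eqv : ∀ {n} → ℕ → Vector Carrier n → Vector Carrier n → Set ℓ
  Eqv N x x′ = ∀ f → Bounded N f →
      (Pos (val f x) ⇔ Pos (val f x′))
    × (∀ h k → 1 ≤ k → k ≤ N → Div h k (val f x) ⇔ Div h k (val f x′))

  Eqv-sym : ∀ {n N} {x x′ : Vector Carrier n} → Eqv N x x′ → Eqv N x′ x
  Eqv-sym e f b = ⇔-sym (proj₁ (e f b)) , λ h k p q → ⇔-sym (proj₂ (e f b) h k p q)

  Eqv-mono : ∀ {n M N} {x x′ : Vector Carrier n} → M ≤ N → Eqv N x x′ → Eqv M x x′
  Eqv-mono M≤N e f b = proj₁ e′ , λ h k p q → proj₂ e′ h k p (ℕₚ.≤-trans q M≤N)
    where e′ = e f (bounded-mono f M≤N b)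

-- Finite lists of bounded coefficients and forms

ints : ℕ → List ℤ
ints N = List.map pos (List.upTo (suc N)) List.++ List.map (ℤ.-_ ∘ pos) (List.upTo (suc N))

∈-ints : ∀ {N} i → abs i ≤ N → i ∈ ints N
∈-ints {N} (pos n)    p = ∈-++⁺ˡ (∈-map⁺ pos (∈-upTo⁺ (s≤s p)))
∈-ints {N} (-[1+ n ]) p = ∈-++⁺ʳ (List.map pos (List.upTo (suc N))) (∈-map⁺ (ℤ.-_ ∘ pos) (∈-upTo⁺ (s≤s p)))

vectors : ∀ n → ℕ → List (Vector ℤ n)
vectors zero    N = List.[ (λ ()) ]
vectors (suc n) N = List.cartesianProductWith VF._∷_ (ints N) (vectors n N)

-- Vectors are functions, so a bounded vector is found in the list only up to pointwise equality;
-- the value of a form is insensitive to that.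
∈-vectors : ∀ {n N} (l : Vector ℤ n) → (∀ i → abs (l i) ≤ N) →
            Σ (Vector ℤ n) λ l′ → l′ ∈ vectors n N × (∀ i → l i ≡ l′ i)
∈-vectors {zero}  l p = _ , here refl , λ ()
∈-vectors {suc n} l p with ∈-vectors (l ∘ suc) (p ∘ suc)
... | l′ , l′∈ , eq = l zero VF.∷ l′ , ∈-cartesianProductWith⁺ VF._∷_ (∈-ints (l zero) (p zero)) l′∈ ,
                      λ { zero → refl ; (suc i) → eq i }

ints-bounded : ∀ {N i} → i ∈ ints N → abs i ≤ N
ints-bounded {N} p with ∈-++⁻ (List.map pos (List.upTo (suc N))) p
... | inj₁ q with ∈-map⁻ pos q
...   | _ , n∈ , refl = ℕₚ.≤-pred (∈-upTo⁻ n∈)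
ints-bounded {N} p | inj₂ q with ∈-map⁻ (ℤ.-_ ∘ pos) q
...   | n , n∈ , refl = subst (_≤ N) (sym (ℤₚ.∣-i∣≡∣i∣ (pos n))) (ℕₚ.≤-pred (∈-upTo⁻ n∈))

vectors-bounded : ∀ {n N} {l : Vector ℤ n} → l ∈ vectors n N → ∀ i → abs (l i) ≤ N
vectors-bounded {suc n} {N} p i with ∈-cartesianProductWith⁻ VF._∷_ (ints N) (vectors n N) p
vectors-bounded {suc n} {N} p zero    | _ , _ , z∈ , _ , refl = ints-bounded z∈
vectors-bounded {suc n} {N} p (suc i) | _ , _ , _ , l∈ , refl = vectors-bounded l∈ i

∈⇒≤sum : ∀ {n ns} → n ∈ ns → n ≤ sum ns
∈⇒≤sum {ns = n ∷ ns} (here refl) = ℕₚ.m≤m+n n (sum ns)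
∈⇒≤sum {ns = n ∷ ns} (there p)   = ℕₚ.≤-trans (∈⇒≤sum p) (ℕₚ.m≤n+m (sum ns) n)

∣! : ∀ {k n} → 1 ≤ k → k ≤ n → k ∣ n !
∣! {suc k} 1≤k k≤n = ℕ∣.∣-trans (ℕ∣.m∣m*n (k !)) (ℕ∣.m≤n⇒m!∣n! k≤n)

module Classical {ℓ : Level} (em : ExcludedMiddle ℓ) (S : OrderedPair ℓ) where
  open OrderedPair S
  open OrderLemmas S
  open Solver

  pos-+-nonneg : ∀ {a b} → Pos a → ¬ Pos (- b) → Pos (a + b)
  pos-+-nonneg {a} {b} p q with pos-tri b
  ... | inj₁ r           = pos-+ p r
  ... | inj₂ (inj₁ refl) = subst Pos (sym (idʳ a)) p
  ... | inj₂ (inj₂ r)    = ⊥-elim (q r)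

  -- With `v` the position of a root and `P` the side on which it lies, this finds the root nearest
  -- to a point on that side.
  argmax : ∀ {X : Set} (xs : List X) (v : X → Carrier) (P : X → Set ℓ) →
           (Σ X λ x → x ∈ xs × P x) →
           Σ X λ x → x ∈ xs × P x × (∀ y → y ∈ xs → P y → ¬ Pos (v y + - v x))
  argmax {X} (z ∷ xs) v P start with em {Σ X λ x → x ∈ xs × P x}
  argmax {X} (z ∷ xs) v P (x , here refl , p) | no none =
    x , here refl , p , λ { y (here refl) _ r → pos-irr (subst Pos (invʳ (v y)) r)
                          ; y (there y∈) q _ → none (y , y∈ , q) }
  argmax {X} (z ∷ xs) v P (x , there x∈ , p) | no none = ⊥-elim (none (x , x∈ , p))
  argmax {X} (z ∷ xs) v P start | yes some with argmax xs v P some | em {P z × Pos (v z + - v (proj₁ (argmax xs v P some)))}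
  ... | x , x∈ , p , max | no worse =
    x , there x∈ , p , λ { y (here refl) q r → worse (q , r) ; y (there y∈) q → max y y∈ q }
  ... | x , x∈ , p , max | yes (q , better) =
    z , here refl , q , λ { y (here refl) _ r → pos-irr (subst Pos (invʳ (v y)) r)
                          ; y (there y∈) q′ r → max y y∈ q′ (subst Pos
                              (solve [] (v y ∷ v z ∷ v x ∷ []) ((v₀ ⊞ ⊟ v₁) ⊞ (v₁ ⊞ ⊟ v₂)) (v₀ ⊞ ⊟ v₂) (refl , refl , refl , tt))
                              (pos-+ r better)) }

  forms : ∀ n → ℕ → List (Form n)
  forms n N = List.cartesianProduct (vectors n N) (ints N)

  forms-bounded : ∀ {n N} {f : Form n} → f ∈ forms n N → Bounded N f
  forms-bounded {n} {N} p with ∈-cartesianProduct⁻ (vectors n N) (ints N) p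
  ... | l∈ , m∈ = vectors-bounded l∈ , ints-bounded m∈

  ∈-forms : ∀ {n N} (f : Form n) → Bounded N f →
            Σ (Form n) λ f′ → f′ ∈ forms n N × Bounded N f′ × (∀ x → val f x ≡ val f′ x)
  ∈-forms {n} {N} (l , m) (p , q) with ∈-vectors l p
  ... | l′ , l′∈ , eq = (l′ , m) , ∈-cartesianProduct⁺ l′∈ (∈-ints m q) ,
                        ((λ i → subst (λ k → abs k ≤ N) (eq i) (p i)) , q) ,
                        λ x → cong (_+ m · u) (lin-cong eq (λ _ → refl))

-- Extending an equivalence by one coordinate

module Extension {ℓ : Level} (em : ExcludedMiddle ℓ) (S : OrderedPair ℓ) (N : ℕ) (N≥1 : 1 ≤ N) where
  open OrderedPair S
  open OrderLemmas S
  open Classical em S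
  open Solver

  K : ℕ
  K = N !

  K≥1 : 1 ≤ K
  K≥1 = ℕₚ.1≤n! N

  N₁ : ℕ
  N₁ = K ℕ.* N

  K≤N₁ : K ≤ N₁
  K≤N₁ = subst (_≤ N₁) (ℕₚ.*-identityʳ K) (ℕₚ.*-monoʳ-≤ K N≥1)

  -- Both signs are recorded because a form with negative coefficient of the new coordinate rescales
  -- to the negative of one with leading coefficient `K`. The bound `N₁` accounts for multiplication
  -- by a cofactor of at most `K`.
  SameCut : ∀ {n} → Carrier → Vector Carrier n → Carrier → Vector Carrier n → Set ℓ
  SameCut a x a′ x′ = ∀ f → Bounded N₁ f →
      (Pos (pos K · a + val f x) ⇔ Pos (pos K · a′ + val f x′))
    × (Pos (- (pos K · a + val f x)) ⇔ Pos (- (pos K · a′ + val f x′)))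

  SameDiv : ∀ {n} → Carrier → Vector Carrier n → Carrier → Vector Carrier n → Set ℓ
  SameDiv a x a′ x′ = ∀ k f → k ≢ ℤ.0ℤ → abs k ≤ N → Bounded N f → ∀ h j → 1 ≤ j → j ≤ N →
    Div h j (k · a + val f x) ⇔ Div h j (k · a′ + val f x′)

  record Cofactor (k : ℕ) : Set where
    field
      q    : ℕ
      q≥1  : 1 ≤ q
      q≤K  : q ≤ K
      K≡qk : K ≡ q ℕ.* k

  cofactor : ∀ {k} → 1 ≤ k → k ≤ N → Cofactor k
  cofactor {k@(suc _)} k≥1 k≤N with ∣! k≥1 k≤N
  ... | divides zero    eq = ⊥-elim (ℕₚ.<⇒≢ K≥1 (sym eq))
  ... | divides (suc q) eq = record
    { q = suc q ; q≥1 = s≤s z≤n ; K≡qk = eq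
    ; q≤K = subst (suc q ≤_) (sym eq) (ℕₚ.m≤m*n (suc q) k) }

  module _ {k : ℕ} (c : Cofactor k) {n : ℕ} (f : Form n) (a : Carrier) (x : Vector Carrier n) where
    open Cofactor c
    open ≡-Reasoning

    private
      K· : pos K · a ≡ (pos q ℤ.* pos k) · a
      K· = cong (_· a) (trans (cong pos K≡qk) (ℤₚ.pos-* q k))

    rescale : pos q · (pos k · a + val f x) ≡ pos K · a + val (pos q *ᶠ f) x
    rescale = begin
      pos q · (pos k · a + val f x)             ≡⟨ solve (pos q ∷ pos k ∷ []) (a ∷ val f x ∷ [])
                                                     (k₀ ⊡ (k₁ ⊡ v₀ ⊞ v₁)) ((k₀ :* k₁) ⊡ v₀ ⊞ k₀ ⊡ v₁) (refl , refl , tt) ⟩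
      (pos q ℤ.* pos k) · a + pos q · val f x   ≡⟨ cong₂ _+_ K· (val-* (pos q) f x) ⟨
      pos K · a + val (pos q *ᶠ f) x            ∎

    rescale-neg : pos q · (- (pos k · a) + val f x) ≡ - (pos K · a + val ((ℤ.- pos q) *ᶠ f) x)
    rescale-neg = begin
      pos q · (- (pos k · a) + val f x)                       ≡⟨ solve (pos q ∷ pos k ∷ []) (a ∷ val f x ∷ [])
                                                                   (k₀ ⊡ (⊟ (k₁ ⊡ v₀) ⊞ v₁))
                                                                   (⊟ ((k₀ :* k₁) ⊡ v₀ ⊞ (:- k₀) ⊡ v₁)) (refl , refl , tt) ⟩
      - ((pos q ℤ.* pos k) · a + (ℤ.- pos q) · val f x)       ≡⟨ cong -_ (cong₂ _+_ K· (val-* (ℤ.- pos q) f x)) ⟨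
      - (pos K · a + val ((ℤ.- pos q) *ᶠ f) x)                ∎

  bounded-q : ∀ {k n} (c : Cofactor k) (f : Form n) → Bounded N f → Bounded N₁ (pos (Cofactor.q c) *ᶠ f)
  bounded-q c f b = bounded-* (pos (Cofactor.q c)) f (Cofactor.q≤K c) b

  bounded-neg-q : ∀ {k n} (c : Cofactor k) (f : Form n) → Bounded N f → Bounded N₁ ((ℤ.- pos (Cofactor.q c)) *ᶠ f)
  bounded-neg-q c f b = bounded-* (ℤ.- pos (Cofactor.q c)) f (subst (_≤ K) (sym (ℤₚ.∣-i∣≡∣i∣ (pos (Cofactor.q c)))) (Cofactor.q≤K c)) b

  cut-at : ∀ {n a a′} {x x′ : Vector Carrier n} → SameCut a x a′ x′ →
           ∀ k f → k ≢ ℤ.0ℤ → abs k ≤ N → Bounded N f → Pos (k · a + val f x) ⇔ Pos (k · a′ + val f x′)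
  cut-at cut (pos zero) f k≢0 k≤N b = ⊥-elim (k≢0 refl)
  cut-at {a = a} {a′} {x} {x′} cut (pos k@(suc _)) f k≢0 k≤N b =
    ⇔-trans (side a x) (⇔-trans (proj₁ (cut (pos q *ᶠ f) (bounded-q c f b))) (⇔-sym (side a′ x′)))
    where
    c = cofactor (s≤s z≤n) k≤N
    open Cofactor c
    side : ∀ a x → Pos (pos k · a + val f x) ⇔ Pos (pos K · a + val (pos q *ᶠ f) x)
    side a x = ⇔-trans (pos-scale⇔ q q≥1 _) (≡⇒⇔ Pos (rescale c f a x))
  cut-at {a = a} {a′} {x} {x′} cut -[1+ k-1 ] f k≢0 k≤N b =
    ⇔-trans (side a x) (⇔-trans (proj₂ (cut ((ℤ.- pos q) *ᶠ f) (bounded-neg-q c f b))) (⇔-sym (side a′ x′)))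
    where
    c = cofactor {suc k-1} (s≤s z≤n) k≤N
    open Cofactor c
    side : ∀ a x → Pos (-[1+ k-1 ] · a + val f x) ⇔ Pos (- (pos K · a + val ((ℤ.- pos q) *ᶠ f) x))
    side a x = ⇔-trans (pos-scale⇔ q q≥1 _) (≡⇒⇔ Pos (rescale-neg c f a x))

  -- Split on the coefficient of the new coordinate: if it is 0, the old equivalence applies to the
  -- remaining form; otherwise the cut gives the sign and `SameDiv` the divisibility.
  extend : ∀ {n a a′} {x x′ : Vector Carrier n} → Eqv N x x′ → SameCut a x a′ x′ → SameDiv a x a′ x′ →
           Eqv N (a VF.∷ x) (a′ VF.∷ x′)
  extend {n} {a} {a′} {x} {x′} eqv cut sdiv f b = byCoefficient (proj₁ f zero) refl
    where
    Goal : Carrier → Carrier → Set ℓ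
    Goal y y′ = (Pos y ⇔ Pos y′) × (∀ h k → 1 ≤ k → k ≤ N → Div h k y ⇔ Div h k y′)

    split : ∀ a x {k} → proj₁ f zero ≡ k → k · a + val (tail f) x ≡ val f (a VF.∷ x)
    split a x refl = sym (val-∷ f a x)

    b′ : Bounded N (tail f)
    b′ = bounded-tail f b

    k≤N : ∀ {k} → proj₁ f zero ≡ k → abs k ≤ N
    k≤N refl = proj₁ b zero

    nonzero : ∀ k → k ≢ ℤ.0ℤ → proj₁ f zero ≡ k → Goal (val f (a VF.∷ x)) (val f (a′ VF.∷ x′))
    nonzero k k≢0 eq = subst₂ Goal (split a x eq) (split a′ x′ eq)
      ( cut-at cut k (tail f) k≢0 (k≤N eq) b′
      , λ h j p q → sdiv k (tail f) k≢0 (k≤N eq) b′ h j p q )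

    byCoefficient : ∀ k → proj₁ f zero ≡ k → Goal (val f (a VF.∷ x)) (val f (a′ VF.∷ x′))
    byCoefficient (pos zero)    eq = subst₂ Goal (trans (sym (idˡ _)) (split a x eq)) (trans (sym (idˡ _)) (split a′ x′ eq))
                                       (eqv (tail f) b′)
    byCoefficient k@(pos (suc _)) eq = nonzero k (λ ()) eq
    byCoefficient k@(-[1+ _ ])    eq = nonzero k (λ ()) eq

  -- Multiplying k a + v by `K` and substituting K a = K² g - w leaves K v - k w plus k K² g. As j
  -- divides `K`, the last term lies in K j H, so only K v - k w matters, and `a` has disappeared.
  sameDiv-coset : ∀ {n a a′ w w′ g g′} {x x′ : Vector Carrier n} → G g → G g′ →
    pos K · a + w ≡ pos K · pos K · g → pos K · a′ + w′ ≡ pos K · pos K · g′ →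
    (∀ k f → abs k ≤ N → Bounded N f → ∀ h j → 1 ≤ j → j ≤ N →
      Div h (K ℕ.* j) (pos K · val f x + - (k · w)) ⇔ Div h (K ℕ.* j) (pos K · val f x′ + - (k · w′))) →
    SameDiv a x a′ x′
  sameDiv-coset {x = x} {x′} Gg Gg′ eq eq′ same k f _ k≤N b h j j≥1 j≤N =
    ⇔-trans (side (val f x) Gg eq) (⇔-trans (same k f k≤N b h j j≥1 j≤N) (⇔-sym (side (val f x′) Gg′ eq′)))
    where
    side : ∀ {a w g} v → G g → pos K · a + w ≡ pos K · pos K · g →
           Div h j (k · a + v) ⇔ Div h (K ℕ.* j) (pos K · v + - (k · w))
    side {a} {w} {g} v Gg eq = ⇔-trans (Div-scale K j K≥1 (k · a + v)) (⇔-trans (≡⇒⇔ (Div h (K ℕ.* j)) e)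
      (⇔-sym (Div-shift (pos K · v + - (k · w)) (k · pos K · pos K · g)
               (Div-· k (to (Div-scale K j K≥1 (pos K · g)) (Div-multiple h (∣! j≥1 j≤N) (G⇒H h Gg)))))))
      where
      e : pos K · (k · a + v) ≡ (pos K · v + - (k · w)) + k · pos K · pos K · g
      e = trans (solve (pos K ∷ k ∷ []) (a ∷ v ∷ w ∷ []) (k₀ ⊡ (k₁ ⊡ v₀ ⊞ v₁))
                  ((k₀ ⊡ v₁ ⊞ ⊟ (k₁ ⊡ v₂)) ⊞ k₁ ⊡ (k₀ ⊡ v₀ ⊞ v₂)) (refl , refl , refl , tt))
                (cong (λ z → (pos K · v + - (k · w)) + k · z) eq)

  coset-leading : ∀ {n a} {x : Vector Carrier n} k f → k ≢ ℤ.0ℤ → abs k ≤ N → Bounded N f → G (k · a + val f x) →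
                  Σ (Form n) λ f′ → Bounded N₁ f′ × G (pos K · a + val f′ x)
  coset-leading (pos zero) f k≢0 k≤N b Gf = ⊥-elim (k≢0 refl)
  coset-leading {a = a} {x} (pos k@(suc _)) f k≢0 k≤N b Gf =
    pos q *ᶠ f , bounded-q c f b , subst G (rescale c f a x) (H-·ℕ true q Gf)
    where
    c = cofactor (s≤s z≤n) k≤N
    open Cofactor c
  coset-leading {a = a} {x} -[1+ k-1 ] f k≢0 k≤N b Gf =
    (ℤ.- pos q) *ᶠ f , bounded-neg-q c f b ,
    subst G (trans (cong -_ (rescale-neg c f a x)) (neg-neg _)) (G-neg (H-·ℕ true q Gf))
    where
    c = cofactor {suc k-1} (s≤s z≤n) k≤N
    open Cofactor c

  -- A multiple in `G` with any coefficient k would rescale to one with leading coefficient `K`, so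
  -- divisibility in `G` fails on both sides. Divisibility in L by j, a divisor of `K`, sees `a`
  -- only through its residue i u.
  sameDiv-generic : ∀ {n a a′ b b′} {x x′ : Vector Carrier n} (i : ℤ) →
    a ≡ pos K · b + i · u → a′ ≡ pos K · b′ + i · u →
    (∀ f → Bounded N₁ f → ¬ G (pos K · a + val f x)) →
    (∀ f → Bounded N₁ f → ¬ G (pos K · a′ + val f x′)) →
    (∀ k f → abs k ≤ N → Bounded N f → ∀ j → 1 ≤ j → j ≤ N →
      Div false j (val f x + (k ℤ.* i) · u) ⇔ Div false j (val f x′ + (k ℤ.* i) · u)) →
    SameDiv a x a′ x′
  sameDiv-generic i _ _ ¬G ¬G′ same k f k≢0 k≤N bf true j j≥1 j≤N =
    mk⇔ (λ d → ⊥-elim (absurd ¬G d)) (λ d → ⊥-elim (absurd ¬G′ d))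
    where
    absurd : ∀ {a x} → (∀ f → Bounded N₁ f → ¬ G (pos K · a + val f x)) → ¬ Div true j (k · a + val f x)
    absurd ¬G d with coset-leading k f k≢0 k≤N bf (Div⇒H d)
    ... | f′ , b′ , Gf′ = ¬G f′ b′ Gf′
  sameDiv-generic {x = x} {x′} i eq eq′ ¬G ¬G′ same k f k≢0 k≤N bf false j j≥1 j≤N =
    ⇔-trans (side (val f x) eq) (⇔-trans (same k f k≤N bf j j≥1 j≤N) (⇔-sym (side (val f x′) eq′)))
    where
    side : ∀ {a b} v → a ≡ pos K · b + i · u → Div false j (k · a + v) ⇔ Div false j (v + (k ℤ.* i) · u)
    side {a} {b} v refl = ⇔-trans
      (≡⇒⇔ (Div false j) (solve (pos K ∷ k ∷ i ∷ []) (b ∷ u ∷ v ∷ [])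
         (k₁ ⊡ (k₀ ⊡ v₀ ⊞ k₂ ⊡ v₁) ⊞ v₂) ((v₂ ⊞ (k₁ :* k₂) ⊡ v₁) ⊞ k₁ ⊡ k₀ ⊡ v₀) (refl , refl , refl , tt)))
      (⇔-sym (Div-shift (v + (k ℤ.* i) · u) (k · pos K · b) (Div-· k (Div-multiple false (∣! j≥1 j≤N) (lift tt)))))

-- The back-and-forth step

module Step {ℓ : Level} (em : ExcludedMiddle ℓ) (S : OrderedPair ℓ) (N : ℕ) (N≥1 : 1 ≤ N) where
  open OrderedPair S
  open OrderLemmas S
  open Classical em S
  open Extension em S N N≥1
  open Solver

  -- A form bounded by `N₁` whose constant is shifted by at most K², as needed to move an element of
  -- `G` into K² G.
  N₂ : ℕ
  N₂ = N₁ ℕ.+ K ℕ.* K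

  -- The bounds on forms and moduli to which the given equivalence is applied below; their sum
  -- dominates each of them.
  bounds : List ℕ
  bounds = N ∷ K ∷ N₂ ∷ N₁ ℕ.+ 1 ℕ.* N₁ ∷ K ℕ.* N ℕ.+ N ℕ.* N₂ ∷ N ℕ.+ N ℕ.* K ∷ []

  N′ : ℕ
  N′ = sum bounds

  neg-form : ∀ {n M} (f : Form n) → Bounded M f → Bounded (1 ℕ.* M) (-[1+ 0 ] *ᶠ f)
  neg-form f b = bounded-* -[1+ 0 ] f ℕₚ.≤-refl b

  val-neg : ∀ {n} (f : Form n) x → val (-[1+ 0 ] *ᶠ f) x ≡ - val f x
  val-neg f x = trans (val-* -[1+ 0 ] f x) (cong -_ (1· (val f x)))

  module _ {n : ℕ} {x x′ : Vector Carrier n} (eqv : Eqv N′ x x′) where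

    eqv-N : Eqv N x x′
    eqv-N = Eqv-mono (∈⇒≤sum {ns = bounds} (here refl)) eqv

    -- This carries the order of the points -f(x)/K over to x′.
    pos-diff : ∀ f g → Bounded N₁ f → Bounded N₁ g → Pos (val f x + - val g x) ⇔ Pos (val f x′ + - val g x′)
    pos-diff f g bf bg = ⇔-trans (≡⇒⇔ Pos (sym (eq x)))
      (⇔-trans (proj₁ (eqv h (bounded-mono h (∈⇒≤sum {ns = bounds} (there (there (there (here refl)))))
                              (bounded-+ f (-[1+ 0 ] *ᶠ g) bf (neg-form g bg)))))
               (≡⇒⇔ Pos (eq x′)))
      where
      h = f +ᶠ -[1+ 0 ] *ᶠ g
      eq : ∀ x → val h x ≡ val f x + - val g x
      eq x = trans (val-+ f (-[1+ 0 ] *ᶠ g) x) (cong (val f x +_) (val-neg g x))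

    root : ∀ f → Bounded N₂ f → Div false K (val f x) → Div false K (val f x′)
    root f b = to (proj₂ (eqv f (bounded-mono f (∈⇒≤sum {ns = bounds} (there (there (here refl)))) b))
                     false K K≥1 (∈⇒≤sum {ns = bounds} (there (here refl))))

    div-coset : ∀ f₀ → Bounded N₂ f₀ → ∀ k f → abs k ≤ N → Bounded N f → ∀ h j → 1 ≤ j → j ≤ N →
      Div h (K ℕ.* j) (pos K · val f x + - (k · val f₀ x)) ⇔ Div h (K ℕ.* j) (pos K · val f x′ + - (k · val f₀ x′))
    div-coset f₀ b₀ k f k≤N b h j j≥1 j≤N = ⇔-trans (≡⇒⇔ (Div h (K ℕ.* j)) (sym (eq x)))
      (⇔-trans (proj₂ (eqv g (bounded-mono g (∈⇒≤sum {ns = bounds} (there (there (there (there (here refl))))))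
                  (bounded-+ (pos K *ᶠ f) ((ℤ.- k) *ᶠ f₀) (bounded-* (pos K) f ℕₚ.≤-refl b)
                     (bounded-* (ℤ.- k) f₀ (subst (_≤ N) (sym (ℤₚ.∣-i∣≡∣i∣ k)) k≤N) b₀))))
                h (K ℕ.* j) (ℕₚ.*-mono-≤ K≥1 j≥1)
                (ℕₚ.≤-trans (ℕₚ.≤-trans (ℕₚ.*-monoʳ-≤ K j≤N) (ℕₚ.m≤m+n N₁ (K ℕ.* K)))
                            (∈⇒≤sum {ns = bounds} (there (there (here refl))))))
               (≡⇒⇔ (Div h (K ℕ.* j)) (eq x′)))
      where
      g = pos K *ᶠ f +ᶠ (ℤ.- k) *ᶠ f₀
      eq : ∀ x → val g x ≡ pos K · val f x + - (k · val f₀ x)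
      eq x = trans (val-+ (pos K *ᶠ f) ((ℤ.- k) *ᶠ f₀) x)
                   (cong₂ _+_ (val-* (pos K) f x) (trans (val-* (ℤ.- k) f₀ x) (neg-· k _)))

    div-const : ∀ i → abs i ≤ K → ∀ k f → abs k ≤ N → Bounded N f → ∀ j → 1 ≤ j → j ≤ N →
      Div false j (val f x + (k ℤ.* i) · u) ⇔ Div false j (val f x′ + (k ℤ.* i) · u)
    div-const i i≤K k f k≤N b j j≥1 j≤N = ⇔-trans (≡⇒⇔ (Div false j) (sym (eq x)))
      (⇔-trans (proj₂ (eqv g (bounded-mono g (∈⇒≤sum {ns = bounds} (there (there (there (there (there (here refl)))))))
                  (bounded-+ f (const (k ℤ.* i)) b (bounded-const (k ℤ.* i) (abs-*-≤ k i k≤N i≤K)))))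
                false j j≥1 (ℕₚ.≤-trans j≤N (∈⇒≤sum {ns = bounds} (here refl))))
               (≡⇒⇔ (Div false j) (eq x′)))
      where
      g = f +ᶠ const (k ℤ.* i)
      eq : ∀ x → val g x ≡ val f x + (k ℤ.* i) · u
      eq x = trans (val-+ f (const (k ℤ.* i)) x) (cong (val f x +_) (val-const (k ℤ.* i) x))

    module _ (a : Carrier) (a≥0 : ¬ Pos (- a)) (a<u : Pos (u + - a)) where

      -- Here f(x) = -K a is divisible by `K`, hence so is f(x′) = K w, which forces a′ = -w. Each K
      -- a + g(x) is then the difference g(x) - f(x) of known forms, and for divisibility the pair
      -- sits in the coset with g = 0.
      root-case : ∀ f → Bounded N₁ f → pos K · a + val f x ≡ 𝟘 → Σ Carrier λ a′ → Eqv N (a VF.∷ x) (a′ VF.∷ x′)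
      root-case f b eq with root f bC (quot (- a) (lift tt) (trans (neg-unique _ _ eq) (sym (·-neg (pos K) a))))
        where
        bC : Bounded N₂ f
        bC = bounded-mono f (ℕₚ.m≤m+n N₁ (K ℕ.* K)) b
      ... | quot w _ eq′ = - w , extend eqv-N cut sdiv
        where
        eq″ : pos K · (- w) + val f x′ ≡ 𝟘
        eq″ = trans (cong₂ _+_ (·-neg (pos K) w) eq′) (invˡ _)
        K·K·𝟘 : pos K · pos K · 𝟘 ≡ 𝟘
        K·K·𝟘 = trans (cong (pos K ·_) (·-𝟘 (pos K))) (·-𝟘 (pos K))
        sdiv = sameDiv-coset G-𝟘 G-𝟘 (trans eq (sym K·K·𝟘)) (trans eq″ (sym K·K·𝟘))
                 (div-coset f (bounded-mono f (ℕₚ.m≤m+n N₁ (K ℕ.* K)) b))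
        ahead : ∀ a x → pos K · a + val f x ≡ 𝟘 → ∀ g → val g x + - val f x ≡ pos K · a + val g x
        ahead a x eq g = trans (sym (idʳ _)) (trans (cong (val g x + - val f x +_) (sym eq))
          (solve (pos K ∷ []) (a ∷ val f x ∷ val g x ∷ []) ((v₂ ⊞ ⊟ v₁) ⊞ (k₀ ⊡ v₀ ⊞ v₁)) (k₀ ⊡ v₀ ⊞ v₂)
                 (refl , refl , refl , tt)))
        behind : ∀ a x → pos K · a + val f x ≡ 𝟘 → ∀ g → val f x + - val g x ≡ - (pos K · a + val g x)
        behind a x eq g = trans (solve [] (val f x ∷ val g x ∷ []) (v₀ ⊞ ⊟ v₁) (⊟ (v₁ ⊞ ⊟ v₀)) (refl , refl , tt))
                                (cong -_ (ahead a x eq g))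
        cut : SameCut a x (- w) x′
        cut g bg =
          ⇔-trans (≡⇒⇔ Pos (sym (ahead a x eq g))) (⇔-trans (pos-diff g f bg b) (≡⇒⇔ Pos (ahead (- w) x′ eq″ g))) ,
          ⇔-trans (≡⇒⇔ Pos (sym (behind a x eq g))) (⇔-trans (pos-diff f g b bg) (≡⇒⇔ Pos (behind (- w) x′ eq″ g)))

      record Window : Set ℓ where
        field
          low high : Carrier
          open-interval : Pos (high + - low)
          inside : ∀ a′ → Pos (pos K · a′ + - low) → Pos (high + - (pos K · a′)) → SameCut a x a′ x′

      Above Below : Form n → Set ℓ
      Above f = Bounded N₁ f × Pos (pos K · a + val f x)
      Below f = Bounded N₁ f × Pos (- (pos K · a + val f x))

      module _ (nz : ∀ f → Bounded N₁ f → pos K · a + val f x ≢ 𝟘)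
               (lo hi : Form n) (lo-above : Above lo) (hi-below : Below hi)
               (lowest  : ∀ f → f ∈ forms n N₁ → Above f → ¬ Pos (- val f x′ + - (- val lo x′)))
               (highest : ∀ f → f ∈ forms n N₁ → Below f → ¬ Pos (val f x′ + - val hi x′)) where

        -- Adding the two strict inequalities eliminates `a` and leaves lo(x) - hi(x) > 0, a sign
        -- condition that passes to x′.
        window-open : Pos (- val hi x′ + - (- val lo x′))
        window-open = subst Pos (solve [] (val lo x′ ∷ val hi x′ ∷ []) (v₀ ⊞ ⊟ v₁) (⊟ v₁ ⊞ ⊟ (⊟ v₀)) (refl , refl , tt))
            (to (pos-diff lo hi (proj₁ lo-above) (proj₁ hi-below))
              (subst Pos (solve (pos K ∷ []) (val lo x ∷ val hi x ∷ a ∷ [])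
                            ((k₀ ⊡ v₂ ⊞ v₀) ⊞ ⊟ (k₀ ⊡ v₂ ⊞ v₁)) (v₀ ⊞ ⊟ v₁) (refl , refl , refl , tt))
                 (pos-+ (proj₂ lo-above) (proj₂ hi-below))))

        -- By extremality of `lo` and `hi`, no -f(x′) lies inside the window. Each form thus keeps
        -- its side, and the converse implications follow since `nz` excludes zeros for `a`.
        window-inside : ∀ a′ → Pos (pos K · a′ + - (- val lo x′)) → Pos (- val hi x′ + - (pos K · a′)) → SameCut a x a′ x′
        window-inside a′ p q f bf with ∈-forms f bf
        ... | f′ , f′∈ , bf′ , eq = mk⇔ up up⁻ , mk⇔ down down⁻
          where
          up : Pos (pos K · a + val f x) → Pos (pos K · a′ + val f x′)
          up r = subst Pos (trans (solve (pos K ∷ []) (a′ ∷ val lo x′ ∷ val f′ x′ ∷ [])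
                               ((k₀ ⊡ v₀ ⊞ ⊟ (⊟ v₁)) ⊞ (⊟ v₁ ⊞ ⊟ (⊟ v₂))) (k₀ ⊡ v₀ ⊞ v₂) (refl , refl , refl , tt))
                               (cong (pos K · a′ +_) (sym (eq x′))))
            (pos-+-nonneg p λ s → lowest f′ f′∈ (bf′ , subst (λ z → Pos (pos K · a + z)) (eq x) r)
              (subst Pos (solve [] (val lo x′ ∷ val f′ x′ ∷ []) (⊟ (⊟ v₀ ⊞ ⊟ (⊟ v₁))) (⊟ v₁ ⊞ ⊟ (⊟ v₀)) (refl , refl , tt)) s))
          down : Pos (- (pos K · a + val f x)) → Pos (- (pos K · a′ + val f x′))
          down r = subst Pos (trans (solve (pos K ∷ []) (a′ ∷ val hi x′ ∷ val f′ x′ ∷ [])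
                               ((⊟ v₁ ⊞ ⊟ (k₀ ⊡ v₀)) ⊞ (v₁ ⊞ ⊟ v₂)) (⊟ (k₀ ⊡ v₀ ⊞ v₂)) (refl , refl , refl , tt))
                               (cong (λ z → - (pos K · a′ + z)) (sym (eq x′))))
            (pos-+-nonneg q λ s → highest f′ f′∈ (bf′ , subst (λ z → Pos (- (pos K · a + z))) (eq x) r)
              (subst Pos (solve [] (val hi x′ ∷ val f′ x′ ∷ []) (⊟ (v₀ ⊞ ⊟ v₁)) (v₁ ⊞ ⊟ v₀) (refl , refl , tt)) s))
          up⁻ : Pos (pos K · a′ + val f x′) → Pos (pos K · a + val f x)
          up⁻ r with pos-tri (pos K · a + val f x)
          ... | inj₁ s        = s
          ... | inj₂ (inj₁ e) = ⊥-elim (nz f bf e)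
          ... | inj₂ (inj₂ s) = ⊥-elim (pos-asym r (down s))
          down⁻ : Pos (- (pos K · a′ + val f x′)) → Pos (- (pos K · a + val f x))
          down⁻ r with pos-tri (pos K · a + val f x)
          ... | inj₁ s        = ⊥-elim (pos-asym (up s) r)
          ... | inj₂ (inj₁ e) = ⊥-elim (nz f bf e)
          ... | inj₂ (inj₂ s) = s

      -- Forms are sorted by their side of `a` at x but compared by their values at x′. Both sides
      -- are inhabited because 0 < a < u: the constant forms 0 and -K u give K a > 0 and K a - K u <
      -- 0.
      window : (∀ f → Bounded N₁ f → pos K · a + val f x ≢ 𝟘) → Window
      window nz with argmax (forms n N₁) (λ f → - val f x′) Above above | argmax (forms n N₁) (λ f → val f x′) Below below
        where
        listed : ∀ (Q : Carrier → Set ℓ) f → Bounded N₁ f → Q (val f x) →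
                 Σ (Form n) λ f → f ∈ forms n N₁ × Bounded N₁ f × Q (val f x)
        listed Q f b q with ∈-forms f b
        ... | f′ , f′∈ , b′ , eq = f′ , f′∈ , b′ , subst Q (eq x) q

        above : Σ (Form n) λ f → f ∈ forms n N₁ × Above f
        above = listed (λ z → Pos (pos K · a + z)) (const ℤ.0ℤ) (bounded-const {n} ℤ.0ℤ z≤n) positive
          where
          a≢𝟘 : a ≢ 𝟘
          a≢𝟘 refl = nz (const ℤ.0ℤ) (bounded-const {n} ℤ.0ℤ z≤n)
            (trans (cong₂ _+_ (·-𝟘 (pos K)) (val-const ℤ.0ℤ x)) (idˡ 𝟘))
          positive : Pos (pos K · a + val (const ℤ.0ℤ) x)
          positive with pos-tri a
          ... | inj₁ p        = subst Pos (sym (trans (cong (pos K · a +_) (val-const ℤ.0ℤ x)) (idʳ _))) (pos-scale K K≥1 p)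
          ... | inj₂ (inj₁ e) = ⊥-elim (a≢𝟘 e)
          ... | inj₂ (inj₂ p) = ⊥-elim (a≥0 p)

        below : Σ (Form n) λ f → f ∈ forms n N₁ × Below f
        below = listed (λ z → Pos (- (pos K · a + z))) (const (ℤ.- pos K)) (bounded-const {n} (ℤ.- pos K)
            (subst (_≤ N₁) (sym (ℤₚ.∣-i∣≡∣i∣ (pos K))) K≤N₁))
          (subst Pos (trans (solve (pos K ∷ []) (a ∷ u ∷ []) (k₀ ⊡ (v₁ ⊞ ⊟ v₀)) (⊟ (k₀ ⊡ v₀ ⊞ (:- k₀) ⊡ v₁)) (refl , refl , tt))
                            (cong (λ z → - (pos K · a + z)) (sym (val-const (ℤ.- pos K) x))))
             (pos-scale K K≥1 a<u))

      ... | lo , _ , lo-above , lowest | hi , _ , hi-below , highest = record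
        { low           = - val lo x′
        ; high          = - val hi x′
        ; open-interval = window-open nz lo hi lo-above hi-below lowest highest
        ; inside        = window-inside nz lo hi lo-above hi-below lowest highest }

      -- Adding i u to f yields f₀ with K a + f₀(x) = K² g. Then f₀(x) = K (K g - a), so f₀(x′) = K
      -- w for some w. Every a′ = K g′ - w with g′ in `G` satisfies K a′ + f₀(x′) = K² g′, and
      -- density of K² G places K a′ in the window.
      coset-case : Window → ∀ f → Bounded N₁ f → G (pos K · a + val f x) → Σ Carrier λ a′ → Eqv N (a VF.∷ x) (a′ VF.∷ x′)
      coset-case win f b Gf with divisible% true (K ℕ.* K) (ℕₚ.*-mono-≤ K≥1 K≥1) Gf
      ... | i , i≤ , quot g Gg eq with root f₀ b₀ (quot (pos K · g + - a) (lift tt) root-eq)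
        where
        open ≡-Reasoning
        f₀ = f +ᶠ const (pos i)
        b₀ = bounded-+ f (const (pos i)) b (bounded-const {n} (pos i) i≤)
        root-eq : val f₀ x ≡ pos K · (pos K · g + - a)
        root-eq = begin
          val f₀ x                                   ≡⟨ trans (val-+ f (const (pos i)) x) (cong (val f x +_) (val-const (pos i) x)) ⟩
          val f x + pos i · u                        ≡⟨ solve (pos K ∷ pos i ∷ []) (a ∷ val f x ∷ u ∷ []) (v₁ ⊞ k₁ ⊡ v₂)
                                                          ((k₀ ⊡ v₀ ⊞ v₁ ⊞ k₁ ⊡ v₂) ⊞ ⊟ (k₀ ⊡ v₀)) (refl , refl , refl , tt) ⟩
          pos K · a + val f x + pos i · u + - (pos K · a) ≡⟨ cong (_+ - (pos K · a)) eq ⟩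
          pos (K ℕ.* K) · g + - (pos K · a)          ≡⟨ cong (λ k → k · g + - (pos K · a)) (ℤₚ.pos-* K K) ⟩
          (pos K ℤ.* pos K) · g + - (pos K · a)      ≡⟨ solve (pos K ∷ []) (a ∷ g ∷ []) ((k₀ :* k₀) ⊡ v₁ ⊞ ⊟ (k₀ ⊡ v₀))
                                                          (k₀ ⊡ (k₀ ⊡ v₁ ⊞ ⊟ v₀)) (refl , refl , tt) ⟩
          pos K · (pos K · g + - a)                  ∎
      ... | quot w _ eq′ with dense (K ℕ.* K) (ℕₚ.*-mono-≤ K≥1 K≥1) (low + pos K · w) (high + pos K · w)
              (subst Pos (solve [] (low ∷ high ∷ pos K · w ∷ []) (v₁ ⊞ ⊟ v₀) ((v₁ ⊞ v₂) ⊞ ⊟ (v₀ ⊞ v₂)) (refl , refl , refl , tt)) open-interval)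
        where open Window win
      ... | g′ , Gg′ , p , q = a′ , extend eqv-N (inside a′ p′ q′) (sameDiv-coset Gg Gg′ eqₐ eqₐ′ (div-coset f₀ b₀))
        where
        open Window win
        open ≡-Reasoning
        f₀ = f +ᶠ const (pos i)
        b₀ = bounded-+ f (const (pos i)) b (bounded-const {n} (pos i) i≤)
        a′ = pos K · g′ + - w
        KK : ∀ g → pos (K ℕ.* K) · g ≡ pos K · pos K · g
        KK g = trans (cong (_· g) (ℤₚ.pos-* K K)) (·-* (pos K) (pos K) g)
        p′ : Pos (pos K · a′ + - low)
        p′ = subst Pos (trans (cong (_+ - (low + pos K · w)) (KK g′))
               (solve (pos K ∷ []) (g′ ∷ w ∷ low ∷ []) (k₀ ⊡ k₀ ⊡ v₀ ⊞ ⊟ (v₂ ⊞ k₀ ⊡ v₁)) (k₀ ⊡ (k₀ ⊡ v₀ ⊞ ⊟ v₁) ⊞ ⊟ v₂)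
                 (refl , refl , refl , tt))) p
        q′ : Pos (high + - (pos K · a′))
        q′ = subst Pos (trans (cong (λ z → (high + pos K · w) + - z) (KK g′))
               (solve (pos K ∷ []) (g′ ∷ w ∷ high ∷ []) ((v₂ ⊞ k₀ ⊡ v₁) ⊞ ⊟ (k₀ ⊡ k₀ ⊡ v₀)) (v₂ ⊞ ⊟ (k₀ ⊡ (k₀ ⊡ v₀ ⊞ ⊟ v₁)))
                 (refl , refl , refl , tt))) q
        eqₐ : pos K · a + val f₀ x ≡ pos K · pos K · g
        eqₐ = begin
          pos K · a + val f₀ x                  ≡⟨ cong (pos K · a +_) (trans (val-+ f (const (pos i)) x) (cong (val f x +_) (val-const (pos i) x))) ⟩
          pos K · a + (val f x + pos i · u)     ≡⟨ assoc _ _ _ ⟨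
          pos K · a + val f x + pos i · u       ≡⟨ eq ⟩
          pos (K ℕ.* K) · g                     ≡⟨ KK g ⟩
          pos K · pos K · g                     ∎
        eqₐ′ : pos K · a′ + val f₀ x′ ≡ pos K · pos K · g′
        eqₐ′ = trans (cong (pos K · a′ +_) eq′) (solve (pos K ∷ []) (g′ ∷ w ∷ [])
                 (k₀ ⊡ (k₀ ⊡ v₀ ⊞ ⊟ v₁) ⊞ k₀ ⊡ v₁) (k₀ ⊡ k₀ ⊡ v₀) (refl , refl , tt))


      record Candidate (low high c : Carrier) (i : ℤ) : Set ℓ where
        field
          a′ b γ    : Carrier
          congruent : a′ ≡ pos K · b + i · u
          Gγ        : G γ
          coset     : pos K · a′ ≡ c + γ
          above-low : Pos (pos K · a′ + - low)
          below-high : Pos (high + - (pos K · a′))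

      -- Dividing c twice by `K` modulo u gives y with K² y in c + G. The point K y + i u has the
      -- right residue, and K times it the right coset. Adding K g with g in `G` preserves both,
      -- while K² g can be chosen to land in the window.
      candidate : ∀ low high → Pos (high + - low) → ∀ c i → Candidate low high c i
      candidate low high lt c i with divisible false K K≥1 {c} (lift tt)
      ... | j , z , _ , z-eq with divisible false K K≥1 {z} (lift tt)
      ... | j′ , y , _ , y-eq with dense (K ℕ.* K) (ℕₚ.*-mono-≤ K≥1 K≥1)
                (low + - (pos K · (pos K · y + i · u))) (high + - (pos K · (pos K · y + i · u)))
                (subst Pos (solve [] (low ∷ high ∷ pos K · (pos K · y + i · u) ∷ [])
                   (v₁ ⊞ ⊟ v₀) ((v₁ ⊞ ⊟ v₂) ⊞ ⊟ (v₀ ⊞ ⊟ v₂)) (refl , refl , refl , tt)) lt)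
      ... | g , Gg , p , q = record
        { a′ = pos K · (y + g) + i · u
        ; b = y + g
        ; γ = j · u + pos K · (j′ · u + i · u + pos K · g)
        ; congruent = refl
        ; Gγ = G-+ (H-· true j G-u) (H-·ℕ true K (G-+ (G-+ (H-· true j′ G-u) (H-· true i G-u)) (H-·ℕ true K Gg)))
        ; coset = begin
            pos K · (pos K · (y + g) + i · u)
              ≡⟨ solve (pos K ∷ i ∷ []) (y ∷ g ∷ u ∷ []) (k₀ ⊡ (k₀ ⊡ (v₀ ⊞ v₁) ⊞ k₁ ⊡ v₂))
                   (k₀ ⊡ (k₀ ⊡ v₀ ⊞ k₁ ⊡ v₂ ⊞ k₀ ⊡ v₁)) (refl , refl , refl , tt) ⟩
            pos K · (pos K · y + i · u + pos K · g)
              ≡⟨ cong (λ t → pos K · (t + i · u + pos K · g)) y-eq ⟨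
            pos K · (z + j′ · u + i · u + pos K · g)
              ≡⟨ solve (pos K ∷ []) (z ∷ j′ · u ∷ i · u ∷ g ∷ []) (k₀ ⊡ (v₀ ⊞ v₁ ⊞ v₂ ⊞ k₀ ⊡ v₃))
                   (k₀ ⊡ v₀ ⊞ k₀ ⊡ (v₁ ⊞ v₂ ⊞ k₀ ⊡ v₃)) (refl , refl , refl , refl , tt) ⟩
            pos K · z + pos K · (j′ · u + i · u + pos K · g)
              ≡⟨ cong (_+ pos K · (j′ · u + i · u + pos K · g)) z-eq ⟨
            c + j · u + pos K · (j′ · u + i · u + pos K · g)
              ≡⟨ assoc _ _ _ ⟩
            c + (j · u + pos K · (j′ · u + i · u + pos K · g)) ∎
        ; above-low = subst Pos (trans (cong (_+ - (low + - (pos K · (pos K · y + i · u)))) KK)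
            (solve (pos K ∷ i ∷ []) (y ∷ g ∷ u ∷ low ∷ [])
              (k₀ ⊡ k₀ ⊡ v₁ ⊞ ⊟ (v₃ ⊞ ⊟ (k₀ ⊡ (k₀ ⊡ v₀ ⊞ k₁ ⊡ v₂)))) (k₀ ⊡ (k₀ ⊡ (v₀ ⊞ v₁) ⊞ k₁ ⊡ v₂) ⊞ ⊟ v₃)
              (refl , refl , refl , refl , tt))) p
        ; below-high = subst Pos (trans (cong (λ t → high + - (pos K · (pos K · y + i · u)) + - t) KK)
            (solve (pos K ∷ i ∷ []) (y ∷ g ∷ u ∷ high ∷ [])
              ((v₃ ⊞ ⊟ (k₀ ⊡ (k₀ ⊡ v₀ ⊞ k₁ ⊡ v₂))) ⊞ ⊟ (k₀ ⊡ k₀ ⊡ v₁)) (v₃ ⊞ ⊟ (k₀ ⊡ (k₀ ⊡ (v₀ ⊞ v₁) ⊞ k₁ ⊡ v₂)))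
              (refl , refl , refl , refl , tt))) q }
        where
        open ≡-Reasoning
        KK : pos (K ℕ.* K) · g ≡ pos K · pos K · g
        KK = trans (cong (_· g) (ℤₚ.pos-* K K)) (·-* (pos K) (pos K) g)

      -- Each form excludes at most one of the pairwise incongruent candidates, so the pigeonhole principle leaves one.
      module _ (¬G : ∀ f → Bounded N₁ f → ¬ G (pos K · a + val f x))
               (low high : Carrier)
               (inside : ∀ a′ → Pos (pos K · a′ + - low) → Pos (high + - (pos K · a′)) → SameCut a x a′ x′)
               (i : ℤ) (i≤K : abs i ≤ K) (b : Carrier) (a-eq : a ≡ pos K · b + i · u)
               (F : ℕ) (F-eq : F ≡ List.length (forms n N₁))
               (c : Fin (suc F) → Carrier) (incongruent : ∀ p q → p ≢ q → ¬ G (c p + - c q))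
               (cand : ∀ p → Candidate low high (c p) i) where

        private module Cand p = Candidate (cand p)

        formAt : Fin F → Form n
        formAt j = List.lookup (forms n N₁) (Fin.cast F-eq j)

        Bad : Fin (suc F) → Set ℓ
        Bad p = Σ (Fin F) λ j → G (pos K · Cand.a′ p + val (formAt j) x′)

        good : ∀ p → ¬ Bad p → Eqv N (a VF.∷ x) (Cand.a′ p VF.∷ x′)
        good p ¬bad = extend eqv-N (inside (Cand.a′ p) (Cand.above-low p) (Cand.below-high p))
          (sameDiv-generic i a-eq (Cand.congruent p) ¬G ¬G′
            (div-const i i≤K))
          where
          ¬G′ : ∀ f → Bounded N₁ f → ¬ G (pos K · Cand.a′ p + val f x′)
          ¬G′ f bf Gf with ∈-forms f bf
          ... | f′ , f′∈ , _ , f-eq = ¬bad (Fin.cast (sym F-eq) (Any.index f′∈) ,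
            subst (λ g → G (pos K · Cand.a′ p + val g x′)) at
                  (subst (λ z → G (pos K · Cand.a′ p + z)) (f-eq x′) Gf))
            where
            at : f′ ≡ formAt (Fin.cast (sym F-eq) (Any.index f′∈))
            at = trans (lookup-index f′∈) (cong (List.lookup (forms n N₁))
                   (sym (Finₚ.cast-involutive F-eq (sym F-eq) (Any.index f′∈))))

        -- The difference of the two memberships no longer contains f and would put c p - c q into
        -- `G`.
        clash : ∀ p q → p ≢ q → ∀ f → G (pos K · Cand.a′ p + val f x′) → G (pos K · Cand.a′ q + val f x′) → ⊥
        clash p q p≢q f Gp Gq = incongruent p q p≢q (subst G difference
            (G-+ (G-+ Gp (G-neg Gq)) (G-+ (Cand.Gγ q) (G-neg (Cand.Gγ p)))))
          where
          difference : (pos K · Cand.a′ p + val f x′ + - (pos K · Cand.a′ q + val f x′)) + (Cand.γ q + - Cand.γ p) ≡ c p + - c q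
          difference = trans
            (cong₂ (λ y z → (y + val f x′ + - (z + val f x′)) + (Cand.γ q + - Cand.γ p)) (Cand.coset p) (Cand.coset q))
            (solve [] (c p ∷ c q ∷ Cand.γ p ∷ Cand.γ q ∷ val f x′ ∷ [])
              (((v₀ ⊞ v₂) ⊞ v₄ ⊞ ⊟ ((v₁ ⊞ v₃) ⊞ v₄)) ⊞ (v₃ ⊞ ⊟ v₂)) (v₀ ⊞ ⊟ v₁) (refl , refl , refl , refl , refl , tt))

        choose : Dec (Σ (Fin (suc F)) λ p → ¬ Bad p) → Σ Carrier λ a′ → Eqv N (a VF.∷ x) (a′ VF.∷ x′)
        choose (yes (p , ¬bad)) = Cand.a′ p , good p ¬bad
        choose (no none) = ⊥-elim (collide (Finₚ.pigeonhole (ℕₚ.n<1+n F) (proj₁ ∘ bad)))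
          where
          bad : ∀ p → Bad p
          bad p with em {Bad p}
          ... | yes b = b
          ... | no ¬b = ⊥-elim (none (p , ¬b))
          collide : (Σ (Fin (suc F)) λ p → Σ (Fin (suc F)) λ q → p Fin.< q × proj₁ (bad p) ≡ proj₁ (bad q)) → ⊥
          collide (p , q , p<q , same) = clash p q (Finₚ.<⇒≢ p<q) (formAt (proj₁ (bad p)))
            (proj₂ (bad p))
            (subst (λ j → G (pos K · Cand.a′ q + val (formAt j) x′)) (sym same) (proj₂ (bad q)))


      generic-case : Window → (∀ f → Bounded N₁ f → ¬ G (pos K · a + val f x)) → Σ Carrier λ a′ → Eqv N (a VF.∷ x) (a′ VF.∷ x′)
      generic-case win ¬G = choose ¬G low high inside i (subst (_≤ K) (sym (ℤₚ.∣-i∣≡∣i∣ (pos r))) (proj₁ (proj₂ residue)))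
          (Div.quotient (proj₂ (proj₂ residue))) a-eq (List.length (forms n N₁)) refl c (proj₂ many)
          (λ p → candidate low high open-interval (c p) i) em
        where
        open Window win
        residue = divisible% false K K≥1 {a} (lift tt)
        r = proj₁ residue
        i = ℤ.- pos r
        many = infinite (suc (List.length (forms n N₁)))
        c = proj₁ many
        a-eq : a ≡ pos K · Div.quotient (proj₂ (proj₂ residue)) + i · u
        a-eq = trans (solve (pos r ∷ []) (a ∷ u ∷ []) v₀ ((v₀ ⊞ k₀ ⊡ v₁) ⊞ (:- k₀) ⊡ v₁) (refl , refl , tt))
                     (cong (_+ i · u) (Div.equality (proj₂ (proj₂ residue))))

      step : Σ Carrier λ a′ → Eqv N (a VF.∷ x) (a′ VF.∷ x′)
      step with em {Σ (Form n) λ f → Bounded N₁ f × pos K · a + val f x ≡ 𝟘}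
      ... | yes (f , b , eq) = root-case f b eq
      ... | no nz with em {Σ (Form n) λ f → Bounded N₁ f × G (pos K · a + val f x)}
      ...   | yes (f , b , Gf) = coset-case (window λ f b eq → nz (f , b , eq)) f b Gf
      ...   | no ng            = generic-case (window λ f b eq → nz (f , b , eq)) (λ f b Gf → ng (f , b , Gf))

-- The universal cover of an oriented group

module Cover {ℓ : Level} (em : ExcludedMiddle ℓ) (M : OStr ℓ)
             (oriented : OStrDefs.IsOrientedAbelianGroup M) where
  open OStr M renaming (Carrier to A)
  open OStrDefs M using (IsAbelianGroup; IsTranslationInvariantCyclicOrder)

  groupᴬ : AbGroup ℓ
  groupᴬ = record
    { Carrier = A ; _+_ = _+ᴬ_ ; -_ = -ᴬ_ ; 𝟘 = 0ᴬ
    ; assoc = proj₁ ab ; comm = proj₁ (proj₂ ab) ; idˡ = proj₁ (proj₂ (proj₂ ab)) ; invˡ = proj₂ (proj₂ (proj₂ ab)) }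
    where
    ab : IsAbelianGroup
    ab = proj₁ oriented

  open AbGroup groupᴬ using () renaming (assoc to assocᴬ; comm to commᴬ; idˡ to idˡᴬ; invˡ to invˡᴬ)
  open ScalarMult groupᴬ using (module Solver) renaming (idʳ to idʳᴬ; invʳ to invʳᴬ; cancelˡ to cancelˡᴬ; neg-neg to neg-negᴬ)
  open Solver

  private
    order : IsTranslationInvariantCyclicOrder
    order = proj₂ oriented

  rot : ∀ {a b c} → 𝒪 a b c → 𝒪 b c a
  rot = proj₁ order _ _ _

  𝒪-asym : ∀ {a b c} → 𝒪 a b c → ¬ 𝒪 c b a
  𝒪-asym = proj₁ (proj₂ order) _ _ _

  𝒪-trans : ∀ {a b c d} → 𝒪 a b c → 𝒪 a c d → 𝒪 a b d
  𝒪-trans = proj₁ (proj₂ (proj₂ order)) _ _ _ _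

  𝒪-total : ∀ {a b c} → a ≢ b → b ≢ c → a ≢ c → 𝒪 a b c ⊎ 𝒪 c b a
  𝒪-total = proj₁ (proj₂ (proj₂ (proj₂ order))) _ _ _

  𝒪-shift : ∀ d {a b c} → 𝒪 a b c → 𝒪 (a +ᴬ d) (b +ᴬ d) (c +ᴬ d)
  𝒪-shift d = proj₂ (proj₂ (proj₂ (proj₂ order))) _ _ _ d

  𝒪-≢₁₂ : ∀ {a b c} → 𝒪 a b c → a ≢ b
  𝒪-≢₁₂ o refl = 𝒪-asym o (rot (rot o))

  𝒪-≢₂₃ : ∀ {a b c} → 𝒪 a b c → b ≢ c
  𝒪-≢₂₃ o = 𝒪-≢₁₂ (rot o)

  𝒪-≢₁₃ : ∀ {a b c} → 𝒪 a b c → a ≢ c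
  𝒪-≢₁₃ o e = 𝒪-≢₁₂ (rot (rot o)) (sym e)

  infix 4 _≺_

  -- The cyclic order cut open at 0, which becomes the least element.
  _≺_ : A → A → Set ℓ
  a ≺ b = (a ≡ 0ᴬ × b ≢ 0ᴬ) ⊎ 𝒪 0ᴬ a b

  ≺-≢ : ∀ {a b} → a ≺ b → a ≢ b
  ≺-≢ (inj₁ (a≡0 , b≢0)) a≡b = b≢0 (trans (sym a≡b) a≡0)
  ≺-≢ (inj₂ o) a≡b = 𝒪-≢₂₃ o a≡b

  ≺-≢0 : ∀ {a b} → a ≺ b → b ≢ 0ᴬ
  ≺-≢0 (inj₁ (_ , b≢0)) = b≢0
  ≺-≢0 (inj₂ o) b≡0 = 𝒪-≢₁₃ o (sym b≡0)

  ≺-𝒪 : ∀ {a b} → a ≢ 0ᴬ → a ≺ b → 𝒪 0ᴬ a b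
  ≺-𝒪 a≢0 (inj₁ (a≡0 , _)) = ⊥-elim (a≢0 a≡0)
  ≺-𝒪 a≢0 (inj₂ o) = o

  ≺-trans : ∀ {a b c} → a ≺ b → b ≺ c → a ≺ c
  ≺-trans p (inj₁ (b≡0 , _)) = ⊥-elim (≺-≢0 p b≡0)
  ≺-trans (inj₁ (a≡0 , _)) q@(inj₂ _) = inj₁ (a≡0 , ≺-≢0 q)
  ≺-trans (inj₂ o) (inj₂ o′) = inj₂ (𝒪-trans o o′)

  ≺-irrefl : ∀ {a} → ¬ a ≺ a
  ≺-irrefl p = ≺-≢ p refl

  ≺-asym : ∀ {a b} → a ≺ b → ¬ b ≺ a
  ≺-asym p q = ≺-irrefl (≺-trans p q)

  ≺-tri : ∀ a b → a ≺ b ⊎ a ≡ b ⊎ b ≺ a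
  ≺-tri a b with em {a ≡ b} | em {a ≡ 0ᴬ} | em {b ≡ 0ᴬ}
  ... | yes e | _     | _     = inj₂ (inj₁ e)
  ... | no ne | yes z | _     = inj₁ (inj₁ (z , λ b≡0 → ne (trans z (sym b≡0))))
  ... | no ne | no nz | yes z = inj₂ (inj₂ (inj₁ (z , nz)))
  ... | no ne | no nz | no nz′ with 𝒪-total {0ᴬ} {a} {b} (λ e → nz (sym e)) ne (λ e → nz′ (sym e))
  ...   | inj₁ o = inj₁ (inj₂ o)
  ...   | inj₂ o = inj₂ (inj₂ (inj₂ (rot (rot o))))

  ≺⇒𝒪 : ∀ {a b c} → a ≺ b → b ≺ c → 𝒪 a b c
  ≺⇒𝒪 p (inj₁ (b≡0 , _)) = ⊥-elim (≺-≢0 p b≡0)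
  ≺⇒𝒪 (inj₁ (refl , _)) (inj₂ o) = o
  ≺⇒𝒪 (inj₂ o) (inj₂ o′) = rot (rot (𝒪-trans (rot o′) (rot (rot o))))

  𝒪⇒≺ : ∀ {a b c} → 𝒪 a b c → (a ≺ b × b ≺ c) ⊎ (b ≺ c × c ≺ a) ⊎ (c ≺ a × a ≺ b)
  𝒪⇒≺ {a} {b} {c} o with ≺-tri a b | ≺-tri b c | ≺-tri a c
  ... | inj₂ (inj₁ e) | _             | _             = ⊥-elim (𝒪-≢₁₂ o e)
  ... | _             | inj₂ (inj₁ e) | _             = ⊥-elim (𝒪-≢₂₃ o e)
  ... | _             | _             | inj₂ (inj₁ e) = ⊥-elim (𝒪-≢₁₃ o e)
  ... | inj₁ p        | inj₁ q        | _             = inj₁ (p , q)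
  ... | inj₁ p        | inj₂ (inj₂ q) | inj₁ r        = ⊥-elim (𝒪-asym o (rot (≺⇒𝒪 r q)))
  ... | inj₁ p        | inj₂ (inj₂ q) | inj₂ (inj₂ r) = inj₂ (inj₂ (r , p))
  ... | inj₂ (inj₂ p) | inj₁ q        | inj₁ r        = ⊥-elim (𝒪-asym o (rot (rot (≺⇒𝒪 p r))))
  ... | inj₂ (inj₂ p) | inj₁ q        | inj₂ (inj₂ r) = inj₂ (inj₁ (q , r))
  ... | inj₂ (inj₂ p) | inj₂ (inj₂ q) | _             = ⊥-elim (𝒪-asym o (≺⇒𝒪 q p))

  -- Representatives in [0 , u) overflow u exactly when the reduced sum falls below its first
  -- summand.
  Wraps : A → A → Set ℓ
  Wraps a b = a +ᴬ b ≺ a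

  -- Rotating 0, b, c by a orients a, a + b, a + c. The three ways to cut this cyclic triple open at
  -- 0 are the three cases; in particular c wraps whenever b does.
  translate : ∀ a {b c} → b ≺ c →
      (¬ Wraps a b × ¬ Wraps a c × a +ᴬ b ≺ a +ᴬ c)
    ⊎ (Wraps a b × Wraps a c × a +ᴬ b ≺ a +ᴬ c)
    ⊎ (¬ Wraps a b × Wraps a c)
  translate a {b} {c} (inj₁ (refl , c≢0)) with ≺-tri (a +ᴬ c) a
  ... | inj₁ p        = inj₂ (inj₂ (subst (λ z → ¬ z ≺ a) (sym (idʳᴬ a)) ≺-irrefl , p))
  ... | inj₂ (inj₁ e) = ⊥-elim (c≢0 (cancelˡᴬ a (trans e (sym (idʳᴬ a)))))
  ... | inj₂ (inj₂ p) = inj₁ ( subst (λ z → ¬ z ≺ a) (sym (idʳᴬ a)) ≺-irrefl , ≺-asym p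
                             , subst (_≺ a +ᴬ c) (sym (idʳᴬ a)) p)
  translate a {b} {c} (inj₂ o) with 𝒪⇒≺ (subst₂ (λ y z → 𝒪 y (a +ᴬ b) z) (idˡᴬ a) (commᴬ c a)
                                          (subst (λ y → 𝒪 (0ᴬ +ᴬ a) y (c +ᴬ a)) (commᴬ b a) (𝒪-shift a o)))
  ... | inj₁ (p , q)        = inj₁ (≺-asym p , ≺-asym (≺-trans p q) , q)
  ... | inj₂ (inj₁ (p , q)) = inj₂ (inj₁ (≺-trans p q , q , p))
  ... | inj₂ (inj₂ (p , q)) = inj₂ (inj₂ (≺-asym q , p))

  carry : A → A → ℤ
  carry a b with em {Wraps a b}
  ... | yes _ = ℤ.1ℤ
  ... | no  _ = ℤ.0ℤ

  carry-1 : ∀ {a b} → Wraps a b → carry a b ≡ ℤ.1ℤ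
  carry-1 {a} {b} w with em {Wraps a b}
  ... | yes _ = refl
  ... | no nw = ⊥-elim (nw w)

  carry-0 : ∀ {a b} → ¬ Wraps a b → carry a b ≡ ℤ.0ℤ
  carry-0 {a} {b} nw with em {Wraps a b}
  ... | yes w = ⊥-elim (nw w)
  ... | no _  = refl

  carry-≡ : ∀ {a b c d} → (Wraps a b → Wraps c d) → (Wraps c d → Wraps a b) → carry a b ≡ carry c d
  carry-≡ {a} {b} {c} {d} f g with em {Wraps a b}
  ... | yes w = sym (carry-1 (f w))
  ... | no nw = sym (carry-0 (λ w → nw (g w)))

  -- A failure of commutativity of the carry; it propagates from (x , y) to (- y , x), and four steps give a ≺-cycle.
  record Twisted (x y : A) : Set ℓ where
    field
      x≢0 : x ≢ 0ᴬ
      x≺  : x ≺ x +ᴬ y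
      ≺y  : x +ᴬ y ≺ y

  -- Translating the orientations of 0, x, x + y and of 0, x + y, y by -y arranges -y, -y + x, x, 0
  -- in this cyclic order. Cut open at 0, this reads -y ≺ -y + x ≺ x.
  twist : ∀ {x y} → Twisted x y → Twisted (-ᴬ y) x
  twist {x} {y} t = record { x≢0 = λ e → 𝒪-≢₁₂ first (sym e) ; x≺ = inj₂ first ; ≺y = inj₂ second }
    where
    open Twisted t
    sum≢0 : x +ᴬ y ≢ 0ᴬ
    sum≢0 = ≺-≢0 x≺
    down : 𝒪 (-ᴬ y) x 0ᴬ
    down = subst₂ (λ a b → 𝒪 a b 0ᴬ) (idˡᴬ _)
      (solve [] (x ∷ y ∷ []) ((v₀ ⊞ v₁) ⊞ ⊟ v₁) v₀ (refl , refl , tt))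
      (subst (𝒪 _ _) (invʳᴬ y) (𝒪-shift (-ᴬ y) (≺-𝒪 sum≢0 ≺y)))
    across : 𝒪 (-ᴬ y) (-ᴬ y +ᴬ x) x
    across = subst₂ (λ a b → 𝒪 a b x) (idˡᴬ _) (commᴬ _ _)
      (subst (𝒪 _ _) (solve [] (x ∷ y ∷ []) ((v₀ ⊞ v₁) ⊞ ⊟ v₁) v₀ (refl , refl , tt))
        (𝒪-shift (-ᴬ y) (≺-𝒪 x≢0 x≺)))
    first : 𝒪 0ᴬ (-ᴬ y) (-ᴬ y +ᴬ x)
    first = rot (rot (𝒪-trans across down))
    second : 𝒪 0ᴬ (-ᴬ y +ᴬ x) x
    second = rot (𝒪-trans (rot down) (rot (rot across)))

  twisted-≺ : ∀ {x y} → Twisted x y → x ≺ y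
  twisted-≺ t = ≺-trans (Twisted.x≺ t) (Twisted.≺y t)

  untwisted : ∀ {x y} → ¬ Twisted x y
  -- The cycle is y ≺ -x ≺ -y ≺ x ≺ y.
  untwisted {x} {y} t = ≺-irrefl (≺-trans (subst (_≺ -ᴬ x) (neg-negᴬ y) (twisted-≺ (twist (twist (twist t)))))
    (≺-trans (twisted-≺ (twist (twist t))) (≺-trans (twisted-≺ (twist t)) (twisted-≺ t))))

  wraps-comm : ∀ {a b} → Wraps a b → Wraps b a
  wraps-comm {a} {b} w with ≺-tri (b +ᴬ a) b
  ... | inj₁ p        = p
  ... | inj₂ (inj₁ e) = ⊥-elim (≺-≢0 w (cancelˡᴬ b (trans e (sym (idʳᴬ b)))))
  ... | inj₂ (inj₂ p) = ⊥-elim (untwisted {b} {a} record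
    { x≢0 = λ b≡0 → ≺-irrefl (subst (_≺ a) (trans (cong (a +ᴬ_) b≡0) (idʳᴬ a)) w)
    ; x≺ = p ; ≺y = subst (_≺ a) (commᴬ a b) w })

  carry-comm : ∀ a b → carry a b ≡ carry b a
  carry-comm a b = carry-≡ wraps-comm wraps-comm

  wraps-0ʳ : ∀ {a} → ¬ Wraps a 0ᴬ
  wraps-0ʳ {a} w = ≺-irrefl (subst (_≺ a) (idʳᴬ a) w)

  carry-0ˡ : ∀ a → carry 0ᴬ a ≡ ℤ.0ℤ
  carry-0ˡ a = trans (carry-comm 0ᴬ a) (carry-0 wraps-0ʳ)

  -- Both sides count the turns made by a + b + c. Whether b + c wraps decides the order of b and b
  -- + c, and `translate` by a turns that order into the remaining carries.
  cocycle : ∀ a b c → carry a b ℤ.+ carry (a +ᴬ b) c ≡ carry b c ℤ.+ carry a (b +ᴬ c)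
  cocycle a b c with em {c ≡ 0ᴬ}
  ... | yes refl = trans (cong (λ i → carry a b ℤ.+ i) (carry-0 wraps-0ʳ)) (trans (ℤₚ.+-comm (carry a b) ℤ.0ℤ)
                     (cong₂ ℤ._+_ (sym (carry-0 {b} wraps-0ʳ)) (cong (carry a) (sym (idʳᴬ b)))))
  ... | no c≢0 with ≺-tri (b +ᴬ c) b
  ...   | inj₂ (inj₁ e) = ⊥-elim (c≢0 (cancelˡᴬ b (trans e (sym (idʳᴬ b)))))
  ...   | inj₁ w with translate a w
  ...     | inj₁ (nw′ , nw , p) = trans (cong₂ ℤ._+_ (carry-0 nw) (carry-1 (subst (_≺ a +ᴬ b) (sym (assocᴬ a b c)) p)))
                                        (sym (cong₂ ℤ._+_ (carry-1 w) (carry-0 nw′)))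
  ...     | inj₂ (inj₁ (w′ , w″ , p)) = trans (cong₂ ℤ._+_ (carry-1 w″) (carry-1 (subst (_≺ a +ᴬ b) (sym (assocᴬ a b c)) p)))
                                        (sym (cong₂ ℤ._+_ (carry-1 w) (carry-1 w′)))
  ...     | inj₂ (inj₂ (nw , w′)) = trans (cong₂ ℤ._+_ (carry-1 w′) (carry-0 λ p → nw (≺-trans (subst (_≺ a +ᴬ b) (assocᴬ a b c) p) w′)))
                                        (sym (cong₂ ℤ._+_ (carry-1 w) (carry-0 nw)))
  cocycle a b c | no c≢0 | inj₂ (inj₂ p) with translate a p
  ...     | inj₁ (nw , nw′ , q) = trans (cong₂ ℤ._+_ (carry-0 nw) (carry-0 λ r → ≺-asym q (subst (_≺ a +ᴬ b) (assocᴬ a b c) r)))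
                                        (sym (cong₂ ℤ._+_ (carry-0 (≺-asym p)) (carry-0 nw′)))
  ...     | inj₂ (inj₁ (w , w′ , q)) = trans (cong₂ ℤ._+_ (carry-1 w) (carry-0 λ r → ≺-asym q (subst (_≺ a +ᴬ b) (assocᴬ a b c) r)))
                                        (sym (cong₂ ℤ._+_ (carry-0 (≺-asym p)) (carry-1 w′)))
  ...     | inj₂ (inj₂ (nw , w)) = trans (cong₂ ℤ._+_ (carry-0 nw) (carry-1 (below (≺-tri a (a +ᴬ b)))))
                                        (sym (cong₂ ℤ._+_ (carry-0 (≺-asym p)) (carry-1 w)))
    where
    below : a ≺ a +ᴬ b ⊎ a ≡ a +ᴬ b ⊎ a +ᴬ b ≺ a → Wraps (a +ᴬ b) c
    below (inj₁ q)        = subst (_≺ a +ᴬ b) (sym (assocᴬ a b c)) (≺-trans w q)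
    below (inj₂ (inj₁ e)) = subst₂ _≺_ (sym (assocᴬ a b c)) e w
    below (inj₂ (inj₂ q)) = ⊥-elim (nw q)

  -- The extension of A by ℤ along the carry cocycle

  L : Set ℓ
  L = ℤ × A

  infixl 6 _+ᴸ_
  infix  8 -ᴸ_

  0ᴸ : L
  0ᴸ = ℤ.0ℤ , 0ᴬ

  uᴸ : L
  uᴸ = ℤ.1ℤ , 0ᴬ

  open +-*-Solver using (_:=_; _:-_) renaming (solve to solveℤ; _:+_ to _:+ᶻ_; :-_ to :-ᶻ_)

  opaque
    _+ᴸ_ : L → L → L
    (m , a) +ᴸ (n , b) = m ℤ.+ n ℤ.+ carry a b , a +ᴬ b

    -ᴸ_ : L → L
    -ᴸ (m , a) = ℤ.- m ℤ.- carry a (-ᴬ a) , -ᴬ a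

    -- The lexicographic order: the second coordinate stands for a point of [0 , u) and is never
    -- negative, so the winding number decides except at the origin.
    Posᴸ : L → Set ℓ
    Posᴸ (m , a) = ℤ.0ℤ ℤ.≤ m × ¬ (m ≡ ℤ.0ℤ × a ≡ 0ᴬ)

  opaque
    unfolding _+ᴸ_

    +ᴸ-def : ∀ m a n b → (m , a) +ᴸ (n , b) ≡ (m ℤ.+ n ℤ.+ carry a b , a +ᴬ b)
    +ᴸ-def m a n b = refl

    -ᴸ-def : ∀ m a → -ᴸ (m , a) ≡ (ℤ.- m ℤ.- carry a (-ᴬ a) , -ᴬ a)
    -ᴸ-def m a = refl

    Posᴸ-intro : ∀ n {a} → ¬ (n ≡ 0 × a ≡ 0ᴬ) → Posᴸ (pos n , a)
    Posᴸ-intro n ne = ℤ.+≤+ z≤n , λ { (e , z) → ne (ℤₚ.+-injective e , z) }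

    Posᴸ-negative : ∀ {n a} → ¬ Posᴸ (-[1+ n ] , a)
    Posᴸ-negative (() , _)

    Posᴸ-zero : ¬ Posᴸ 0ᴸ
    Posᴸ-zero (_ , ne) = ne (refl , refl)

    assocᴸ : ∀ x y z → (x +ᴸ y) +ᴸ z ≡ x +ᴸ (y +ᴸ z)
    assocᴸ (m , a) (n , b) (k , c) = cong₂ _,_ integers (assocᴬ a b c)
      where
      open ≡-Reasoning
      integers : (m ℤ.+ n ℤ.+ carry a b) ℤ.+ k ℤ.+ carry (a +ᴬ b) c ≡ m ℤ.+ (n ℤ.+ k ℤ.+ carry b c) ℤ.+ carry a (b +ᴬ c)
      integers = begin
        (m ℤ.+ n ℤ.+ carry a b) ℤ.+ k ℤ.+ carry (a +ᴬ b) c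
          ≡⟨ solveℤ 5 (λ m n k c d → (m :+ᶻ n :+ᶻ c) :+ᶻ k :+ᶻ d := m :+ᶻ n :+ᶻ k :+ᶻ (c :+ᶻ d)) refl m n k (carry a b) (carry (a +ᴬ b) c) ⟩
        m ℤ.+ n ℤ.+ k ℤ.+ (carry a b ℤ.+ carry (a +ᴬ b) c)
          ≡⟨ cong (λ i → m ℤ.+ n ℤ.+ k ℤ.+ i) (cocycle a b c) ⟩
        m ℤ.+ n ℤ.+ k ℤ.+ (carry b c ℤ.+ carry a (b +ᴬ c))
          ≡⟨ solveℤ 5 (λ m n k c d → m :+ᶻ n :+ᶻ k :+ᶻ (c :+ᶻ d) := m :+ᶻ (n :+ᶻ k :+ᶻ c) :+ᶻ d) refl m n k (carry b c) (carry a (b +ᴬ c)) ⟩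
        m ℤ.+ (n ℤ.+ k ℤ.+ carry b c) ℤ.+ carry a (b +ᴬ c) ∎

    commᴸ : ∀ x y → x +ᴸ y ≡ y +ᴸ x
    commᴸ (m , a) (n , b) = cong₂ _,_ (cong₂ ℤ._+_ (ℤₚ.+-comm m n) (carry-comm a b)) (commᴬ a b)

    idˡᴸ : ∀ x → 0ᴸ +ᴸ x ≡ x
    idˡᴸ (m , a) = cong₂ _,_ (trans (cong₂ ℤ._+_ (ℤₚ.+-identityˡ m) (carry-0ˡ a)) (ℤₚ.+-identityʳ m)) (idˡᴬ a)

    invˡᴸ : ∀ x → -ᴸ x +ᴸ x ≡ 0ᴸ
    invˡᴸ (m , a) = cong₂ _,_
      (trans (cong (λ i → ℤ.- m ℤ.- carry a (-ᴬ a) ℤ.+ m ℤ.+ i) (carry-comm (-ᴬ a) a))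
             (solveℤ 2 (λ m c → (:-ᶻ m :- c) :+ᶻ m :+ᶻ c := con ℤ.0ℤ) refl m (carry a (-ᴬ a))))
      (invˡᴬ a)

    Posᴸ-+ : ∀ {x y} → Posᴸ x → Posᴸ y → Posᴸ (x +ᴸ y)
    Posᴸ-+ {pos m , a} {pos n , b} (_ , x≢0) (_ , y≢0) with em {Wraps a b}
    ... | yes w = ℤ.+≤+ z≤n , λ { (e , _) → ℕₚ.1+n≢0 (trans (ℕₚ.+-comm 1 (m ℕ.+ n)) (ℤₚ.+-injective e)) }
    -- A vanishing sum without carry has m = 0, so a ≠ 0; but then a + b = 0 is the least element,
    -- below a, and the sum wraps.
    ... | no nw = ℤ.+≤+ z≤n , λ { (e , s) → nw (inj₁ (s , λ a≡0 → x≢0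
        (cong pos (ℕₚ.m+n≡0⇒m≡0 m (trans (sym (ℕₚ.+-identityʳ (m ℕ.+ n))) (ℤₚ.+-injective e))) , a≡0))) }
    Posᴸ-+ {pos _ , _}    { -[1+ _ ] , _} _ (() , _)
    Posᴸ-+ { -[1+ _ ] , _} {_ , _}        (() , _) _

    Posᴸ-tri : ∀ x → Posᴸ x ⊎ x ≡ 0ᴸ ⊎ Posᴸ (-ᴸ x)
    Posᴸ-tri (pos zero , a) with em {a ≡ 0ᴬ}
    ... | yes refl = inj₂ (inj₁ refl)
    ... | no a≢0   = inj₁ (ℤ.+≤+ z≤n , λ { (_ , a≡0) → a≢0 a≡0 })
    Posᴸ-tri (pos (suc m) , a) = inj₁ (ℤ.+≤+ z≤n , λ ())
    Posᴸ-tri (-[1+ m ] , a) with em {Wraps a (-ᴬ a)}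
    -- The carry can lower the winding number of the negative to 0; positivity then rests on -a ≠ 0.
    ... | yes w = inj₂ (inj₂ (ℤ.+≤+ z≤n , λ { (_ , e) → ≺-≢0 w (trans (sym (neg-negᴬ a)) (trans (cong -ᴬ_ e) (ScalarMult.neg-𝟘 groupᴬ))) }))
    ... | no _  = inj₂ (inj₂ (ℤ.+≤+ z≤n , λ ()))

  groupᴸ : AbGroup ℓ
  groupᴸ = record
    { Carrier = L ; _+_ = _+ᴸ_ ; -_ = -ᴸ_ ; 𝟘 = 0ᴸ ; assoc = assocᴸ ; comm = commᴸ ; idˡ = idˡᴸ ; invˡ = invˡᴸ }

  orderedᴸ : OrderedGroup ℓ
  orderedᴸ = record
    { group = groupᴸ ; Pos = Posᴸ ; pos-+ = Posᴸ-+ ; pos-irr = Posᴸ-zero ; pos-tri = Posᴸ-tri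
    ; pos-asym = λ {x} p q → Posᴸ-zero (subst Posᴸ (ScalarMult.invʳ groupᴸ x) (Posᴸ-+ p q))
    ; u = uᴸ ; pos-u = Posᴸ-intro 1 λ () }

-- The cover seen through its section and its projection

record UniversalCover {ℓ : Level} (M : OStr ℓ) : Set (lsuc ℓ) where
  open OStr M renaming (Carrier to A)
  field
    ordered : OrderedGroup ℓ
  open OrderedGroup ordered public
  open OrderedGroupLemmas ordered public using (_<_)
  field
    ι            : A → Carrier
    π            : Carrier → A
    π-ι          : ∀ a → π (ι a) ≡ a
    π-+          : ∀ x y → π (x + y) ≡ π x +ᴬ π y
    π-neg        : ∀ x → π (- x) ≡ -ᴬ π x
    π-u          : π u ≡ 0ᴬ
    ι-0          : ι 0ᴬ ≡ 𝟘
    ι-nonneg     : ∀ a → ¬ Pos (- ι a)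
    ι-<u         : ∀ a → ι a < u
    ι-surjective : ∀ z → ¬ Pos (- z) → z < u → z ≡ ι (π z)
    winding      : ∀ z → Σ ℤ λ m → z ≡ ι (π z) + m · u
    𝒪⇔<          : ∀ a b c → 𝒪 a b c ⇔ ((ι a < ι b × ι b < ι c) ⊎ (ι b < ι c × ι c < ι a) ⊎ (ι c < ι a × ι a < ι b))

module CoverLemmas {ℓ : Level} (em : ExcludedMiddle ℓ) (M : OStr ℓ)
                   (oriented : OStrDefs.IsOrientedAbelianGroup M) where
  open OStr M renaming (Carrier to A)
  open Cover em M oriented
  open OrderedGroup orderedᴸ
  open OrderedGroupLemmas orderedᴸ
  open Solver

  ι : A → L
  ι a = ℤ.0ℤ , a

  ι-Pos : ∀ {a} → a ≢ 0ᴬ → Pos (ι a)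
  ι-Pos a≢0 = Posᴸ-intro 0 λ { (_ , a≡0) → a≢0 a≡0 }

  -- A carry would place b below a.
  ι-diff : ∀ {a b} → a ≺ b → ι a + ι (b +ᴬ -ᴬ a) ≡ ι b
  ι-diff {a} {b} p = trans (+ᴸ-def ℤ.0ℤ a ℤ.0ℤ (b +ᴬ -ᴬ a))
      (cong₂ _,_ (trans (ℤₚ.+-identityˡ _) (carry-0 λ w → ≺-asym p (subst (_≺ a) restore w))) restore)
    where
    restore : a +ᴬ (b +ᴬ -ᴬ a) ≡ b
    restore = S.solve [] (a ∷ b ∷ []) (S.var zero S.⊞ (S.var (suc zero) S.⊞ S.⊟ S.var zero)) (S.var (suc zero)) (refl , refl , tt)
      where module S = ScalarMult.Solver groupᴬ

  ι-< : ∀ {a b} → a ≺ b → ι a < ι b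
  ι-< {a} {b} p = subst Pos
    (trans (solve [] (ι a ∷ ι (b +ᴬ -ᴬ a) ∷ []) v₁ ((v₀ ⊞ v₁) ⊞ ⊟ v₀) (refl , refl , tt)) (cong (_+ - ι a) (ι-diff p)))
    (ι-Pos λ e → ≺-≢ p (trans (sym (ScalarMult.neg-neg groupᴬ a))
                              (sym (ScalarMult.neg-unique groupᴬ (-ᴬ a) b (trans (AbGroup.comm groupᴬ (-ᴬ a) b) e)))))

  ι-<⁻ : ∀ {a b} → ι a < ι b → a ≺ b
  ι-<⁻ {a} {b} p with ≺-tri a b
  ... | inj₁ q           = q
  ... | inj₂ (inj₁ refl) = ⊥-elim (<-irrefl {ι a} p)
  ... | inj₂ (inj₂ q)    = ⊥-elim (<-asym {ι a} {ι b} p (ι-< q))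

  ·u : ∀ i → i · u ≡ (i , 0ᴬ)
  ·u (pos n) = natural n
    where
    natural : ∀ n → n ·ℕ u ≡ (pos n , 0ᴬ)
    natural zero    = refl
    natural (suc n) = trans (cong (u +_) (natural n)) (trans (+ᴸ-def ℤ.1ℤ 0ᴬ (pos n) 0ᴬ)
      (cong₂ _,_ (trans (cong (λ i → pos (suc n) ℤ.+ i) (carry-0ˡ 0ᴬ)) (ℤₚ.+-identityʳ _)) (AbGroup.idˡ groupᴬ 0ᴬ)))
  ·u -[1+ n ] = trans (cong -_ (·u (pos (suc n)))) (trans (-ᴸ-def (pos (suc n)) 0ᴬ)
      (cong₂ _,_ (cong (λ i → -[1+ n ] ℤ.- i) (carry-0ˡ _)) (ScalarMult.neg-𝟘 groupᴬ)))

  +·u : ∀ m a i → (m , a) + i · u ≡ (m ℤ.+ i , a)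
  +·u m a i = trans (cong ((m , a) +_) (·u i)) (trans (+ᴸ-def m a i 0ᴬ)
    (cong₂ _,_ (trans (cong (λ j → m ℤ.+ i ℤ.+ j) (carry-0 wraps-0ʳ)) (ℤₚ.+-identityʳ _)) (ScalarMult.idʳ groupᴬ a)))

  decompose : ∀ m a → (m , a) ≡ ι a + m · u
  decompose m a = sym (trans (+·u ℤ.0ℤ a m) (cong (_, a) (ℤₚ.+-identityˡ m)))

  ι-nonneg : ∀ a → ¬ Pos (- ι a)
  ι-nonneg a p with em {a ≡ 0ᴬ}
  ... | yes refl = pos-irr (subst Pos neg-𝟘 p)
  ... | no a≢0   = pos-asym {ι a} (ι-Pos a≢0) p

  ι-<u : ∀ a → ι a < u
  ι-<u a with <-tri (ι a) u
  ... | inj₁ p         = p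
  ... | inj₂ (inj₁ ())
  ... | inj₂ (inj₂ p)  = ⊥-elim (Posᴸ-negative (subst Pos
          (trans (solve [] (ι a ∷ u ∷ []) (v₀ ⊞ ⊟ v₁) (v₀ ⊞ con -[1+ 0 ] ⊡ v₁) (refl , refl , tt)) (+·u ℤ.0ℤ a -[1+ 0 ])) p))

  ι-surjective : ∀ z → ¬ Pos (- z) → z < u → z ≡ ι (proj₂ z)
  ι-surjective (pos zero , a) _ _ = refl
  ι-surjective (pos (suc k) , a) _ z<u = ⊥-elim (beyond em)
    where
    z≡ : (pos k , a) + u ≡ (pos (suc k) , a)
    z≡ = trans (cong ((pos k , a) +_) (sym (1· u))) (trans (+·u (pos k) a ℤ.1ℤ) (cong (λ n → pos n , a) (ℕₚ.+-comm k 1)))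
    beyond : Dec (k ≡ 0 × a ≡ 0ᴬ) → ⊥
    beyond (yes (refl , refl)) = <-irrefl {u} z<u
    beyond (no ne) = <-asym {pos (suc k) , a} {u} z<u (subst Pos
      (trans (solve [] ((pos k , a) ∷ u ∷ []) v₀ ((v₀ ⊞ v₁) ⊞ ⊟ v₁) (refl , refl , tt)) (cong (_+ - u) z≡))
      (Posᴸ-intro k ne))
  ι-surjective (-[1+ k ] , a) z≥0 _ with Posᴸ-tri (-[1+ k ] , a)
  ... | inj₁ p         = ⊥-elim (Posᴸ-negative p)
  ... | inj₂ (inj₁ ())
  ... | inj₂ (inj₂ p)  = ⊥-elim (z≥0 p)

  𝒪⇔ι : ∀ a b c → 𝒪 a b c ⇔ ((ι a < ι b × ι b < ι c) ⊎ (ι b < ι c × ι c < ι a) ⊎ (ι c < ι a × ι a < ι b))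
  𝒪⇔ι a b c = mk⇔ forth back
    where
    forth : 𝒪 a b c → (ι a < ι b × ι b < ι c) ⊎ (ι b < ι c × ι c < ι a) ⊎ (ι c < ι a × ι a < ι b)
    forth o with 𝒪⇒≺ o
    ... | inj₁ (p , q)        = inj₁ (ι-< p , ι-< q)
    ... | inj₂ (inj₁ (p , q)) = inj₂ (inj₁ (ι-< p , ι-< q))
    ... | inj₂ (inj₂ (p , q)) = inj₂ (inj₂ (ι-< p , ι-< q))
    back : (ι a < ι b × ι b < ι c) ⊎ (ι b < ι c × ι c < ι a) ⊎ (ι c < ι a × ι a < ι b) → 𝒪 a b c
    back (inj₁ (p , q))        = ≺⇒𝒪 (ι-<⁻ p) (ι-<⁻ q)
    back (inj₂ (inj₁ (p , q))) = rot (rot (≺⇒𝒪 (ι-<⁻ p) (ι-<⁻ q)))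
    back (inj₂ (inj₂ (p , q))) = rot (≺⇒𝒪 (ι-<⁻ p) (ι-<⁻ q))

  opaque
    unfolding _+ᴸ_

    proj₂-+ : ∀ x y → proj₂ (x + y) ≡ proj₂ x +ᴬ proj₂ y
    proj₂-+ _ _ = refl

    proj₂-neg : ∀ x → proj₂ (- x) ≡ -ᴬ proj₂ x
    proj₂-neg _ = refl

  universalCover : UniversalCover M
  universalCover = record
    { ordered = orderedᴸ ; ι = ι ; π = proj₂ ; π-ι = λ _ → refl ; π-+ = proj₂-+ ; π-neg = proj₂-neg
    ; π-u = refl ; ι-0 = refl ; ι-nonneg = ι-nonneg ; ι-<u = ι-<u ; ι-surjective = ι-surjective
    ; winding = λ { (m , a) → m , decompose m a } ; 𝒪⇔< = 𝒪⇔ι }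

-- Density and divisibility in the cover of a pair

record PairData {ℓ : Level} (M : LpStr ℓ) : Set ℓ where
  open LpStr M renaming (Carrier to A)
  open OStrDefs base using (IsOrientedAbelianGroup) renaming (_·_ to _×ᴬ_; _-ᴬ_ to _∸ᴬ_)
  field
    oriented : IsOrientedAbelianGroup
    V-0      : V 0ᴬ
    V-+      : ∀ a b → V a → V b → V (a +ᴬ b)
    V-neg    : ∀ a → V a → V (-ᴬ a)
    divides-p : ∀ h p → Prime p → ∀ a → OrAll V h a → Σ A λ b → OrAll V h b × p ×ᴬ b ≡ a
    regular  : ∀ h p → Prime p → ∀ a b → OrAll V h a → OrAll V h b → 𝒪 0ᴬ a b →
               Σ A λ c → OrAll V h c × 𝒪 a (p ×ᴬ c) b × (∀ i → 1 ≤ i → i ℕ.< p → 𝒪 0ᴬ (i ×ᴬ c) (suc i ×ᴬ c))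
    V-dense  : ∀ a b → Σ A (λ x → 𝒪 a x b) → Σ A λ g → V g × 𝒪 a g b
    V-index  : ∀ n → Σ (Fin n → A) λ c → ∀ i j → i ≢ j → ¬ V (c i ∸ᴬ c j)

module CoverOrder {ℓ : Level} {M : OStr ℓ} (oriented : OStrDefs.IsOrientedAbelianGroup M) (C : UniversalCover M) where
  open OStr M renaming (Carrier to A)
  open OStrDefs M using () renaming (_·_ to _×ᴬ_)
  open UniversalCover C hiding (_<_)
  open OrderedGroupLemmas ordered public
  open Solver

  groupᴬ : AbGroup ℓ
  groupᴬ = record
    { Carrier = A ; _+_ = _+ᴬ_ ; -_ = -ᴬ_ ; 𝟘 = 0ᴬ
    ; assoc = proj₁ (proj₁ oriented) ; comm = proj₁ (proj₂ (proj₁ oriented))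
    ; idˡ = proj₁ (proj₂ (proj₂ (proj₁ oriented))) ; invˡ = proj₂ (proj₂ (proj₂ (proj₁ oriented))) }

  π-𝟘 : π 𝟘 ≡ 0ᴬ
  π-𝟘 = trans (cong π (sym ι-0)) (π-ι 0ᴬ)

  π-·ℕ : ∀ n z → π (n ·ℕ z) ≡ n ×ᴬ π z
  π-·ℕ zero    z = π-𝟘
  π-·ℕ (suc n) z = trans (π-+ z (n ·ℕ z)) (cong (π z +ᴬ_) (π-·ℕ n z))

  ×ᴬ-* : ∀ m n a → (m ℕ.* n) ×ᴬ a ≡ m ×ᴬ (n ×ᴬ a)
  ×ᴬ-* m n a = begin
    (m ℕ.* n) ×ᴬ a               ≡⟨ cong ((m ℕ.* n) ×ᴬ_) (π-ι a) ⟨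
    (m ℕ.* n) ×ᴬ π (ι a)         ≡⟨ π-·ℕ (m ℕ.* n) (ι a) ⟨
    π ((m ℕ.* n) ·ℕ ι a)         ≡⟨ cong π (trans (cong (_· ι a) (ℤₚ.pos-* m n)) (·-* (pos m) (pos n) (ι a))) ⟩
    π (m ·ℕ n ·ℕ ι a)            ≡⟨ π-·ℕ m (n ·ℕ ι a) ⟩
    m ×ᴬ π (n ·ℕ ι a)            ≡⟨ cong (m ×ᴬ_) (trans (π-·ℕ n (ι a)) (cong (n ×ᴬ_) (π-ι a))) ⟩
    m ×ᴬ (n ×ᴬ a)                ∎
    where open ≡-Reasoning

  π-·u : ∀ i → π (i · u) ≡ 0ᴬ
  π-·u (pos n)  = natural n
    where
    natural : ∀ n → π (n ·ℕ u) ≡ 0ᴬ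
    natural zero    = π-𝟘
    natural (suc n) = trans (π-+ u (n ·ℕ u)) (trans (cong₂ _+ᴬ_ π-u (natural n)) (AbGroup.idˡ groupᴬ 0ᴬ))
  π-·u -[1+ n ] = trans (π-neg (suc n ·ℕ u)) (trans (cong -ᴬ_ (π-·u (pos (suc n)))) (ScalarMult.neg-𝟘 groupᴬ))

  π-+·u : ∀ z i → π (z + i · u) ≡ π z
  π-+·u z i = trans (π-+ z (i · u)) (trans (cong (π z +ᴬ_) (π-·u i)) (ScalarMult.idʳ groupᴬ (π z)))

  ι-injective : ∀ {a b} → ι a ≡ ι b → a ≡ b
  ι-injective {a} {b} e = trans (sym (π-ι a)) (trans (cong π e) (π-ι b))

  <-via-neg : ∀ {a} → Pos (- a) → a < 𝟘
  <-via-neg {a} = subst Pos (sym (idˡ (- a)))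

  ι-≢0⇒Pos : ∀ {a} → a ≢ 0ᴬ → Pos (ι a)
  ι-≢0⇒Pos {a} a≢0 with pos-tri (ι a)
  ... | inj₁ p        = p
  ... | inj₂ (inj₁ e) = ⊥-elim (a≢0 (ι-injective (trans e (sym ι-0))))
  ... | inj₂ (inj₂ p) = ⊥-elim (ι-nonneg a p)

  𝒪-0⇒< : ∀ {a b} → 𝒪 0ᴬ a b → ι a < ι b
  𝒪-0⇒< {a} {b} o with to (𝒪⇔< 0ᴬ a b) o
  ... | inj₁ (_ , q)        = q
  ... | inj₂ (inj₁ (p , _)) = p
  ... | inj₂ (inj₂ (p , _)) = ⊥-elim (ι-nonneg b (subst Pos (trans (cong (_+ - ι b) ι-0) (idˡ _)) p))

  <⇒𝒪-0 : ∀ {a b} → Pos (ι a) → ι a < ι b → 𝒪 0ᴬ a b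
  <⇒𝒪-0 {a} {b} p q = from (𝒪⇔< 0ᴬ a b) (inj₁
    (subst Pos (sym (trans (cong (λ z → ι a + - z) ι-0) (trans (cong (ι a +_) neg-𝟘) (idʳ _)))) p , q))

  𝒪-between : ∀ {a b c} → ι a < ι c → 𝒪 a b c → ι a < ι b × ι b < ι c
  𝒪-between {a} {b} {c} ac o with to (𝒪⇔< a b c) o
  ... | inj₁ pq             = pq
  ... | inj₂ (inj₁ (_ , q)) = ⊥-elim (<-asym ac q)
  ... | inj₂ (inj₂ (q , _)) = ⊥-elim (<-asym ac q)

  -- The sum lies in [0 , 2u), so at most one u has to be removed; after removal it equals ι a - (u
  -- - ι b), which is below ι a.
  ι-sum : ∀ a b → (ι a + ι b ≡ ι (a +ᴬ b)) ⊎ (ι a + ι b ≡ ι (a +ᴬ b) + u × ι (a +ᴬ b) < ι a)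
  ι-sum a b = cases (<-tri (ι a + ι b) u)
    where
    nonneg : ¬ Pos (- (ι a + ι b))
    nonneg p with pos-tri (ι a)
    ... | inj₁ q = ι-nonneg b (subst Pos (solve [] (ι a ∷ ι b ∷ []) (v₀ ⊞ ⊟ (v₀ ⊞ v₁)) (⊟ v₁) (refl , refl , tt)) (pos-+ q p))
    ... | inj₂ (inj₂ q) = ι-nonneg a q
    ... | inj₂ (inj₁ e) = ι-nonneg b (subst (λ z → Pos (- z)) (trans (cong (_+ ι b) e) (idˡ _)) p)
    projection : π (ι a + ι b) ≡ a +ᴬ b
    projection = trans (π-+ (ι a) (ι b)) (cong₂ _+ᴬ_ (π-ι a) (π-ι b))
    wrapped : ¬ Pos (- (ι a + ι b + - u)) → ι a + ι b ≡ ι (a +ᴬ b) + u × ι (a +ᴬ b) < ι a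
    wrapped p = trans (solve [] (ι a + ι b ∷ u ∷ []) v₀ ((v₀ ⊞ ⊟ v₁) ⊞ v₁) (refl , refl , tt)) (cong (_+ u) e)
              , subst (_< ι a) e smaller
      where
      smaller : ι a + ι b + - u < ι a
      smaller = subst Pos (solve [] (ι a ∷ ι b ∷ u ∷ []) (v₂ ⊞ ⊟ v₁) (v₀ ⊞ ⊟ (v₀ ⊞ v₁ ⊞ ⊟ v₂)) (refl , refl , refl , tt)) (ι-<u b)
      e : ι a + ι b + - u ≡ ι (a +ᴬ b)
      e = trans (ι-surjective _ p (<-trans smaller (ι-<u a)))
            (cong ι (trans (π-+ (ι a + ι b) (- u)) (trans (cong₂ _+ᴬ_ projection
              (trans (π-neg u) (trans (cong -ᴬ_ π-u) (ScalarMult.neg-𝟘 groupᴬ)))) (ScalarMult.idʳ groupᴬ _))))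
    cases : ι a + ι b < u ⊎ ι a + ι b ≡ u ⊎ u < ι a + ι b →
            (ι a + ι b ≡ ι (a +ᴬ b)) ⊎ (ι a + ι b ≡ ι (a +ᴬ b) + u × ι (a +ᴬ b) < ι a)
    cases (inj₁ p)        = inj₁ (trans (ι-surjective _ nonneg p) (cong ι projection))
    cases (inj₂ (inj₁ e)) = inj₂ (wrapped λ p → pos-irr (subst Pos (trans (cong (λ z → - (z + - u)) e) (trans (cong -_ (invʳ u)) neg-𝟘)) p))
    cases (inj₂ (inj₂ p)) = inj₂ (wrapped (pos-asym p))

  ι-sum-≮ : ∀ a b → ι a + ι b ≡ ι (a +ᴬ b) → ¬ ι (a +ᴬ b) < ι a
  ι-sum-≮ a b e p = ι-nonneg b (subst Pos (trans (cong (λ z → ι a + - z) (sym e))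
    (solve [] (ι a ∷ ι b ∷ []) (v₀ ⊞ ⊟ (v₀ ⊞ v₁)) (⊟ v₁) (refl , refl , tt))) p)

module PairCover {ℓ : Level} (em : ExcludedMiddle ℓ) (M : LpStr ℓ) (D : PairData M) (C : UniversalCover (LpStr.base M)) where
  open LpStr M renaming (Carrier to A)
  open OStrDefs base using () renaming (_·_ to _×ᴬ_)
  open PairData D
  open UniversalCover C hiding (_<_)
  open CoverOrder oriented C
  open Solver

  G̃ : Carrier → Set ℓ
  G̃ z = V (π z)

  divide : ∀ h k → 1 ≤ k → ∀ a → OrAll V h a → Σ A λ b → OrAll V h b × k ×ᴬ b ≡ a
  divide h k@(suc _) _ a p = subst (λ k → Σ A λ b → OrAll V h b × k ×ᴬ b ≡ a) (sym (PrimeFactorisation.isFactorisation F))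
                                   (go _ (PrimeFactorisation.factorsPrime F) a p)
    where
    F = factorise k
    go : ∀ ps → All Prime ps → ∀ a → OrAll V h a → Σ A λ b → OrAll V h b × product ps ×ᴬ b ≡ a
    go []       []         a q = a , q , ScalarMult.idʳ groupᴬ a
    go (p ∷ ps) (pp ∷ pps) a q with divides-p h p pp a q
    ... | b , r , eq with go ps pps b r
    ...   | c , r′ , eq′ = c , r′ , trans (×ᴬ-* p (product ps) c) (trans (cong (p ×ᴬ_) eq′) eq)

  -- This is the role of the chain condition in regular density: it says that none of the additions
  -- leading from c to p c wraps around, so p c in `A` is p times the representative of c in L.
  ι-multiples : ∀ p c → (∀ i → 1 ≤ i → i ℕ.< p → 𝒪 0ᴬ (i ×ᴬ c) (suc i ×ᴬ c)) →
                ∀ n → 1 ≤ n → n ≤ p → n ·ℕ ι c ≡ ι (n ×ᴬ c)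
  ι-multiples p c incr (suc zero)    _ _   = trans (idʳ (ι c)) (cong ι (sym (ScalarMult.idʳ groupᴬ c)))
  ι-multiples p c incr (suc (suc n)) _ n<p = begin
    ι c + suc n ·ℕ ι c         ≡⟨ cong (ι c +_) (ι-multiples p c incr (suc n) (s≤s z≤n) (ℕₚ.<⇒≤ n<p)) ⟩
    ι c + ι (suc n ×ᴬ c)       ≡⟨ comm (ι c) (ι (suc n ×ᴬ c)) ⟩
    ι (suc n ×ᴬ c) + ι c       ≡⟨ unwrapped (ι-sum (suc n ×ᴬ c) c) ⟩
    ι (suc n ×ᴬ c +ᴬ c)        ≡⟨ cong ι (AbGroup.comm groupᴬ (suc n ×ᴬ c) c) ⟩
    ι (suc (suc n) ×ᴬ c)       ∎
    where
    open ≡-Reasoning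
    unwrapped : (ι (suc n ×ᴬ c) + ι c ≡ ι (suc n ×ᴬ c +ᴬ c)) ⊎ (ι (suc n ×ᴬ c) + ι c ≡ ι (suc n ×ᴬ c +ᴬ c) + u × ι (suc n ×ᴬ c +ᴬ c) < ι (suc n ×ᴬ c)) →
                ι (suc n ×ᴬ c) + ι c ≡ ι (suc n ×ᴬ c +ᴬ c)
    unwrapped (inj₁ e)       = e
    unwrapped (inj₂ (_ , w)) = ⊥-elim (<-asym w (subst (λ z → ι (suc n ×ᴬ c) < ι z) (AbGroup.comm groupᴬ c (suc n ×ᴬ c))
                                                  (𝒪-0⇒< (incr (suc n) (s≤s z≤n) n<p))))

  regularᴸ : ∀ h p → Prime p → ∀ {a b} → OrAll V h a → OrAll V h b → Pos (ι a) → ι a < ι b →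
             Σ A λ c → OrAll V h c × ι a < pos p · ι c × pos p · ι c < ι b
  regularᴸ h p pp {a} {b} Va Vb a>0 a<b with regular h p pp a b Va Vb (<⇒𝒪-0 a>0 a<b)
  ... | c , Vc , o , incr = c , Vc , subst (ι a <_) multiple (proj₁ between) , subst (_< ι b) multiple (proj₂ between)
    where
    multiple : ι (p ×ᴬ c) ≡ pos p · ι c
    multiple = sym (ι-multiples p c incr p (ℕ.>-nonZero⁻¹ p {{prime⇒nonZero pp}}) ℕₚ.≤-refl)
    between : ι a < ι (p ×ᴬ c) × ι (p ×ᴬ c) < ι b
    between = 𝒪-between a<b o

  -- Of three elements from distinct cosets of `V`, two would coincide.
  atMostTwo : ∀ z → ¬ (∀ a → ι a ≡ 𝟘 ⊎ ι a ≡ z)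
  atMostTwo z two with V-index 3
  ... | c , apart = collide (Finₚ.pigeonhole (ℕₚ.n<1+n 2) λ i → codeOf (two (c i)))
    where
    codeOf : ∀ {a} → ι a ≡ 𝟘 ⊎ ι a ≡ z → Fin 2
    codeOf (inj₁ _) = zero
    codeOf (inj₂ _) = suc zero
    same : ∀ {a b} (p : ι a ≡ 𝟘 ⊎ ι a ≡ z) (q : ι b ≡ 𝟘 ⊎ ι b ≡ z) → codeOf p ≡ codeOf q → a ≡ b
    same (inj₁ p) (inj₁ q) _ = ι-injective (trans p (sym q))
    same (inj₂ p) (inj₂ q) _ = ι-injective (trans p (sym q))
    collide : (Σ (Fin 3) λ i → Σ (Fin 3) λ j → i Fin.< j × codeOf (two (c i)) ≡ codeOf (two (c j))) → ⊥
    collide (i , j , i<j , e) = apart i j (Finₚ.<⇒≢ i<j)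
      (subst V (trans (sym (ScalarMult.invʳ groupᴬ (c i))) (cong (λ b → c i +ᴬ -ᴬ b) (same (two (c i)) (two (c j)) e))) V-0)
  -- Regular density for the prime 2, applied between z and 2z, both of which represent points of
  -- `A`.
  double-<u : ∀ {z} → Pos z → z + z < u → Σ Carrier λ w → z < w × w < z + z
  double-<u {z} pz q = result (regularᴸ false 2 prime[2] {π z} {π (z + z)} (lift tt) (lift tt) (subst Pos z≡ pz) (subst₂ _<_ z≡ zz≡ z<z+z))
    where
    z<z+z : z < z + z
    z<z+z = subst Pos (solve [] (z ∷ []) v₀ ((v₀ ⊞ v₀) ⊞ ⊟ v₀) (refl , tt)) pz
    z≡ : z ≡ ι (π z)
    z≡ = ι-surjective z (pos-asym pz) (<-trans z<z+z q)
    zz≡ : z + z ≡ ι (π (z + z))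
    zz≡ = ι-surjective (z + z) (pos-asym (pos-+ pz pz)) q
    result : (Σ A λ c → OrAll V false c × ι (π z) < pos 2 · ι c × pos 2 · ι c < ι (π (z + z))) → Σ Carrier λ w → z < w × w < z + z
    result (c , _ , p , r) = pos 2 · ι c , subst (λ z → z < pos 2 · ι c) (sym z≡) p , subst (λ z → pos 2 · ι c < z) (sym zz≡) r
  gap : ∀ z → ¬ (Σ Carrier λ y → Pos y × y < z) → ∀ w → z < w → ¬ w < z + z
  gap z none w p q = none (w + - z , p , subst Pos
      (solve [] (z ∷ w ∷ []) ((v₀ ⊞ v₀) ⊞ ⊟ v₁) (v₀ ⊞ ⊟ (v₁ ⊞ ⊟ v₀)) (refl , refl , tt)) q)
  ι-≤ : ∀ z → ¬ (Σ Carrier λ y → Pos y × y < z) → ¬ z + z < u → ∀ a → ι a ≡ 𝟘 ⊎ ι a ≡ z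
  ι-≤ z none double a = cases em (<-tri (ι a) z) (<-tri (ι a) (z + z))
    where
    cases : Dec (a ≡ 0ᴬ) → ι a < z ⊎ ι a ≡ z ⊎ z < ι a → ι a < z + z ⊎ ι a ≡ z + z ⊎ z + z < ι a → ι a ≡ 𝟘 ⊎ ι a ≡ z
    cases (yes a≡0) _               _               = inj₁ (trans (cong ι a≡0) ι-0)
    cases (no a≢0)  (inj₁ p)        _               = ⊥-elim (none (ι a , ι-≢0⇒Pos a≢0 , p))
    cases (no a≢0)  (inj₂ (inj₁ e)) _               = inj₂ e
    cases (no a≢0)  (inj₂ (inj₂ p)) (inj₁ q)        = ⊥-elim (gap z none (ι a) p q)
    cases (no a≢0)  (inj₂ (inj₂ p)) (inj₂ (inj₁ e)) = ⊥-elim (double (subst (_< u) e (ι-<u a)))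
    cases (no a≢0)  (inj₂ (inj₂ p)) (inj₂ (inj₂ q)) = ⊥-elim (double (<-trans q (ι-<u a)))
  -- A least positive z would force 2z ≥ u, hence A = {0 , z}, against the infinite index.
  no-least : ∀ z → Pos z → Σ Carrier λ y → Pos y × y < z
  no-least z pz = cases em
    where
    cases : Dec (Σ Carrier λ y → Pos y × y < z) → Σ Carrier λ y → Pos y × y < z
    cases (yes found) = found
    cases (no none)   = ⊥-elim (atMostTwo z (ι-≤ z none λ q → double (double-<u pz q)))
      where
      double : (Σ Carrier λ w → z < w × w < z + z) → ⊥
      double (w , p , r) = gap z none w p r

  below-both : ∀ {p q} → Pos p → Pos q → Σ Carrier λ y → Pos y × y < p × y < q
  below-both {p} {q} pp pq with <-tri p q | no-least p pp | no-least q pq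
  ... | inj₁ r           | y , py , y<p | _            = y , py , y<p , <-trans y<p r
  ... | inj₂ (inj₁ refl) | y , py , y<p | _            = y , py , y<p , y<p
  ... | inj₂ (inj₂ r)    | _            | y , py , y<q = y , py , <-trans y<q r , y<q

  Between : ℕ → Carrier → Carrier → Set ℓ
  Between k s t = Σ Carrier λ g → G̃ g × s < pos k · g × pos k · g < t

  -- Density of `V` concerns intervals of `A` that are known to be inhabited. Choosing y₀ below both
  -- t - s and u - ι a keeps (ι a , ι a + y₀) in one copy of [0 , u); a smaller positive y₁ supplies
  -- the inhabitant. The point found is moved back by m u.
  between-ι : ∀ a m t → ι a + m · u < t → Between 1 (ι a + m · u) t
  between-ι a m t s<t = first (below-both s<t (ι-<u a))
    where
    ahead : ∀ {y} → Pos y → ι a < ι a + y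
    ahead {y} = subst Pos (solve [] (ι a ∷ y ∷ []) v₁ ((v₀ ⊞ v₁) ⊞ ⊟ v₀) (refl , refl , tt))
    lifted : ∀ {y} → Pos y → ι a + y < u → ι a + y ≡ ι (π (ι a + y))
    lifted {y} py = ι-surjective _ λ r → ι-nonneg a (subst Pos
      (solve [] (ι a ∷ y ∷ []) (⊟ (v₀ ⊞ v₁) ⊞ v₁) (⊟ v₀) (refl , refl , tt)) (pos-+ r py))
    first : (Σ Carrier λ y → Pos y × y < t + - (ι a + m · u) × y < u + - ι a) → Between 1 (ι a + m · u) t
    first (y₀ , py₀ , y₀<t , y₀<u) = second (no-least y₀ py₀)
      where
      top : ι a + y₀ < u
      top = subst Pos (solve [] (ι a ∷ y₀ ∷ u ∷ []) ((v₂ ⊞ ⊟ v₀) ⊞ ⊟ v₁) (v₂ ⊞ ⊟ (v₀ ⊞ v₁)) (refl , refl , refl , tt)) y₀<u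
      below : ι (π (ι a + y₀)) + m · u < t
      below = subst (λ z → z + m · u < t) (lifted py₀ top) (subst Pos
        (solve [] (ι a ∷ y₀ ∷ m · u ∷ t ∷ []) ((v₃ ⊞ ⊟ (v₀ ⊞ v₂)) ⊞ ⊟ v₁) (v₃ ⊞ ⊟ (v₀ ⊞ v₁ ⊞ v₂)) (refl , refl , refl , refl , tt)) y₀<t)
      third : (Σ A λ g → V g × 𝒪 a g (π (ι a + y₀))) → Between 1 (ι a + m · u) t
      third (g , Vg , o) = ι g + m · u , subst V (sym (trans (π-+·u (ι g) m) (π-ι g))) Vg
                         , subst (ι a + m · u <_) (sym (1· _)) (<-shift (m · u) (proj₁ between))
                         , subst (_< t) (sym (1· _)) (<-trans (<-shift (m · u) (proj₂ between)) below)
        where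
        between : ι a < ι g × ι g < ι (π (ι a + y₀))
        between = 𝒪-between (subst (ι a <_) (lifted py₀ top) (ahead py₀)) o
      second : (Σ Carrier λ y → Pos y × y < y₀) → Between 1 (ι a + m · u) t
      second (y₁ , py₁ , y₁<y₀) = third (V-dense a (π (ι a + y₀)) (π (ι a + y₁) , from (𝒪⇔< _ _ _) (inj₁
          ( subst (ι a <_) (lifted py₁ (<-trans mid top)) (ahead py₁)
          , subst₂ _<_ (lifted py₁ (<-trans mid top)) (lifted py₀ top) mid))))
        where
        mid : ι a + y₁ < ι a + y₀
        mid = subst₂ _<_ (comm y₁ (ι a)) (comm y₀ (ι a)) (<-shift (ι a) y₁<y₀)

  between-1 : ∀ s t → s < t → Between 1 s t
  between-1 s t s<t = subst (λ s → Between 1 s t) (sym (proj₂ (winding s)))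
    (between-ι (π s) (proj₁ (winding s)) t (subst (_< t) (proj₂ (winding s)) s<t))

module PairDensity {ℓ : Level} (em : ExcludedMiddle ℓ) (M : LpStr ℓ) (D : PairData M) (C : UniversalCover (LpStr.base M)) where
  open LpStr M renaming (Carrier to A)
  open OStrDefs base using () renaming (_·_ to _×ᴬ_)
  open PairData D
  open UniversalCover C hiding (_<_)
  open CoverOrder oriented C
  open PairCover em M D C
  open Solver

  G̃-+ : ∀ {x y} → G̃ x → G̃ y → G̃ (x + y)
  G̃-+ {x} {y} p q = subst V (sym (π-+ x y)) (V-+ _ _ p q)

  G̃-neg : ∀ {x} → G̃ x → G̃ (- x)
  G̃-neg {x} p = subst V (sym (π-neg x)) (V-neg _ p)

  -- Density of the p-multiples of G̃, one copy of [0 , u) at a time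

  module _ (p : ℕ) (prime-p : Prime p) where

    DenseAt : Carrier → Set ℓ
    DenseAt v = ∀ s t → ¬ s < v → ¬ v + u < t → s < t → Between p s t

    -- Regular density of `G` asks for endpoints in `G` with a positive left one. Density of G̃
    -- first places g₁ < g₂ strictly between s and t.
    dense-𝟘 : DenseAt 𝟘
    dense-𝟘 s t s≥0 t≤u s<t = first (between-1 s t s<t)
      where
      second : ∀ g₁ → G̃ g₁ → s < g₁ → g₁ < t → Between 1 g₁ t → Between p s t
      second g₁ Vg₁ s<g₁ g₁<t (g₂ , Vg₂ , g₁<g₂′ , g₂<t′) = conclude
          (regularᴸ true p prime-p Vg₁ Vg₂ (subst Pos ι₁ pos₁) (subst₂ _<_ ι₁ ι₂ g₁<g₂))
        where
        g₁<g₂ : g₁ < g₂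
        g₁<g₂ = subst (g₁ <_) (1· g₂) g₁<g₂′
        g₂<t : g₂ < t
        g₂<t = subst (_< t) (1· g₂) g₂<t′
        pos₁ : Pos g₁
        pos₁ with pos-tri g₁
        ... | inj₁ q           = q
        ... | inj₂ (inj₁ refl) = ⊥-elim (s≥0 s<g₁)
        ... | inj₂ (inj₂ q)    = ⊥-elim (s≥0 (<-trans s<g₁ (<-via-neg q)))
        g₂<u : g₂ < u
        g₂<u with <-tri g₂ u
        ... | inj₁ q           = q
        ... | inj₂ (inj₁ refl) = ⊥-elim (t≤u (subst (_< t) (sym (idˡ u)) g₂<t))
        ... | inj₂ (inj₂ q)    = ⊥-elim (t≤u (subst (_< t) (sym (idˡ u)) (<-trans q g₂<t)))
        ι₁ : g₁ ≡ ι (π g₁)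
        ι₁ = ι-surjective g₁ (pos-asym pos₁) (<-trans g₁<g₂ g₂<u)
        ι₂ : g₂ ≡ ι (π g₂)
        ι₂ = ι-surjective g₂ (λ q → <-asym g₁<g₂ (<-trans (<-via-neg q) (subst Pos (sym (trans (cong (g₁ +_) neg-𝟘) (idʳ g₁))) pos₁))) g₂<u
        conclude : (Σ A λ c → V c × ι (π g₁) < pos p · ι c × pos p · ι c < ι (π g₂)) → Between p s t
        conclude (c , Vc , q , r) = ι c , subst V (sym (π-ι c)) Vc
          , <-trans s<g₁ (subst (_< pos p · ι c) (sym ι₁) q) , <-trans (subst (pos p · ι c <_) (sym ι₂) r) g₂<t
      first : Between 1 s t → Between p s t
      first (g , Vg , s<g , g<t) = second g Vg (subst (s <_) (1· g) s<g) (subst (_< t) (1· g) g<t)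
                                     (between-1 g t (subst (_< t) (1· g) g<t))

    -- Shifting by p d with u - p d small replaces an exact shift by u, which need not be divisible by p.
    nearUnit : ∀ ε → Pos ε → ε < u → Σ Carrier λ d → G̃ d × u + - ε < pos p · d × pos p · d < u
    nearUnit ε ε>0 ε<u = dense-𝟘 (u + - ε) u
      (λ q → pos-asym ε<u (subst Pos (idˡ _) q))
      (λ q → <-irrefl (subst (_< u) (idˡ u) q))
      (subst Pos (solve [] (ε ∷ u ∷ []) v₀ (v₁ ⊞ ⊟ (v₁ ⊞ ⊟ v₀)) (refl , refl , tt)) ε>0)

    -- Replace (s , t) by (s - p d , t - u). Since p d < u, it lies within [v , v + u]; since u - p
    -- d < ε < t - s, it is not empty. A multiple p e found there gives p (e + d) in (s , t).
    dense-up : ∀ v → DenseAt v → DenseAt (v + u)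
    dense-up v dense s t s≥ t≤ s<t = start (below-both s<t pos-u)
      where
      close : ∀ d → G̃ d → Between p (s + - (pos p · d)) (t + - u) → pos p · d < u → Between p s t
      close d Vd (e , Ve , q , r) pd<u = e + d , G̃-+ Ve Vd
        , subst Pos (solve (pos p ∷ []) (s ∷ d ∷ e ∷ []) (k₀ ⊡ v₂ ⊞ ⊟ (v₀ ⊞ ⊟ (k₀ ⊡ v₁))) (k₀ ⊡ (v₂ ⊞ v₁) ⊞ ⊟ v₀) (refl , refl , refl , tt)) q
        , subst Pos (solve (pos p ∷ []) (t ∷ d ∷ e ∷ u ∷ []) (((v₀ ⊞ ⊟ v₃) ⊞ ⊟ (k₀ ⊡ v₂)) ⊞ (v₃ ⊞ ⊟ (k₀ ⊡ v₁))) (v₀ ⊞ ⊟ (k₀ ⊡ (v₂ ⊞ v₁)))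
                       (refl , refl , refl , refl , tt)) (pos-+ r pd<u)
      middle : ∀ ε → ε < t + - s → (Σ Carrier λ d → G̃ d × u + - ε < pos p · d × pos p · d < u) → Between p s t
      middle ε ε<ts (d , Vd , q , r) = close d Vd (dense (s + - (pos p · d)) (t + - u)
          (λ w → s≥ (subst Pos (solve (pos p ∷ []) (s ∷ v ∷ d ∷ u ∷ []) ((v₁ ⊞ ⊟ (v₀ ⊞ ⊟ (k₀ ⊡ v₂))) ⊞ (v₃ ⊞ ⊟ (k₀ ⊡ v₂))) ((v₁ ⊞ v₃) ⊞ ⊟ v₀)
                       (refl , refl , refl , refl , tt)) (pos-+ w r)))
          (λ w → t≤ (subst Pos (solve [] (t ∷ v ∷ u ∷ []) ((v₀ ⊞ ⊟ v₂) ⊞ ⊟ (v₁ ⊞ v₂)) (v₀ ⊞ ⊟ ((v₁ ⊞ v₂) ⊞ v₂)) (refl , refl , refl , tt)) w))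
          (subst Pos (solve (pos p ∷ []) (s ∷ t ∷ d ∷ u ∷ ε ∷ []) (((v₁ ⊞ ⊟ v₀) ⊞ ⊟ v₄) ⊞ (k₀ ⊡ v₂ ⊞ ⊟ (v₃ ⊞ ⊟ v₄)))
                       ((v₁ ⊞ ⊟ v₃) ⊞ ⊟ (v₀ ⊞ ⊟ (k₀ ⊡ v₂))) (refl , refl , refl , refl , refl , tt)) (pos-+ ε<ts q))) r
      start : (Σ Carrier λ ε → Pos ε × ε < t + - s × ε < u) → Between p s t
      start (ε , ε>0 , ε<ts , ε<u) = middle ε ε<ts (nearUnit ε ε>0 ε<u)

    -- The mirror image: the interval becomes (s + u , t + p d), and d is subtracted afterwards.
    dense-down : ∀ v → DenseAt (v + u) → DenseAt v
    dense-down v dense s t s≥ t≤ s<t = start (below-both s<t pos-u)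
      where
      close : ∀ d → G̃ d → Between p (s + u) (t + pos p · d) → pos p · d < u → Between p s t
      close d Vd (e , Ve , q , r) pd<u = e + - d , G̃-+ Ve (G̃-neg Vd)
        , subst Pos (solve (pos p ∷ []) (s ∷ d ∷ e ∷ u ∷ []) ((k₀ ⊡ v₂ ⊞ ⊟ (v₀ ⊞ v₃)) ⊞ (v₃ ⊞ ⊟ (k₀ ⊡ v₁))) (k₀ ⊡ (v₂ ⊞ ⊟ v₁) ⊞ ⊟ v₀)
                       (refl , refl , refl , refl , tt)) (pos-+ q pd<u)
        , subst Pos (solve (pos p ∷ []) (t ∷ d ∷ e ∷ []) ((v₀ ⊞ k₀ ⊡ v₁) ⊞ ⊟ (k₀ ⊡ v₂)) (v₀ ⊞ ⊟ (k₀ ⊡ (v₂ ⊞ ⊟ v₁))) (refl , refl , refl , tt)) r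
      middle : ∀ ε → ε < t + - s → (Σ Carrier λ d → G̃ d × u + - ε < pos p · d × pos p · d < u) → Between p s t
      middle ε ε<ts (d , Vd , q , r) = close d Vd (dense (s + u) (t + pos p · d)
          (λ w → s≥ (subst Pos (solve [] (s ∷ v ∷ u ∷ []) ((v₁ ⊞ v₂) ⊞ ⊟ (v₀ ⊞ v₂)) (v₁ ⊞ ⊟ v₀) (refl , refl , refl , tt)) w))
          (λ w → t≤ (subst Pos (solve (pos p ∷ []) (t ∷ v ∷ d ∷ u ∷ []) (((v₀ ⊞ k₀ ⊡ v₂) ⊞ ⊟ ((v₁ ⊞ v₃) ⊞ v₃)) ⊞ (v₃ ⊞ ⊟ (k₀ ⊡ v₂))) (v₀ ⊞ ⊟ (v₁ ⊞ v₃))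
                       (refl , refl , refl , refl , tt)) (pos-+ w r)))
          (subst Pos (solve (pos p ∷ []) (s ∷ t ∷ d ∷ u ∷ ε ∷ []) (((v₁ ⊞ ⊟ v₀) ⊞ ⊟ v₄) ⊞ (k₀ ⊡ v₂ ⊞ ⊟ (v₃ ⊞ ⊟ v₄)))
                       ((v₁ ⊞ k₀ ⊡ v₂) ⊞ ⊟ (v₀ ⊞ v₃)) (refl , refl , refl , refl , refl , tt)) (pos-+ ε<ts q))) r
      start : (Σ Carrier λ ε → Pos ε × ε < t + - s × ε < u) → Between p s t
      start (ε , ε>0 , ε<ts , ε<u) = middle ε ε<ts (nearUnit ε ε>0 ε<u)

    denseAt : ∀ m → DenseAt (m · u)
    denseAt (pos zero)      = dense-𝟘
    denseAt (pos (suc n))   = subst DenseAt (comm (pos n · u) u) (dense-up (pos n · u) (denseAt (pos n)))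
    denseAt -[1+ zero ]     = dense-down (-[1+ 0 ] · u) (subst DenseAt
      (solve [] (u ∷ []) ∅ (con -[1+ 0 ] ⊡ v₀ ⊞ v₀) (refl , tt)) dense-𝟘)
    denseAt -[1+ suc n ]    = dense-down (-[1+ suc n ] · u) (subst DenseAt
      (solve (pos n ∷ []) (u ∷ []) (⊟ (v₀ ⊞ k₀ ⊡ v₀)) (⊟ (v₀ ⊞ (v₀ ⊞ k₀ ⊡ v₀)) ⊞ v₀) (refl , tt)) (denseAt -[1+ n ]))

    between-p : ∀ s t → s < t → Between p s t
    between-p s t s<t = cases (<-tri t (m · u + u))
      where
      m = proj₁ (winding s)
      s≡ = proj₂ (winding s)
      s≥ : ¬ s < m · u
      s≥ q = ι-nonneg (π s) (subst Pos (trans (cong (λ z → m · u + - z) s≡)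
        (solve [] (ι (π s) ∷ m · u ∷ []) (v₁ ⊞ ⊟ (v₀ ⊞ v₁)) (⊟ v₀) (refl , refl , tt))) q)
      s< : s < m · u + u
      s< = subst₂ _<_ (sym s≡) (comm u (m · u)) (<-shift (m · u) (ι-<u (π s)))
      cases : t < m · u + u ⊎ t ≡ m · u + u ⊎ m · u + u < t → Between p s t
      cases (inj₁ q)           = denseAt m s t s≥ (<-asym q) s<t
      cases (inj₂ (inj₁ refl)) = denseAt m s t s≥ <-irrefl s<t
      -- An interval that leaves the copy of [0 , u) containing s is truncated at the end of that
      -- copy.
      cases (inj₂ (inj₂ q))    = shorten (denseAt m s (m · u + u) s≥ <-irrefl s<)
        where
        shorten : Between p s (m · u + u) → Between p s t
        shorten (g , Vg , a , b) = g , Vg , a , <-trans b q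

  -- Two multiples p h₁ < p h₂ inside (s , t) leave room for some k c between h₁ and h₂; multiplied
  -- by p, it lands in (s , t).
  between-* : ∀ p k → 1 ≤ p → (∀ s t → s < t → Between p s t) → (∀ s t → s < t → Between k s t) →
              ∀ s t → s < t → Between (p ℕ.* k) s t
  between-* p k p≥1 dense-p dense-k s t s<t = first (dense-p s t s<t)
    where
    product· : ∀ c → pos p · pos k · c ≡ pos (p ℕ.* k) · c
    product· c = sym (trans (cong (_· c) (ℤₚ.pos-* p k)) (·-* (pos p) (pos k) c))
    scale : ∀ {a b} → a < b → pos p · a < pos p · b
    scale {a} {b} q = subst Pos (solve (pos p ∷ []) (a ∷ b ∷ []) (k₀ ⊡ (v₁ ⊞ ⊟ v₀)) (k₀ ⊡ v₁ ⊞ ⊟ (k₀ ⊡ v₀)) (refl , refl , tt)) (pos-scale p p≥1 q)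
    unscale : ∀ {a b} → pos p · a < pos p · b → a < b
    unscale {a} {b} q = pos-unscale p p≥1 (subst Pos
      (solve (pos p ∷ []) (a ∷ b ∷ []) (k₀ ⊡ v₁ ⊞ ⊟ (k₀ ⊡ v₀)) (k₀ ⊡ (v₁ ⊞ ⊟ v₀)) (refl , refl , tt)) q)
    third : ∀ h₁ h₂ → s < pos p · h₁ → pos p · h₂ < t → Between k h₁ h₂ → Between (p ℕ.* k) s t
    third h₁ h₂ q r (c , Vc , a , b) = c , Vc , <-trans q (subst (pos p · h₁ <_) (product· c) (scale a))
                                             , <-trans (subst (_< pos p · h₂) (product· c) (scale b)) r
    second : ∀ h₁ → s < pos p · h₁ → Between p (pos p · h₁) t → Between (p ℕ.* k) s t
    second h₁ q (h₂ , _ , a , b) = third h₁ h₂ q b (dense-k h₁ h₂ (unscale a))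
    first : Between p s t → Between (p ℕ.* k) s t
    first (h₁ , _ , a , b) = second h₁ a (dense-p (pos p · h₁) t b)

  between-k : ∀ k → 1 ≤ k → ∀ s t → s < t → Between k s t
  between-k k@(suc _) _ = subst (λ k → ∀ s t → s < t → Between k s t) (sym (PrimeFactorisation.isFactorisation F))
                            (go _ (PrimeFactorisation.factorsPrime F))
    where
    F = factorise k
    go : ∀ ps → All Prime ps → ∀ s t → s < t → Between (product ps) s t
    go []       []         = between-1
    go (p ∷ ps) (pp ∷ pps) = between-* p (product ps) (ℕ.>-nonZero⁻¹ p {{prime⇒nonZero pp}}) (between-p p pp) (go ps pps)

  -- If k b = π z in the group below, then k ι b and z have the same projection and differ by their
  -- winding numbers.
  divisibleᴸ : ∀ h k → 1 ≤ k → ∀ {z} → OrAll G̃ h z → Σ ℤ λ j → Σ Carrier λ b → OrAll G̃ h b × z + j · u ≡ pos k · b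
  divisibleᴸ h k k≥1 {z} p = conclude (divide h k k≥1 (π z) (down h p))
    where
    down : ∀ h → OrAll G̃ h z → OrAll V h (π z)
    down true  q = q
    down false _ = lift tt
    up : ∀ h {b} → OrAll V h b → OrAll G̃ h (ι b)
    up true  {b} q = subst V (sym (π-ι b)) q
    up false _ = lift tt
    conclude : (Σ A λ b → OrAll V h b × k ×ᴬ b ≡ π z) → Σ ℤ λ j → Σ Carrier λ b → OrAll G̃ h b × z + j · u ≡ pos k · b
    conclude (b , Vb , eq) = n ℤ.- m , ι b , up h Vb , (begin
        z + (n ℤ.- m) · u                            ≡⟨ cong (_+ (n ℤ.- m) · u) (proj₂ (winding z)) ⟩
        ι (π z) + m · u + (n ℤ.- m) · u              ≡⟨ solve (m ∷ n ∷ []) (ι (π z) ∷ u ∷ []) ((v₀ ⊞ k₀ ⊡ v₁) ⊞ (k₁ :+ (:- k₀)) ⊡ v₁) (v₀ ⊞ k₁ ⊡ v₁) (refl , refl , tt) ⟩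
        ι (π z) + n · u                              ≡⟨ cong (λ a → ι a + n · u) same ⟨
        ι (π (pos k · ι b)) + n · u                  ≡⟨ proj₂ (winding (pos k · ι b)) ⟨
        pos k · ι b                                  ∎)
      where
      open ≡-Reasoning
      m = proj₁ (winding z)
      n = proj₁ (winding (pos k · ι b))
      same : π (pos k · ι b) ≡ π z
      same = trans (π-·ℕ k (ι b)) (trans (cong (k ×ᴬ_) (π-ι b)) eq)

  coverPair : OrderedPair ℓ
  coverPair = record
    { orderedGroup = ordered ; G = G̃
    ; G-𝟘 = subst V (sym π-𝟘) V-0 ; G-+ = G̃-+ ; G-neg = G̃-neg ; G-u = subst V (sym π-u) V-0
    ; divisible = divisibleᴸ ; dense = between-k
    ; infinite = λ n → (λ i → ι (proj₁ (V-index n) i)) , λ i j i≢j q → proj₂ (V-index n) i j i≢j (subst V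
        (trans (π-+ _ _) (cong₂ _+ᴬ_ (π-ι _) (trans (π-neg _) (cong -ᴬ_ (π-ι _))))) q) }

-- Definability of signs and divisibility

lift-renaming : ∀ {n n′} → (Fin n → Fin n′) → Fin (suc n) → Fin (suc n′)
lift-renaming σ zero    = zero
lift-renaming σ (suc i) = suc (σ i)

renameᵗ : ∀ {n n′} → (Fin n → Fin n′) → Term n → Term n′
renameᵗ σ (var i) = var (σ i)
renameᵗ σ (s ⊕ t) = renameᵗ σ s ⊕ renameᵗ σ t
renameᵗ σ (⊝ t)   = ⊝ renameᵗ σ t
renameᵗ σ 𝟎       = 𝟎

rename : ∀ {n n′} → (Fin n → Fin n′) → Formula n → Formula n′
rename σ (s ≐ t)    = renameᵗ σ s ≐ renameᵗ σ t
rename σ (𝒪ᶠ s t r) = 𝒪ᶠ (renameᵗ σ s) (renameᵗ σ t) (renameᵗ σ r)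
rename σ (Vᶠ t)     = Vᶠ (renameᵗ σ t)
rename σ (¬ᶠ φ)     = ¬ᶠ rename σ φ
rename σ (φ ∧ᶠ ψ)   = rename σ φ ∧ᶠ rename σ ψ
rename σ (∃ᶠ φ)     = ∃ᶠ (rename (lift-renaming σ) φ)

×-⇔ : ∀ {a b c d} {A : Set a} {B : Set b} {C : Set c} {D : Set d} → A ⇔ B → C ⇔ D → (A × C) ⇔ (B × D)
×-⇔ f g = mk⇔ (λ { (a , c) → to f a , to g c }) (λ { (b , d) → from f b , from g d })

¬-⇔ : ∀ {a b} {A : Set a} {B : Set b} → A ⇔ B → (¬ A) ⇔ (¬ B)
¬-⇔ f = mk⇔ (λ n b → n (from f b)) (λ n a → n (to f a))

Σ-⇔ : ∀ {a p q} {A : Set a} {P : A → Set p} {Q : A → Set q} → (∀ x → P x ⇔ Q x) → Σ A P ⇔ Σ A Q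
Σ-⇔ f = mk⇔ (λ { (x , p) → x , to (f x) p }) (λ { (x , q) → x , from (f x) q })

module Renaming {ℓ : Level} (M : LpStr ℓ) where
  open LpStr M
  open Semantics M

  renameᵗ-correct : ∀ {n n′} (σ : Fin n → Fin n′) (t : Term n) {ρ ρ′} → (∀ i → ρ′ (σ i) ≡ ρ i) → ⟦ renameᵗ σ t ⟧ₜ ρ′ ≡ ⟦ t ⟧ₜ ρ
  renameᵗ-correct σ (var i) e = e i
  renameᵗ-correct σ (s ⊕ t) e = cong₂ _+ᴬ_ (renameᵗ-correct σ s e) (renameᵗ-correct σ t e)
  renameᵗ-correct σ (⊝ t)   e = cong -ᴬ_ (renameᵗ-correct σ t e)
  renameᵗ-correct σ 𝟎       e = refl

  rename-correct : ∀ {n n′} (σ : Fin n → Fin n′) (φ : Formula n) {ρ ρ′} → (∀ i → ρ′ (σ i) ≡ ρ i) → Sat (rename σ φ) ρ′ ⇔ Sat φ ρ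
  rename-correct σ (s ≐ t) e =
    mk⇔ (subst₂ _≡_ (renameᵗ-correct σ s e) (renameᵗ-correct σ t e))
        (subst₂ _≡_ (sym (renameᵗ-correct σ s e)) (sym (renameᵗ-correct σ t e)))
  rename-correct σ (𝒪ᶠ s t r) {ρ} {ρ′} e
    rewrite renameᵗ-correct σ s {ρ} {ρ′} e | renameᵗ-correct σ t {ρ} {ρ′} e | renameᵗ-correct σ r {ρ} {ρ′} e = ⇔-refl
  rename-correct σ (Vᶠ t)     e = ≡⇒⇔ V (renameᵗ-correct σ t e)
  rename-correct σ (¬ᶠ φ)     e = ¬-⇔ (rename-correct σ φ e)
  rename-correct σ (φ ∧ᶠ ψ)   e = ×-⇔ (rename-correct σ φ e) (rename-correct σ ψ e)
  rename-correct σ (∃ᶠ φ)     e = Σ-⇔ λ a → rename-correct (lift-renaming σ) φ λ { zero → refl ; (suc i) → e i }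

module Definability {ℓ : Level} (em : ExcludedMiddle ℓ) (M : LpStr ℓ) (D : PairData M) (C : UniversalCover (LpStr.base M)) where
  open LpStr M renaming (Carrier to A)
  open PairData D using (oriented)
  open UniversalCover C hiding (_<_)
  open CoverOrder oriented C using (groupᴬ; π-+·u; ι-≢0⇒Pos; 𝒪-0⇒<; <⇒𝒪-0; ι-sum; ι-sum-≮)
  open PairDensity em M D C using (coverPair)
  open OrderLemmas coverPair
  open OrderedPair coverPair using (H; G-u)
  open Semantics M
  open Renaming M
  open Solver using (solve; _⊞_; ⊟_; _⊡_; con; _:+_; _:*_; :-_; v₀; v₁; v₂; k₀; k₁; k₂)

  ⊤ᶠ ⊥ᶠ : ∀ {n} → Formula n
  ⊤ᶠ = 𝟎 ≐ 𝟎
  ⊥ᶠ = ¬ᶠ ⊤ᶠ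

  infixr 5 _∨ᶠ_
  _∨ᶠ_ : ∀ {n} → Formula n → Formula n → Formula n
  φ ∨ᶠ ψ = ¬ᶠ ((¬ᶠ φ) ∧ᶠ (¬ᶠ ψ))

  ∨ᶠ-correct : ∀ {n} (φ ψ : Formula n) ρ → Sat (φ ∨ᶠ ψ) ρ ⇔ (Sat φ ρ ⊎ Sat ψ ρ)
  ∨ᶠ-correct φ ψ ρ = mk⇔ forth λ { (inj₁ p) (n , _) → n p ; (inj₂ q) (_ , n) → n q }
    where
    forth : Sat (φ ∨ᶠ ψ) ρ → Sat φ ρ ⊎ Sat ψ ρ
    forth n with em {Sat φ ρ} | em {Sat ψ ρ}
    ... | yes p | _     = inj₁ p
    ... | no _  | yes q = inj₂ q
    ... | no np | no nq = ⊥-elim (n (np , nq))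

  if_then_else_ : ∀ {n} → Formula n → Formula n → Formula n → Formula n
  if χ then φ else ψ = (χ ∧ᶠ φ) ∨ᶠ ((¬ᶠ χ) ∧ᶠ ψ)

  if-correct : ∀ {n} (χ φ ψ : Formula n) ρ {P : Set ℓ} →
               (Sat χ ρ → Sat φ ρ ⇔ P) → (¬ Sat χ ρ → Sat ψ ρ ⇔ P) → Sat (if χ then φ else ψ) ρ ⇔ P
  if-correct χ φ ψ ρ {P} f g = ⇔-trans (∨ᶠ-correct (χ ∧ᶠ φ) ((¬ᶠ χ) ∧ᶠ ψ) ρ)
    (mk⇔ (λ { (inj₁ (c , p)) → to (f c) p ; (inj₂ (c , p)) → to (g c) p }) (λ p → back p em))
    where
    back : P → Dec (Sat χ ρ) → (Sat χ ρ × Sat φ ρ) ⊎ (¬ Sat χ ρ × Sat ψ ρ)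
    back p (yes c) = inj₁ (c , from (f c) p)
    back p (no c)  = inj₂ (c , from (g c) p)

  ⋀ : ∀ {n} {X : Set} → List X → (X → Formula n) → Formula n
  ⋀ []       φ = ⊤ᶠ
  ⋀ (x ∷ xs) φ = φ x ∧ᶠ ⋀ xs φ

  ⋀-correct : ∀ {n} {X : Set} (xs : List X) (φ : X → Formula n) ρ → Sat (⋀ xs φ) ρ ⇔ (∀ x → x ∈ xs → Sat (φ x) ρ)
  ⋀-correct []       φ ρ = mk⇔ (λ _ _ ()) (λ _ → refl)
  ⋀-correct (x ∷ xs) φ ρ = mk⇔
    (λ { (p , q) y (here refl) → p ; (p , q) y (there y∈) → to (⋀-correct xs φ ρ) q y y∈ })
    (λ f → f x (here refl) , from (⋀-correct xs φ ρ) (λ y y∈ → f y (there y∈)))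

  less : ∀ {n} → Term n → Term n → Formula n
  less s t = ((s ≐ 𝟎) ∧ᶠ (¬ᶠ (t ≐ 𝟎))) ∨ᶠ 𝒪ᶠ 𝟎 s t

  ι<⇔ : ∀ a b → ((a ≡ 0ᴬ × b ≢ 0ᴬ) ⊎ 𝒪 0ᴬ a b) ⇔ (ι a < ι b)
  ι<⇔ a b = mk⇔ forth (λ p → back p em)
    where
    vs-0 : ∀ {b} → ι b + - ι 0ᴬ ≡ ι b
    vs-0 {b} = trans (cong (λ z → ι b + - z) ι-0) (trans (cong (ι b +_) neg-𝟘) (idʳ _))
    forth : (a ≡ 0ᴬ × b ≢ 0ᴬ) ⊎ 𝒪 0ᴬ a b → ι a < ι b
    forth (inj₁ (refl , b≢0)) = subst Pos (sym vs-0) (ι-≢0⇒Pos b≢0)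
    forth (inj₂ o)            = 𝒪-0⇒< o
    back : ι a < ι b → Dec (a ≡ 0ᴬ) → (a ≡ 0ᴬ × b ≢ 0ᴬ) ⊎ 𝒪 0ᴬ a b
    back p (yes refl) = inj₁ (refl , λ { refl → <-irrefl p })
    back p (no a≢0)   = inj₂ (<⇒𝒪-0 (ι-≢0⇒Pos a≢0) p)

  less-correct : ∀ {n} (s t : Term n) ρ → Sat (less s t) ρ ⇔ (ι (⟦ s ⟧ₜ ρ) < ι (⟦ t ⟧ₜ ρ))
  less-correct s t ρ = ⇔-trans (∨ᶠ-correct ((s ≐ 𝟎) ∧ᶠ (¬ᶠ (t ≐ 𝟎))) (𝒪ᶠ 𝟎 s t) ρ) (ι<⇔ _ _)

  -- Terms of the language compute modulo u; these expressions denote elements of L itself, where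
  -- sign and divisibility make sense.
  data Linear (n : ℕ) : Set where
    var  : Fin n → Linear n
    unit : ℤ → Linear n
    add  : Linear n → Linear n → Linear n
    neg  : Linear n → Linear n

  value : ∀ {n} → Linear n → Vector A n → Carrier
  value (var i)    ρ = ι (ρ i)
  value (unit m)   ρ = m · u
  value (add e e′) ρ = value e ρ + value e′ ρ
  value (neg e)    ρ = - value e ρ

  times : ∀ {n} → ℕ → Linear n → Linear n
  times zero    e = unit ℤ.0ℤ
  times (suc k) e = add e (times k e)

  timesᶻ : ∀ {n} → ℤ → Linear n → Linear n
  timesᶻ (pos k)  e = times k e
  timesᶻ -[1+ k ] e = neg (times (suc k) e)

  value-times : ∀ {n} k (e : Linear n) ρ → value (times k e) ρ ≡ k ·ℕ value e ρ
  value-times zero    e ρ = refl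
  value-times (suc k) e ρ = cong (value e ρ +_) (value-times k e ρ)

  value-timesᶻ : ∀ {n} k (e : Linear n) ρ → value (timesᶻ k e) ρ ≡ k · value e ρ
  value-timesᶻ (pos k)  e ρ = value-times k e ρ
  value-timesᶻ -[1+ k ] e ρ = cong -_ (value-times (suc k) e ρ)

  combination : ∀ {m n} → Vector ℤ m → (Fin m → Fin n) → Linear n
  combination {zero}  l σ = unit ℤ.0ℤ
  combination {suc m} l σ = add (timesᶻ (l zero) (var (σ zero))) (combination (l ∘ suc) (σ ∘ suc))

  linear : ∀ {m n} → Form m → (Fin m → Fin n) → Linear n
  linear (l , m) σ = add (combination l σ) (unit m)

  value-linear : ∀ {m n} (f : Form m) (σ : Fin m → Fin n) {ρ} {y : Vector A m} → (∀ i → ρ (σ i) ≡ y i) →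
                 value (linear f σ) ρ ≡ val f (ι ∘ y)
  value-linear (l , m) σ {ρ} {y} e = cong (_+ m · u) (go l σ e)
    where
    go : ∀ {m} (l : Vector ℤ m) (σ : Fin m → Fin _) {y : Vector A m} → (∀ i → ρ (σ i) ≡ y i) → value (combination l σ) ρ ≡ lin l (ι ∘ y)
    go {zero}  l σ e = refl
    go {suc m} l σ e = cong₂ _+_ (trans (value-timesᶻ (l zero) (var (σ zero)) ρ) (cong (λ a → l zero · ι a) (e zero)))
                                 (go (l ∘ suc) (σ ∘ suc) (e ∘ suc))

  -- Continuation passing: κ receives a term t and a winding number m with value e = ι t + m u,
  -- branching on whether each sum wraps around.
  normalise : ∀ {n} → Linear n → (Term n → ℤ → Formula n) → Formula n
  normalise (var i)    κ = κ (var i) ℤ.0ℤ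
  normalise (unit m)   κ = κ 𝟎 m
  normalise (add e e′) κ = normalise e λ t m → normalise e′ λ t′ m′ →
    if less (t ⊕ t′) t then κ (t ⊕ t′) (m ℤ.+ m′ ℤ.+ ℤ.1ℤ) else κ (t ⊕ t′) (m ℤ.+ m′)
  normalise (neg e)    κ = normalise e λ t m → if (t ≐ 𝟎) then κ 𝟎 (ℤ.- m) else κ (⊝ t) (ℤ.- m ℤ.- ℤ.1ℤ)

  -- The continuation has to be right only for pairs (t , m) that do represent the value of e at ρ;
  -- the guards reject the other branches.
  normalise-correct : ∀ {n} (e : Linear n) κ ρ {P : Set ℓ} →
    (∀ t m → ι (⟦ t ⟧ₜ ρ) + m · u ≡ value e ρ → Sat (κ t m) ρ ⇔ P) → Sat (normalise e κ) ρ ⇔ P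
  normalise-correct (var i)    κ ρ h = h (var i) ℤ.0ℤ (idʳ _)
  normalise-correct (unit m)   κ ρ h = h 𝟎 m (trans (cong (_+ m · u) ι-0) (idˡ _))
  normalise-correct (add e e′) κ ρ {P} h = normalise-correct e _ ρ λ t m eq → normalise-correct e′ _ ρ λ t′ m′ eq′ →
    if-correct (less (t ⊕ t′) t) (κ (t ⊕ t′) (m ℤ.+ m′ ℤ.+ ℤ.1ℤ)) (κ (t ⊕ t′) (m ℤ.+ m′)) ρ
      (λ w → h (t ⊕ t′) (m ℤ.+ m′ ℤ.+ ℤ.1ℤ) (wrapped t t′ m m′ eq eq′ (to (less-correct (t ⊕ t′) t ρ) w) (ι-sum _ _)))
      (λ nw → h (t ⊕ t′) (m ℤ.+ m′) (unwrapped t t′ m m′ eq eq′ (nw ∘ from (less-correct (t ⊕ t′) t ρ)) (ι-sum _ _)))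
    where
    module _ (t t′ : Term _) (m m′ : ℤ) (eq : ι (⟦ t ⟧ₜ ρ) + m · u ≡ value e ρ) (eq′ : ι (⟦ t′ ⟧ₜ ρ) + m′ · u ≡ value e′ ρ) where
      a b : A
      a = ⟦ t ⟧ₜ ρ
      b = ⟦ t′ ⟧ₜ ρ
      Sums : Set ℓ
      Sums = (ι a + ι b ≡ ι (a +ᴬ b)) ⊎ (ι a + ι b ≡ ι (a +ᴬ b) + u × ι (a +ᴬ b) < ι a)
      total : (ι a + ι b) + (m ℤ.+ m′) · u ≡ value e ρ + value e′ ρ
      total = trans (solve (m ∷ m′ ∷ []) (ι a ∷ ι b ∷ u ∷ []) ((v₀ ⊞ v₁) ⊞ (k₀ :+ k₁) ⊡ v₂) ((v₀ ⊞ k₀ ⊡ v₂) ⊞ (v₁ ⊞ k₁ ⊡ v₂)) (refl , refl , refl , tt))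
                    (cong₂ _+_ eq eq′)
      wrapped : ι (a +ᴬ b) < ι a → Sums → ι (a +ᴬ b) + (m ℤ.+ m′ ℤ.+ ℤ.1ℤ) · u ≡ value e ρ + value e′ ρ
      wrapped w (inj₁ s)       = ⊥-elim (ι-sum-≮ a b s w)
      wrapped w (inj₂ (s , _)) = trans
        (solve (m ∷ m′ ∷ []) (ι (a +ᴬ b) ∷ u ∷ []) (v₀ ⊞ (k₀ :+ k₁ :+ con ℤ.1ℤ) ⊡ v₁) ((v₀ ⊞ v₁) ⊞ (k₀ :+ k₁) ⊡ v₁) (refl , refl , tt))
        (trans (cong (_+ (m ℤ.+ m′) · u) (sym s)) total)
      unwrapped : ¬ ι (a +ᴬ b) < ι a → Sums → ι (a +ᴬ b) + (m ℤ.+ m′) · u ≡ value e ρ + value e′ ρ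
      unwrapped nw (inj₁ s)       = trans (cong (_+ (m ℤ.+ m′) · u) (sym s)) total
      unwrapped nw (inj₂ (_ , w)) = ⊥-elim (nw w)
  normalise-correct (neg e)    κ ρ h = normalise-correct e _ ρ λ t m eq →
    if-correct (t ≐ 𝟎) (κ 𝟎 (ℤ.- m)) (κ (⊝ t) (ℤ.- m ℤ.- ℤ.1ℤ)) ρ
      (λ z → h 𝟎 (ℤ.- m) (at-zero t m eq z))
      (λ nz → h (⊝ t) (ℤ.- m ℤ.- ℤ.1ℤ) (nonzero t m eq nz (ι-sum (⟦ t ⟧ₜ ρ) (-ᴬ ⟦ t ⟧ₜ ρ))))
    where
    at-zero : ∀ t m → ι (⟦ t ⟧ₜ ρ) + m · u ≡ value e ρ → ⟦ t ⟧ₜ ρ ≡ 0ᴬ → ι 0ᴬ + (ℤ.- m) · u ≡ - value e ρ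
    at-zero t m eq z = trans (cong (_+ (ℤ.- m) · u) ι-0) (trans (idˡ _) (trans (neg-· m u)
      (cong -_ (trans (sym (trans (cong (_+ m · u) (trans (cong ι z) ι-0)) (idˡ _))) eq))))
    -- For a ≠ 0 the representatives of a and -a add up to u, which costs one extra turn.
    nonzero : ∀ t m → ι (⟦ t ⟧ₜ ρ) + m · u ≡ value e ρ → ⟦ t ⟧ₜ ρ ≢ 0ᴬ →
              (ι (⟦ t ⟧ₜ ρ) + ι (-ᴬ ⟦ t ⟧ₜ ρ) ≡ ι (⟦ t ⟧ₜ ρ +ᴬ -ᴬ ⟦ t ⟧ₜ ρ))
                ⊎ (ι (⟦ t ⟧ₜ ρ) + ι (-ᴬ ⟦ t ⟧ₜ ρ) ≡ ι (⟦ t ⟧ₜ ρ +ᴬ -ᴬ ⟦ t ⟧ₜ ρ) + u × ι (⟦ t ⟧ₜ ρ +ᴬ -ᴬ ⟦ t ⟧ₜ ρ) < ι (⟦ t ⟧ₜ ρ)) →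
              ι (-ᴬ ⟦ t ⟧ₜ ρ) + (ℤ.- m ℤ.- ℤ.1ℤ) · u ≡ - value e ρ
    nonzero t m eq nz (inj₁ s) = ⊥-elim (ι-nonneg (-ᴬ a) (subst Pos (neg-unique (ι (-ᴬ a)) (ι a) (trans (comm _ _) (trans s cancelled))) (ι-≢0⇒Pos nz)))
      where
      a = ⟦ t ⟧ₜ ρ
      cancelled : ι (a +ᴬ -ᴬ a) ≡ 𝟘
      cancelled = trans (cong ι (ScalarMult.invʳ groupᴬ a)) ι-0
    nonzero t m eq nz (inj₂ (s , _)) = trans
      (trans (solve (m ∷ []) (ι a ∷ ι (-ᴬ a) ∷ u ∷ []) (v₁ ⊞ ((:- k₀) :+ con -[1+ 0 ]) ⊡ v₂) ((v₀ ⊞ v₁) ⊞ (⊟ v₂ ⊞ ⊟ (v₀ ⊞ k₀ ⊡ v₂))) (refl , refl , refl , tt))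
        (cong (_+ (- u + - (ι a + m · u))) (trans s (trans (cong (_+ u) cancelled) (idˡ u)))))
      (trans (solve (m ∷ []) (ι a ∷ u ∷ []) (v₁ ⊞ (⊟ v₁ ⊞ ⊟ (v₀ ⊞ k₀ ⊡ v₁))) (⊟ (v₀ ⊞ k₀ ⊡ v₁)) (refl , refl , tt)) (cong -_ eq))
      where
      a = ⟦ t ⟧ₜ ρ
      cancelled : ι (a +ᴬ -ᴬ a) ≡ 𝟘
      cancelled = trans (cong ι (ScalarMult.invʳ groupᴬ a)) ι-0

  ⊤ᶠ-correct : ∀ {n ρ} {P : Set ℓ} → P → Sat (⊤ᶠ {n}) ρ ⇔ P
  ⊤ᶠ-correct p = mk⇔ (λ _ → p) (λ _ → refl)

  ⊥ᶠ-correct : ∀ {n ρ} {P : Set ℓ} → ¬ P → Sat (⊥ᶠ {n}) ρ ⇔ P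
  ⊥ᶠ-correct np = mk⇔ (λ f → ⊥-elim (f refl)) (λ p → ⊥-elim (np p))

  -- Since 0 ≤ ι t < u, the sign of ι t + m u is that of m unless m = 0.
  posBody : ∀ {n} → Term n → ℤ → Formula n
  posBody t (pos zero)    = ¬ᶠ (t ≐ 𝟎)
  posBody t (pos (suc _)) = ⊤ᶠ
  posBody t -[1+ _ ]      = ⊥ᶠ

  posᶠ : ∀ {n} → Linear n → Formula n
  posᶠ e = normalise e posBody

  u-multiple : ∀ n → 1 ≤ n → Pos (pos n · u)
  u-multiple n n≥1 = pos-scale n n≥1 pos-u

  ι+multiple : ∀ a n → Pos (ι a + pos (suc n) · u)
  ι+multiple a n with pos-tri (ι a)
  ... | inj₁ p        = pos-+ p (u-multiple (suc n) (s≤s z≤n))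
  ... | inj₂ (inj₁ e) = subst Pos (sym (trans (cong (_+ _) e) (idˡ _))) (u-multiple (suc n) (s≤s z≤n))
  ... | inj₂ (inj₂ p) = ⊥-elim (ι-nonneg a p)

  ι-multiple : ∀ a n → ¬ Pos (ι a + -[1+ n ] · u)
  ι-multiple a zero p = <-asym (ι-<u a) (subst (λ z → Pos (ι a + - z)) (1· u) p)
  ι-multiple a (suc n) p = ι-multiple a zero (subst Pos
    (solve (pos n ∷ []) (ι a ∷ u ∷ []) ((v₀ ⊞ ⊟ (v₁ ⊞ (v₁ ⊞ k₀ ⊡ v₁))) ⊞ (v₁ ⊞ k₀ ⊡ v₁)) (v₀ ⊞ con -[1+ 0 ] ⊡ v₁) (refl , refl , tt))
    (pos-+ p (u-multiple (suc n) (s≤s z≤n))))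

  posᶠ-correct : ∀ {n} (e : Linear n) ρ → Sat (posᶠ e) ρ ⇔ Pos (value e ρ)
  posᶠ-correct e ρ = normalise-correct e posBody ρ body
    where
    body : ∀ t m → ι (⟦ t ⟧ₜ ρ) + m · u ≡ value e ρ → Sat (posBody t m) ρ ⇔ Pos (value e ρ)
    body t (pos zero) eq = mk⇔ (λ nz → subst Pos (trans (sym (idʳ _)) eq) (ι-≢0⇒Pos nz))
      (λ p z → pos-irr (subst Pos (trans (sym eq) (trans (idʳ _) (trans (cong ι z) ι-0))) p))
    body t (pos (suc n)) eq = ⊤ᶠ-correct {ρ = ρ} (subst Pos eq (ι+multiple _ n))
    body t -[1+ n ]      eq = ⊥ᶠ-correct {ρ = ρ} (λ p → ι-multiple _ n (subst Pos (sym eq) p))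

  u-torsion-free : ∀ i → i · u ≡ 𝟘 → i ≡ ℤ.0ℤ
  u-torsion-free (pos zero)    e = refl
  u-torsion-free (pos (suc n)) e = ⊥-elim (pos-irr (subst Pos e (u-multiple (suc n) (s≤s z≤n))))
  u-torsion-free -[1+ n ]      e = ⊥-elim (pos-irr (subst Pos (trans (sym (neg-neg _)) (trans (cong -_ e) neg-𝟘))
                                                          (u-multiple (suc n) (s≤s z≤n))))

  ι+·u-injective : ∀ {a b i j} → ι a + i · u ≡ ι b + j · u → a ≡ b × i ≡ j
  ι+·u-injective {a} {b} {i} {j} e = a≡b , i≡j
    where
    a≡b : a ≡ b
    a≡b = trans (sym (π-ι a)) (trans (sym (π-+·u (ι a) i)) (trans (cong π e) (trans (π-+·u (ι b) j) (π-ι b))))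
    i≡j : i ≡ j
    i≡j = ℤₚ.i-j≡0⇒i≡j i j (u-torsion-free (i ℤ.- j) (trans
      (solve (i ∷ j ∷ []) (ι a ∷ u ∷ []) ((k₀ :+ (:- k₁)) ⊡ v₁) ((v₀ ⊞ k₀ ⊡ v₁) ⊞ ⊟ (v₀ ⊞ k₁ ⊡ v₁)) (refl , refl , tt))
      (trans (cong (λ c → (ι a + i · u) + - (ι c + j · u)) a≡b) (trans (cong (_+ - (ι b + j · u)) e) (invʳ _)))))

  when : ∀ {n} {P : Set} → Dec P → Formula n → Formula n
  when (yes _) φ = φ
  when (no _)  φ = ⊥ᶠ

  inᶠ : ∀ {n} → Bool → Term n → Formula n
  inᶠ true  t = Vᶠ t
  inᶠ false t = ⊤ᶠ

  divBody : ∀ {n} → ℕ → Term n → ℤ → Term (suc n) → ℤ → Formula (suc n)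
  divBody k t m s r = when (pos k ∣ᶻ? (m ℤ.- r)) (s ≐ renameᵗ suc t)

  -- The quotient ranges over L but the quantifier only over `A`. Writing the quotient as ι a + q u,
  -- with k ι a = ι s + r u, the existence of q becomes s = t together with k | m - r, an integer
  -- condition decided while the formula is built.
  divᶠ : ∀ {n} → Bool → ℕ → Linear n → Formula n
  divᶠ h k e = normalise e λ t m → ∃ᶠ (inᶠ h (var zero) ∧ᶠ normalise (times k (var zero)) (divBody k t m))

  divᶠ-correct : ∀ {n} h k (e : Linear n) ρ → Sat (divᶠ h k e) ρ ⇔ Div h k (value e ρ)
  divᶠ-correct {n} h k e ρ = normalise-correct e _ ρ outer
    where
    Quotient : A → Set ℓ
    Quotient a = Σ ℤ λ q → value e ρ ≡ pos k · (ι a + q · u)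

    inner : ∀ t m → ι (⟦ t ⟧ₜ ρ) + m · u ≡ value e ρ → ∀ a s r → ι (⟦ s ⟧ₜ (a VF.∷ ρ)) + r · u ≡ value (times k (var zero)) (a VF.∷ ρ) →
            Sat (divBody k t m s r) (a VF.∷ ρ) ⇔ Quotient a
    inner t m eq a s r eq′ = body (pos k ∣ᶻ? (m ℤ.- r))
      where
      open ≡-Reasoning
      weak : ⟦ renameᵗ suc t ⟧ₜ (a VF.∷ ρ) ≡ ⟦ t ⟧ₜ ρ
      weak = renameᵗ-correct suc t (λ _ → refl)
      multiple : ι (⟦ s ⟧ₜ (a VF.∷ ρ)) + r · u ≡ pos k · ι a
      multiple = trans eq′ (value-times k (var zero) (a VF.∷ ρ))
      forth : pos k ∣ᶻ (m ℤ.- r) → ⟦ s ⟧ₜ (a VF.∷ ρ) ≡ ⟦ renameᵗ suc t ⟧ₜ (a VF.∷ ρ) → Quotient a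
      forth (dividesᶻ q m-r) s≡t = q , (begin
        value e ρ                                             ≡⟨ eq ⟨
        ι (⟦ t ⟧ₜ ρ) + m · u                                  ≡⟨ cong (λ b → ι b + m · u) (trans s≡t weak) ⟨
        ι (⟦ s ⟧ₜ (a VF.∷ ρ)) + m · u                         ≡⟨ solve (m ∷ r ∷ []) (ι (⟦ s ⟧ₜ (a VF.∷ ρ)) ∷ u ∷ []) (v₀ ⊞ k₀ ⊡ v₁)
                                                                   ((v₀ ⊞ k₁ ⊡ v₁) ⊞ (k₀ :+ (:- k₁)) ⊡ v₁) (refl , refl , tt) ⟩
        ι (⟦ s ⟧ₜ (a VF.∷ ρ)) + r · u + (m ℤ.- r) · u         ≡⟨ cong₂ _+_ multiple (cong (_· u) m-r) ⟩
        pos k · ι a + (q ℤ.* pos k) · u                       ≡⟨ solve (q ∷ pos k ∷ []) (ι a ∷ u ∷ []) (k₁ ⊡ v₀ ⊞ (k₀ :* k₁) ⊡ v₁)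
                                                                   (k₁ ⊡ (v₀ ⊞ k₀ ⊡ v₁)) (refl , refl , tt) ⟩
        pos k · (ι a + q · u)                                 ∎)
      both : Quotient a → ⟦ t ⟧ₜ ρ ≡ ⟦ s ⟧ₜ (a VF.∷ ρ) × (pos k ∣ᶻ (m ℤ.- r))
      both (q , eq″) = proj₁ same , dividesᶻ q (trans (cong (ℤ._- r) (proj₂ same)) (cancel r (pos k) q))
        where
        same : ⟦ t ⟧ₜ ρ ≡ ⟦ s ⟧ₜ (a VF.∷ ρ) × m ≡ r ℤ.+ pos k ℤ.* q
        same = ι+·u-injective (begin
          ι (⟦ t ⟧ₜ ρ) + m · u                                ≡⟨ trans eq eq″ ⟩
          pos k · (ι a + q · u)                               ≡⟨ ·-distrib (pos k) (ι a) (q · u) ⟩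
          pos k · ι a + pos k · q · u                         ≡⟨ cong (_+ pos k · q · u) multiple ⟨
          ι (⟦ s ⟧ₜ (a VF.∷ ρ)) + r · u + pos k · q · u       ≡⟨ solve (r ∷ q ∷ pos k ∷ []) (ι (⟦ s ⟧ₜ (a VF.∷ ρ)) ∷ u ∷ [])
                                                                   (v₀ ⊞ k₀ ⊡ v₁ ⊞ k₂ ⊡ k₁ ⊡ v₁) (v₀ ⊞ (k₀ :+ k₂ :* k₁) ⊡ v₁) (refl , refl , tt) ⟩
          ι (⟦ s ⟧ₜ (a VF.∷ ρ)) + (r ℤ.+ pos k ℤ.* q) · u     ∎)
        cancel : ∀ r k q → r ℤ.+ k ℤ.* q ℤ.- r ≡ q ℤ.* k
        cancel = +-*-Solver.solve 3 (λ r k q → r +-*-Solver.:+ k +-*-Solver.:* q +-*-Solver.:- r +-*-Solver.:= q +-*-Solver.:* k) refl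
      body : (d : Dec (pos k ∣ᶻ (m ℤ.- r))) → Sat (when d (s ≐ renameᵗ suc t)) (a VF.∷ ρ) ⇔ Quotient a
      body (yes d) = mk⇔ (forth d) (λ q → sym (trans weak (proj₁ (both q))))
      body (no nd) = ⊥ᶠ-correct {ρ = a VF.∷ ρ} (λ q → nd (proj₂ (both q)))

    inᶠ-correct : ∀ h a → Sat (inᶠ {suc n} h (var zero)) (a VF.∷ ρ) ⇔ H h (ι a)
    inᶠ-correct true  a = ≡⇒⇔ V (sym (π-ι a))
    inᶠ-correct false a = ⊤ᶠ-correct {ρ = a VF.∷ ρ} (lift tt)

    outer : ∀ t m → ι (⟦ t ⟧ₜ ρ) + m · u ≡ value e ρ →
            Sat (∃ᶠ (inᶠ h (var zero) ∧ᶠ normalise (times k (var zero)) (divBody k t m))) ρ ⇔ Div h k (value e ρ)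
    outer t m eq = ⇔-trans
      (Σ-⇔ λ a → ×-⇔ (inᶠ-correct h a) (normalise-correct (times k (var zero)) (divBody k t m) (a VF.∷ ρ) (inner t m eq a)))
      (mk⇔ (λ { (a , Ha , q , eq′) → quot (ι a + q · u) (H-+ h Ha (H-· h q (G⇒H h G-u))) eq′ }) back)
      where
      back : Div h k (value e ρ) → Σ A λ a → H h (ι a) × Quotient a
      back (quot b Hb eq′) = π b
        , subst (H h) (solve (j ∷ []) (ι (π b) ∷ u ∷ []) ((v₀ ⊞ k₀ ⊡ v₁) ⊞ ⊟ (k₀ ⊡ v₁)) v₀ (refl , refl , tt))
            (H-+ h (subst (H h) (proj₂ (winding b)) Hb) (H-neg h (H-· h j (G⇒H h G-u))))
        , j , trans eq′ (cong (pos k ·_) (proj₂ (winding b)))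
        where j = proj₁ (winding b)

-- Formulas do not distinguish equivalent tuples

module BackAndForth {ℓ : Level} (em : ExcludedMiddle ℓ) (M : LpStr ℓ) (D : PairData M) (C : UniversalCover (LpStr.base M)) where
  open LpStr M renaming (Carrier to A)
  open PairData D using (oriented)
  open UniversalCover C hiding (_<_)
  open CoverOrder oriented C using (groupᴬ; π-+·u; ι-injective; ι-sum)
  open PairDensity em M D C using (coverPair)
  open OrderLemmas coverPair
  open Classical em coverPair
  open Semantics M
  open Solver using (solve; _⊞_; ⊟_; _⊡_; con; v₀; v₁)

  Eqv-pointwise : ∀ {n N} {x x′ y y′ : Vector Carrier n} → (∀ i → x i ≡ y i) → (∀ i → x′ i ≡ y′ i) → Eqv N x x′ → Eqv N y y′
  Eqv-pointwise {N = N} e e′ eqv f b = subst₂ (λ z z′ → (Pos z ⇔ Pos z′) × (∀ h k → 1 ≤ k → k ≤ N → Div h k z ⇔ Div h k z′))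
    (cong (_+ proj₂ f · u) (lin-cong (λ _ → refl) e)) (cong (_+ proj₂ f · u) (lin-cong (λ _ → refl) e′)) (eqv f b)

  Eqv-refl : ∀ {n N} (x : Vector Carrier n) → Eqv N x x
  Eqv-refl x f b = ⇔-refl , λ _ _ _ _ → ⇔-refl

  coefficients : ∀ {n} → Term n → Vector ℤ n
  coefficients (var i) = δ i
  coefficients (s ⊕ t) = λ i → coefficients s i ℤ.+ coefficients t i
  coefficients (⊝ t)   = λ i → -[1+ 0 ] ℤ.* coefficients t i
  coefficients 𝟎       = λ _ → ℤ.0ℤ

  size : ∀ {n} → Term n → ℕ
  size (var i) = 1
  size (s ⊕ t) = suc (size s ℕ.+ size t)
  size (⊝ t)   = suc (size t)
  size 𝟎       = 0

  abs-δ : ∀ {n} (i j : Fin n) → abs (δ i j) ≤ 1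
  abs-δ zero    zero    = s≤s z≤n
  abs-δ zero    (suc j) = z≤n
  abs-δ (suc i) zero    = z≤n
  abs-δ (suc i) (suc j) = abs-δ i j

  bounded-minus : ∀ {n N} (f : Form n) → Bounded N f → Bounded N (-[1+ 0 ] *ᶠ f)
  bounded-minus {n} {N} f b = subst (λ M → Bounded M (-[1+ 0 ] *ᶠ f)) (ℕₚ.*-identityˡ N) (bounded-* -[1+ 0 ] f ℕₚ.≤-refl b)

  val-minus : ∀ {n} (f : Form n) x → val (-[1+ 0 ] *ᶠ f) x ≡ - val f x
  val-minus f x = trans (val-* -[1+ 0 ] f x) (cong -_ (1· (val f x)))

  bounded-coefficients : ∀ {n} (t : Term n) i → abs (coefficients t i) ≤ size t
  bounded-coefficients (var i) j = abs-δ i j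
  bounded-coefficients (s ⊕ t) i = ℕₚ.≤-trans (abs-+-≤ (coefficients s i) (coefficients t i) (bounded-coefficients s i) (bounded-coefficients t i))
                                              (ℕₚ.n≤1+n _)
  bounded-coefficients (⊝ t)   i = ℕₚ.≤-trans (abs-*-≤ -[1+ 0 ] (coefficients t i) ℕₚ.≤-refl (bounded-coefficients t i))
                                              (ℕₚ.≤-trans (ℕₚ.≤-reflexive (ℕₚ.*-identityˡ (size t))) (ℕₚ.n≤1+n _))
  bounded-coefficients 𝟎       i = z≤n

  Winds : ∀ {n} → Term n → Vector A n → ℤ → Set ℓ
  Winds t ρ m = ι (⟦ t ⟧ₜ ρ) ≡ val (coefficients t , m) (ι ∘ ρ)

  -- The number of wraps depends on ρ, but is bounded by the size of the term.
  winds : ∀ {n} (t : Term n) ρ → Σ ℤ λ m → abs m ≤ size t × Winds t ρ m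
  winds (var i) ρ = ℤ.0ℤ , z≤n , sym (trans (idʳ _) (lin-δ i (ι ∘ ρ)))
  winds 𝟎       ρ = ℤ.0ℤ , z≤n , sym (trans (idʳ _) (trans (lin-0 (ι ∘ ρ)) (sym ι-0)))
  winds (s ⊕ t) ρ = result (winds s ρ) (winds t ρ) (ι-sum _ _)
    where
    a b : A
    a = ⟦ s ⟧ₜ ρ
    b = ⟦ t ⟧ₜ ρ
    result : (Σ ℤ λ m → abs m ≤ size s × Winds s ρ m) → (Σ ℤ λ m → abs m ≤ size t × Winds t ρ m) →
             (ι a + ι b ≡ ι (a +ᴬ b)) ⊎ (ι a + ι b ≡ ι (a +ᴬ b) + u × ι (a +ᴬ b) < ι a) →
             Σ ℤ λ m → abs m ≤ size (s ⊕ t) × Winds (s ⊕ t) ρ m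
    result (m , p , e) (m′ , p′ , e′) (inj₁ q) = m ℤ.+ m′ , ℕₚ.≤-trans (abs-+-≤ m m′ p p′) (ℕₚ.n≤1+n _) ,
      trans (sym q) (trans (cong₂ _+_ e e′) (sym (val-+ (coefficients s , m) (coefficients t , m′) (ι ∘ ρ))))
    result (m , p , e) (m′ , p′ , e′) (inj₂ (q , _)) = (m ℤ.+ m′) ℤ.+ -[1+ 0 ] ,
      ℕₚ.≤-trans (abs-+-≤ (m ℤ.+ m′) -[1+ 0 ] (abs-+-≤ m m′ p p′) ℕₚ.≤-refl) (ℕₚ.≤-reflexive (ℕₚ.+-comm _ 1)) , (begin
        ι (a +ᴬ b)                                   ≡⟨ solve [] (ι (a +ᴬ b) ∷ u ∷ []) v₀ ((v₀ ⊞ v₁) ⊞ con -[1+ 0 ] ⊡ v₁) (refl , refl , tt) ⟩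
        ι (a +ᴬ b) + u + -[1+ 0 ] · u                ≡⟨ cong (_+ -[1+ 0 ] · u) (trans (sym q) (trans (cong₂ _+_ e e′)
                                                          (sym (val-+ (coefficients s , m) (coefficients t , m′) (ι ∘ ρ))))) ⟩
        lin (coefficients (s ⊕ t)) (ι ∘ ρ) + (m ℤ.+ m′) · u + -[1+ 0 ] · u
                                                     ≡⟨ trans (assoc _ _ _) (cong (lin (coefficients (s ⊕ t)) (ι ∘ ρ) +_) (sym (·-+ (m ℤ.+ m′) -[1+ 0 ] u))) ⟩
        lin (coefficients (s ⊕ t)) (ι ∘ ρ) + ((m ℤ.+ m′) ℤ.+ -[1+ 0 ]) · u ∎)
      where open ≡-Reasoning
  winds (⊝ t) ρ = result (winds t ρ) (ι-sum a (-ᴬ a))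
    where
    a : A
    a = ⟦ t ⟧ₜ ρ
    cancelled : ι (a +ᴬ -ᴬ a) ≡ 𝟘
    cancelled = trans (cong ι (ScalarMult.invʳ groupᴬ a)) ι-0
    result : (Σ ℤ λ m → abs m ≤ size t × Winds t ρ m) →
             (ι a + ι (-ᴬ a) ≡ ι (a +ᴬ -ᴬ a)) ⊎ (ι a + ι (-ᴬ a) ≡ ι (a +ᴬ -ᴬ a) + u × ι (a +ᴬ -ᴬ a) < ι a) →
             Σ ℤ λ m → abs m ≤ size (⊝ t) × Winds (⊝ t) ρ m
    result (m , p , e) (inj₁ q) = -[1+ 0 ] ℤ.* m ,
      ℕₚ.≤-trans (abs-*-≤ -[1+ 0 ] m ℕₚ.≤-refl p) (ℕₚ.≤-trans (ℕₚ.≤-reflexive (ℕₚ.*-identityˡ (size t))) (ℕₚ.n≤1+n _)) ,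
      trans (neg-unique (ι a) (ι (-ᴬ a)) (trans q cancelled)) (trans (cong -_ e) (sym (val-minus (coefficients t , m) (ι ∘ ρ))))
    result (m , p , e) (inj₂ (q , _)) = -[1+ 0 ] ℤ.* m ℤ.+ ℤ.1ℤ ,
      ℕₚ.≤-trans (abs-+-≤ (-[1+ 0 ] ℤ.* m) ℤ.1ℤ (abs-*-≤ -[1+ 0 ] m ℕₚ.≤-refl p) ℕₚ.≤-refl)
        (ℕₚ.≤-reflexive (trans (ℕₚ.+-comm (1 ℕ.* size t) 1) (cong suc (ℕₚ.*-identityˡ (size t))))) , (begin
        ι (-ᴬ a)                                     ≡⟨ solve [] (ι a ∷ ι (-ᴬ a) ∷ []) v₁ (⊟ v₀ ⊞ (v₀ ⊞ v₁)) (refl , refl , tt) ⟩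
        - ι a + (ι a + ι (-ᴬ a))                     ≡⟨ cong₂ _+_ (trans (cong -_ e) (sym (val-minus (coefficients t , m) (ι ∘ ρ))))
                                                          (trans q (trans (cong (_+ u) cancelled) (trans (idˡ u) (sym (1· u))))) ⟩
        lin (coefficients (⊝ t)) (ι ∘ ρ) + (-[1+ 0 ] ℤ.* m) · u + ℤ.1ℤ · u
                                                     ≡⟨ trans (assoc _ _ _) (cong (lin (coefficients (⊝ t)) (ι ∘ ρ) +_) (sym (·-+ (-[1+ 0 ] ℤ.* m) ℤ.1ℤ u))) ⟩
        lin (coefficients (⊝ t)) (ι ∘ ρ) + (-[1+ 0 ] ℤ.* m ℤ.+ ℤ.1ℤ) · u ∎)
      where open ≡-Reasoning

  record CommonForm {n : ℕ} (t : Term n) (ρ ρ′ : Vector A n) : Set ℓ where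
    field
      form    : Form n
      bounded : Bounded (size t) form
      left    : ι (⟦ t ⟧ₜ ρ) ≡ val form (ι ∘ ρ)
      right   : ι (⟦ t ⟧ₜ ρ′) ≡ val form (ι ∘ ρ′)

  -- The form that computes t at ρ takes a value in [0 , u) there. The signs of -f and u - f carry
  -- this to ρ′, where f has the right projection and hence is the representative of t. So the
  -- winding number found at ρ is also valid at ρ′.
  commonForm : ∀ {n N} (t : Term n) {ρ ρ′ : Vector A n} → suc (size t) ≤ N → Eqv N (ι ∘ ρ) (ι ∘ ρ′) → CommonForm t ρ ρ′
  commonForm {n} {N} t {ρ} {ρ′} size<N eqv = build (winds t ρ) (winds t ρ′)
    where
    build : (Σ ℤ λ m → abs m ≤ size t × Winds t ρ m) → (Σ ℤ λ m → abs m ≤ size t × Winds t ρ′ m) → CommonForm t ρ ρ′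
    build (m , m≤ , e) (m′ , _ , e′) = record { form = f ; bounded = b ; left = e ; right = trans (cong ι same) (sym z≡) }
      where
      f : Form n
      f = coefficients t , m
      b : Bounded (size t) f
      b = bounded-coefficients t , m≤
      z : Carrier
      z = val f (ι ∘ ρ′)
      nonneg : ¬ Pos (- z)
      nonneg p = ι-nonneg (⟦ t ⟧ₜ ρ) (subst Pos (trans (val-minus f (ι ∘ ρ)) (cong -_ (sym e)))
        (from (proj₁ (eqv (-[1+ 0 ] *ᶠ f) (bounded-mono (-[1+ 0 ] *ᶠ f) (ℕₚ.<⇒≤ size<N) (bounded-minus f b))))
              (subst Pos (sym (val-minus f (ι ∘ ρ′))) p)))
      g : Form n
      g = const ℤ.1ℤ +ᶠ -[1+ 0 ] *ᶠ f
      val-g : ∀ x → val g x ≡ u + - val f x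
      val-g x = trans (val-+ (const ℤ.1ℤ) (-[1+ 0 ] *ᶠ f) x) (cong₂ _+_ (trans (val-const ℤ.1ℤ x) (1· u)) (val-minus f x))
      z<u : z < u
      z<u = subst Pos (val-g (ι ∘ ρ′)) (to (proj₁ (eqv g (bounded-mono g size<N
              (bounded-+ (const ℤ.1ℤ) (-[1+ 0 ] *ᶠ f) (bounded-const {n} ℤ.1ℤ ℕₚ.≤-refl) (bounded-minus f b)))))
              (subst Pos (sym (val-g (ι ∘ ρ))) (subst (_< u) e (ι-<u (⟦ t ⟧ₜ ρ)))))
      z≡ : z ≡ ι (π z)
      z≡ = ι-surjective z nonneg z<u
      same : ⟦ t ⟧ₜ ρ′ ≡ π z
      same = trans (sym (π-ι _)) (trans (cong π e′) (trans (π-+·u (lin (coefficients t) (ι ∘ ρ′)) m′) (sym (π-+·u (lin (coefficients t) (ι ∘ ρ′)) m))))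

  SameOrder : ∀ {n} → Term n → Term n → Vector A n → Vector A n → Set ℓ
  SameOrder s t ρ ρ′ = (ι (⟦ s ⟧ₜ ρ) < ι (⟦ t ⟧ₜ ρ)) ⇔ (ι (⟦ s ⟧ₜ ρ′) < ι (⟦ t ⟧ₜ ρ′))

  -- The additional 1 pays for the constant u in the comparison of a form with u.
  weight : ∀ {n} → Term n → ℕ
  weight t = suc (size t)

  sameOrder : ∀ {n N} (s t : Term n) {ρ ρ′ : Vector A n} → weight s ℕ.+ weight t ≤ N → Eqv N (ι ∘ ρ) (ι ∘ ρ′) → SameOrder s t ρ ρ′
  sameOrder {n} {N} s t {ρ} {ρ′} w eqv = build
      (commonForm s (ℕₚ.≤-trans (ℕₚ.m≤m+n _ _) w) eqv) (commonForm t (ℕₚ.≤-trans (ℕₚ.m≤n+m _ (weight s)) w) eqv)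
    where
    build : CommonForm s ρ ρ′ → CommonForm t ρ ρ′ → SameOrder s t ρ ρ′
    build S T = ⇔-trans (side ρ (CommonForm.left S) (CommonForm.left T))
      (⇔-trans (proj₁ (eqv h (bounded-mono h (ℕₚ.≤-trans (ℕₚ.≤-trans (ℕₚ.≤-reflexive (ℕₚ.+-comm (size t) (size s))) (ℕₚ.+-mono-≤ (ℕₚ.n≤1+n _) (ℕₚ.n≤1+n _))) w)
                 (bounded-+ (CommonForm.form T) (-[1+ 0 ] *ᶠ CommonForm.form S) (CommonForm.bounded T)
                            (bounded-minus (CommonForm.form S) (CommonForm.bounded S))))))
               (⇔-sym (side ρ′ (CommonForm.right S) (CommonForm.right T))))
      where
      h : Form n
      h = CommonForm.form T +ᶠ -[1+ 0 ] *ᶠ CommonForm.form S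
      side : ∀ ρ → ι (⟦ s ⟧ₜ ρ) ≡ val (CommonForm.form S) (ι ∘ ρ) → ι (⟦ t ⟧ₜ ρ) ≡ val (CommonForm.form T) (ι ∘ ρ) →
             (ι (⟦ s ⟧ₜ ρ) < ι (⟦ t ⟧ₜ ρ)) ⇔ Pos (val h (ι ∘ ρ))
      side ρ e e′ = ≡⇒⇔ Pos (trans (cong₂ _+_ e′ (trans (cong -_ e) (sym (val-minus (CommonForm.form S) (ι ∘ ρ)))))
                                   (sym (val-+ (CommonForm.form T) (-[1+ 0 ] *ᶠ CommonForm.form S) (ι ∘ ρ))))

  -- A quantifier costs one back-and-forth step. The successor in that clause makes the target bound
  -- at least 1, so that the signs of -z and u - z are available for the new element z.
  rank : ∀ {n} → Formula n → ℕ
  rank (s ≐ t)    = weight s ℕ.+ weight t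
  rank (𝒪ᶠ s t r) = (weight s ℕ.+ weight t) ℕ.+ (weight t ℕ.+ weight r) ℕ.+ (weight r ℕ.+ weight s)
  rank (Vᶠ t)     = weight t
  rank (¬ᶠ φ)     = rank φ
  rank (φ ∧ᶠ ψ)   = rank φ ℕ.+ rank ψ
  rank (∃ᶠ φ)     = Step.N′ em coverPair (suc (rank φ)) (s≤s z≤n)

  ⊎-⇔ : ∀ {a b c d} {A : Set a} {B : Set b} {C : Set c} {D : Set d} → A ⇔ B → C ⇔ D → (A ⊎ C) ⇔ (B ⊎ D)
  ⊎-⇔ f g = mk⇔ (λ { (inj₁ a) → inj₁ (to f a) ; (inj₂ c) → inj₂ (to g c) })
                (λ { (inj₁ b) → inj₁ (from f b) ; (inj₂ d) → inj₂ (from g d) })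

  transfer : ∀ {n} (φ : Formula n) {ρ ρ′ : Vector A n} → Eqv (rank φ) (ι ∘ ρ) (ι ∘ ρ′) → Sat φ ρ ⇔ Sat φ ρ′
  transfer (s ≐ t) {ρ} {ρ′} eqv = mk⇔ (equal (from st) (from ts)) (equal (to st) (to ts))
    where
    st = sameOrder s t ℕₚ.≤-refl eqv
    ts = sameOrder t s (ℕₚ.≤-reflexive (ℕₚ.+-comm (weight t) (weight s))) eqv
    equal : ∀ {ρ ρ′} → (ι (⟦ s ⟧ₜ ρ′) < ι (⟦ t ⟧ₜ ρ′) → ι (⟦ s ⟧ₜ ρ) < ι (⟦ t ⟧ₜ ρ)) →
            (ι (⟦ t ⟧ₜ ρ′) < ι (⟦ s ⟧ₜ ρ′) → ι (⟦ t ⟧ₜ ρ) < ι (⟦ s ⟧ₜ ρ)) → ⟦ s ⟧ₜ ρ ≡ ⟦ t ⟧ₜ ρ → ⟦ s ⟧ₜ ρ′ ≡ ⟦ t ⟧ₜ ρ′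
    equal {ρ} {ρ′} f g e with <-tri (ι (⟦ s ⟧ₜ ρ′)) (ι (⟦ t ⟧ₜ ρ′))
    ... | inj₁ p         = ⊥-elim (<-irrefl (subst (λ a → ι a < ι (⟦ t ⟧ₜ ρ)) e (f p)))
    ... | inj₂ (inj₁ e′) = ι-injective e′
    ... | inj₂ (inj₂ p)  = ⊥-elim (<-irrefl (subst (λ a → ι (⟦ t ⟧ₜ ρ) < ι a) e (g p)))
  transfer (𝒪ᶠ s t r) eqv = ⇔-trans (𝒪⇔< _ _ _) (⇔-trans (⊎-⇔ (×-⇔ st tr) (⊎-⇔ (×-⇔ tr rs) (×-⇔ rs st))) (⇔-sym (𝒪⇔< _ _ _)))
    where
    st = sameOrder s t (ℕₚ.≤-trans (ℕₚ.m≤m+n _ _) (ℕₚ.m≤m+n _ _)) eqv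
    tr = sameOrder t r (ℕₚ.≤-trans (ℕₚ.m≤n+m _ (weight s ℕ.+ weight t)) (ℕₚ.m≤m+n _ _)) eqv
    rs = sameOrder r s (ℕₚ.m≤n+m _ ((weight s ℕ.+ weight t) ℕ.+ (weight t ℕ.+ weight r))) eqv
  transfer (Vᶠ t) {ρ} {ρ′} eqv = build (commonForm t ℕₚ.≤-refl eqv)
    where
    one : ∀ a → V a ⇔ Div true 1 (ι a)
    one a = mk⇔ (λ v → quot (ι a) (subst V (sym (π-ι a)) v) (sym (1· (ι a))))
                (λ d → subst V (π-ι a) (Div⇒H d))
    build : CommonForm t ρ ρ′ → V (⟦ t ⟧ₜ ρ) ⇔ V (⟦ t ⟧ₜ ρ′)
    build F = ⇔-trans (one _) (⇔-trans (≡⇒⇔ (Div true 1) left) (⇔-trans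
        (proj₂ (eqv form (bounded-mono form (ℕₚ.n≤1+n _) bounded)) true 1 ℕₚ.≤-refl (s≤s z≤n))
        (⇔-sym (⇔-trans (one _) (≡⇒⇔ (Div true 1) right)))))
      where open CommonForm F
  transfer (¬ᶠ φ)   eqv = ¬-⇔ (transfer φ eqv)
  transfer (φ ∧ᶠ ψ) eqv = ×-⇔ (transfer φ (Eqv-mono (ℕₚ.m≤m+n (rank φ) (rank ψ)) eqv))
                              (transfer ψ (Eqv-mono (ℕₚ.m≤n+m (rank ψ) (rank φ)) eqv))
  transfer (∃ᶠ φ) {ρ} {ρ′} eqv = mk⇔ (move eqv) (move (Eqv-sym eqv))
    where
    N : ℕ
    N = suc (rank φ)
    move : ∀ {ρ ρ′} → Eqv (Step.N′ em coverPair N (s≤s z≤n)) (ι ∘ ρ) (ι ∘ ρ′) → Sat (∃ᶠ φ) ρ → Sat (∃ᶠ φ) ρ′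
    move {ρ} {ρ′} eqv (a , sat) = conclude (Step.step em coverPair N (s≤s z≤n) eqv (ι a) (ι-nonneg a) (ι-<u a))
      where
      conclude : (Σ Carrier λ z → Eqv N (ι a VF.∷ (ι ∘ ρ)) (z VF.∷ (ι ∘ ρ′))) → Sat (∃ᶠ φ) ρ′
      conclude (z , eqv′) = π z , to (transfer φ (Eqv-pointwise consˡ consʳ (Eqv-mono {x = ι a VF.∷ (ι ∘ ρ)} {x′ = z VF.∷ (ι ∘ ρ′)} (ℕₚ.n≤1+n (rank φ)) eqv′))) sat
        where
        -- The step delivers z in L. Its equivalence with ι a gives -z and u - z the same signs as
        -- for ι a, so z lies in [0 , u) and comes from an element of `A`.
        in-unit : z ≡ ι (π z)
        in-unit = ι-surjective z
          (λ p → ι-nonneg a (subst Pos (trans (coordinate -[1+ 0 ] ℤ.0ℤ (ι a) (ι ∘ ρ)) (trans (idʳ _) (cong -_ (1· (ι a)))))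
            (from (proj₁ (eqv′ (coord -[1+ 0 ] ℤ.0ℤ) (coord-bounded -[1+ 0 ] ℤ.0ℤ (s≤s z≤n) z≤n)))
              (subst Pos (sym (trans (coordinate -[1+ 0 ] ℤ.0ℤ z (ι ∘ ρ′)) (trans (idʳ _) (cong -_ (1· z))))) p))))
          (subst Pos (trans (coordinate -[1+ 0 ] ℤ.1ℤ z (ι ∘ ρ′)) (swap z))
            (to (proj₁ (eqv′ (coord -[1+ 0 ] ℤ.1ℤ) (coord-bounded -[1+ 0 ] ℤ.1ℤ (s≤s z≤n) (s≤s z≤n))))
              (subst Pos (sym (trans (coordinate -[1+ 0 ] ℤ.1ℤ (ι a) (ι ∘ ρ)) (swap (ι a)))) (ι-<u a))))
          where
          coord : ∀ {n} → ℤ → ℤ → Form (suc n)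
          coord c m = (c VF.∷ (λ _ → ℤ.0ℤ)) , m
          coord-bounded : ∀ {n} c m → abs c ≤ N → abs m ≤ N → Bounded N (coord {n} c m)
          coord-bounded c m p q = (λ { zero → p ; (suc _) → z≤n }) , q
          coordinate : ∀ {n} c m b (x : Vector Carrier n) → val (coord c m) (b VF.∷ x) ≡ c · b + m · u
          coordinate c m b x = cong (_+ m · u) (trans (cong (c · b +_) (lin-0 x)) (idʳ _))
          swap : ∀ b → -[1+ 0 ] · b + ℤ.1ℤ · u ≡ u + - b
          swap b = solve [] (b ∷ u ∷ []) (con -[1+ 0 ] ⊡ v₀ ⊞ con ℤ.1ℤ ⊡ v₁) (v₁ ⊞ ⊟ v₀) (refl , refl , tt)
        consˡ : ∀ i → (ι a VF.∷ (ι ∘ ρ)) i ≡ ι ((a VF.∷ ρ) i)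
        consˡ zero    = refl
        consˡ (suc i) = refl
        consʳ : ∀ i → (z VF.∷ (ι ∘ ρ′)) i ≡ ι ((π z VF.∷ ρ′) i)
        consʳ zero    = in-unit
        consʳ (suc i) = refl

-- Types over finite sets

module Descriptions {ℓ : Level} (em : ExcludedMiddle ℓ) (M : LpStr ℓ) (D : PairData M) (C : UniversalCover (LpStr.base M))
                   (N : ℕ) (N≥1 : 1 ≤ N) (m : ℕ) where
  open LpStr M renaming (Carrier to A)
  open PairData D using (oriented)
  open UniversalCover C hiding (_<_)
  open CoverOrder oriented C using (ι-≢0⇒Pos)
  open PairDensity em M D C using (coverPair)
  open OrderLemmas coverPair
  open OrderedPair coverPair using (G)
  open Classical em coverPair
  open Extension em coverPair N N≥1
  open Step em coverPair N N≥1 using (N₂)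
  open BackAndForth em M D C
  open Definability em M D C
  open Semantics M
  open Solver using (solve; _⊞_; ⊟_; _⊡_; :-_; v₀; v₁; v₂; k₀)

  -- How the type of x is described over parameters p and q: as a root of K x + f(p), or as lying immediately
  -- to the right of the root of K x + f(p), and then in a coset given by q, or in none but congruent to - r u mod K.
  data Kind : Set where
    root    : Form m → Kind
    near    : Form m → Form m → Kind
    generic : Form m → ℤ → Kind

  kinds : List Kind
  kinds = List.map root (forms m N₁)
    List.++ (List.cartesianProductWith near (forms m N₁) (forms m N₂)
    List.++ List.cartesianProductWith generic (forms m N₁) (ints K))

  root∈ : ∀ {f} → f ∈ forms m N₁ → root f ∈ kinds
  root∈ p = ∈-++⁺ˡ (∈-map⁺ root p)

  near∈ : ∀ {f g} → f ∈ forms m N₁ → g ∈ forms m N₂ → near f g ∈ kinds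
  near∈ p q = ∈-++⁺ʳ (List.map root (forms m N₁)) (∈-++⁺ˡ (∈-cartesianProductWith⁺ near p q))

  generic∈ : ∀ {f r} → f ∈ forms m N₁ → r ∈ ints K → generic f r ∈ kinds
  generic∈ p q = ∈-++⁺ʳ (List.map root (forms m N₁))
    (∈-++⁺ʳ (List.cartesianProductWith near (forms m N₁) (forms m N₂)) (∈-cartesianProductWith⁺ generic p q))

  at : Form m → A → Vector A m → Carrier
  at f a y = pos K · ι a + val f (ι ∘ y)

  -- The point -f(p)/K lies to the left of a, no -g(y)/K lies strictly between it and a, and none
  -- equals a.
  Cut : Form m → A → Vector A m → Vector A m → Set ℓ
  Cut f a y p = Pos (at f a p) × (∀ g → g ∈ forms m N₁ →
    ¬ (Pos (at g a y) × Pos (val f (ι ∘ p) + - val g (ι ∘ y))) × ¬ at g a y ≡ 𝟘)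

  -- Besides p and q only one tuple y enters, so the condition is expressible by a formula in these
  -- tuples; a description over B asks for it at every y in B.
  Holds : Kind → A → Vector A m → Vector A m → Vector A m → Set ℓ
  Holds (root f)      a y p q = at f a p ≡ 𝟘
  Holds (near f g)    a y p q = Cut f a y p × Div true (K ℕ.* K) (at g a q)
  Holds (generic f r) a y p q = Cut f a y p × ((∀ g → g ∈ forms m N₁ → ¬ Div true 1 (at g a y)) × Div false K (ι a + r · u))

  module _ {n : ℕ} (x : Fin n) (y p q : Fin m → Fin n) where

    atᴸ : Form m → (Fin m → Fin n) → Linear n
    atᴸ f σ = add (times K (var x)) (linear f σ)

    zeroᶠ : Linear n → Formula n
    zeroᶠ e = (¬ᶠ posᶠ e) ∧ᶠ (¬ᶠ posᶠ (neg e))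

    zeroᶠ-correct : ∀ e ρ → Sat (zeroᶠ e) ρ ⇔ (value e ρ ≡ 𝟘)
    zeroᶠ-correct e ρ = ⇔-trans (×-⇔ (¬-⇔ (posᶠ-correct e ρ)) (¬-⇔ (posᶠ-correct (neg e) ρ))) (mk⇔ forth back)
      where
      forth : ¬ Pos (value e ρ) × ¬ Pos (- value e ρ) → value e ρ ≡ 𝟘
      forth (np , nn) with pos-tri (value e ρ)
      ... | inj₁ z        = ⊥-elim (np z)
      ... | inj₂ (inj₁ z) = z
      ... | inj₂ (inj₂ z) = ⊥-elim (nn z)
      back : value e ρ ≡ 𝟘 → ¬ Pos (value e ρ) × ¬ Pos (- value e ρ)
      back z = (λ r → pos-irr (subst Pos z r)) , (λ r → pos-irr (subst Pos (trans (cong -_ z) neg-𝟘) r))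

    cutᶠ : Form m → Formula n
    cutᶠ f = posᶠ (atᴸ f p) ∧ᶠ ⋀ (forms m N₁) λ g →
      (¬ᶠ (posᶠ (atᴸ g y) ∧ᶠ posᶠ (add (linear f p) (neg (linear g y))))) ∧ᶠ (¬ᶠ zeroᶠ (atᴸ g y))

    kindᶠ : Kind → Formula n
    kindᶠ (root f)      = zeroᶠ (atᴸ f p)
    kindᶠ (near f g)    = cutᶠ f ∧ᶠ divᶠ true (K ℕ.* K) (atᴸ g q)
    kindᶠ (generic f r) = cutᶠ f ∧ᶠ (⋀ (forms m N₁) (λ g → ¬ᶠ divᶠ true 1 (atᴸ g y)) ∧ᶠ divᶠ false K (add (var x) (unit r)))

    module _ {ρ : Vector A n} {a : A} {ys ps qs : Vector A m} (x≡ : ρ x ≡ a)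
             (y≡ : ∀ i → ρ (y i) ≡ ys i) (p≡ : ∀ i → ρ (p i) ≡ ps i) (q≡ : ∀ i → ρ (q i) ≡ qs i) where

      value-at : ∀ f (σ : Fin m → Fin n) {z} → (∀ i → ρ (σ i) ≡ z i) → value (atᴸ f σ) ρ ≡ at f a z
      value-at f σ e = cong₂ _+_ (trans (value-times K (var x) ρ) (cong (λ b → pos K · ι b) x≡)) (value-linear f σ e)

      pos-at : ∀ f (σ : Fin m → Fin n) {z} → (∀ i → ρ (σ i) ≡ z i) → Sat (posᶠ (atᴸ f σ)) ρ ⇔ Pos (at f a z)
      pos-at f σ e = ⇔-trans (posᶠ-correct (atᴸ f σ) ρ) (≡⇒⇔ Pos (value-at f σ e))

      zero-at : ∀ f (σ : Fin m → Fin n) {z} → (∀ i → ρ (σ i) ≡ z i) → Sat (zeroᶠ (atᴸ f σ)) ρ ⇔ (at f a z ≡ 𝟘)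
      zero-at f σ e = ⇔-trans (zeroᶠ-correct (atᴸ f σ) ρ) (≡⇒⇔ (_≡ 𝟘) (value-at f σ e))

      div-at : ∀ k f (σ : Fin m → Fin n) {z} → (∀ i → ρ (σ i) ≡ z i) → Sat (divᶠ true k (atᴸ f σ)) ρ ⇔ Div true k (at f a z)
      div-at k f σ e = ⇔-trans (divᶠ-correct true k (atᴸ f σ) ρ) (≡⇒⇔ (Div true k) (value-at f σ e))

      forall∈ : ∀ (φ : Form m → Formula n) {P : Form m → Set ℓ} → (∀ g → Sat (φ g) ρ ⇔ P g) →
                Sat (⋀ (forms m N₁) φ) ρ ⇔ (∀ g → g ∈ forms m N₁ → P g)
      forall∈ φ e = ⇔-trans (⋀-correct (forms m N₁) φ ρ)
        (mk⇔ (λ s g g∈ → to (e g) (s g g∈)) (λ s g g∈ → from (e g) (s g g∈)))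

      cutᶠ-correct : ∀ f → Sat (cutᶠ f) ρ ⇔ Cut f a ys ps
      cutᶠ-correct f = ×-⇔ (pos-at f p p≡) (forall∈ (λ g →
          (¬ᶠ (posᶠ (atᴸ g y) ∧ᶠ posᶠ (add (linear f p) (neg (linear g y))))) ∧ᶠ (¬ᶠ zeroᶠ (atᴸ g y)))
        λ g → ×-⇔ (¬-⇔ (×-⇔ (pos-at g y y≡) (⇔-trans (posᶠ-correct (add (linear f p) (neg (linear g y))) ρ)
                 (≡⇒⇔ Pos (cong₂ (λ b c → b + - c) (value-linear f p p≡) (value-linear g y y≡))))))
               (¬-⇔ (zero-at g y y≡)))

      kindᶠ-correct : ∀ κ → Sat (kindᶠ κ) ρ ⇔ Holds κ a ys ps qs
      kindᶠ-correct (root f)      = zero-at f p p≡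
      kindᶠ-correct (near f g)    = ×-⇔ (cutᶠ-correct f) (div-at (K ℕ.* K) g q q≡)
      kindᶠ-correct (generic f r) = ×-⇔ (cutᶠ-correct f) (×-⇔ (forall∈ (λ g → ¬ᶠ divᶠ true 1 (atᴸ g y)) (λ g → ¬-⇔ (div-at 1 g y y≡)))
        (⇔-trans (divᶠ-correct false K (add (var x) (unit r)) ρ) (≡⇒⇔ (Div false K) (cong (λ b → ι b + r · u) x≡))))

  -- If K a + g(y) > 0, the cut at a gives g(y) ≥ f(p), whence K a′ + g(y) ≥ K a′ + f(p) > 0. The
  -- negative signs follow by exchanging a and a′, as zeros are excluded.
  cut-determines : ∀ f {a a′} y p → Cut f a y p → Cut f a′ y p → SameCut (ι a) (ι ∘ y) (ι a′) (ι ∘ y)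
  cut-determines f {a} {a′} y p cut cut′ g bg = listed (∈-forms g bg)
    where
    up : ∀ {b b′} → Cut f b y p → Cut f b′ y p → ∀ g → g ∈ forms m N₁ → Pos (at g b y) → Pos (at g b′ y)
    up {b} {b′} c c′ g g∈ r = subst Pos (solve (pos K ∷ []) (ι b′ ∷ val f (ι ∘ p) ∷ val g (ι ∘ y) ∷ [])
        ((k₀ ⊡ v₀ ⊞ v₁) ⊞ (v₂ ⊞ ⊟ v₁)) (k₀ ⊡ v₀ ⊞ v₂) (refl , refl , refl , tt))
      (pos-+-nonneg (proj₁ c′) λ s → proj₁ (proj₂ c g g∈) (r , subst Pos
        (solve [] (val f (ι ∘ p) ∷ val g (ι ∘ y) ∷ []) (⊟ (v₁ ⊞ ⊟ v₀)) (v₀ ⊞ ⊟ v₁) (refl , refl , tt)) s))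
    down : ∀ {b b′} → Cut f b y p → Cut f b′ y p → ∀ g → g ∈ forms m N₁ → Pos (- at g b y) → Pos (- at g b′ y)
    down {b} {b′} c c′ g g∈ r with pos-tri (at g b′ y)
    ... | inj₁ s        = ⊥-elim (pos-asym (up c′ c g g∈ s) r)
    ... | inj₂ (inj₁ e) = ⊥-elim (proj₂ (proj₂ c′ g g∈) e)
    ... | inj₂ (inj₂ s) = s
    listed : (Σ (Form m) λ g′ → g′ ∈ forms m N₁ × Bounded N₁ g′ × (∀ x → val g x ≡ val g′ x)) →
             (Pos (at g a y) ⇔ Pos (at g a′ y)) × (Pos (- at g a y) ⇔ Pos (- at g a′ y))
    listed (g′ , g′∈ , _ , e) = subst (λ z → (Pos (pos K · ι a + z) ⇔ Pos (pos K · ι a′ + z)) × (Pos (- (pos K · ι a + z)) ⇔ Pos (- (pos K · ι a′ + z))))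
      (sym (e (ι ∘ y))) (mk⇔ (up cut cut′ g′ g′∈) (up cut′ cut g′ g′∈) , mk⇔ (down cut cut′ g′ g′∈) (down cut′ cut g′ g′∈))

  -- Two solutions of one description are compared over the same y, p and q, so the side conditions
  -- of the coset and generic lemmas become identical on both sides. A root pins a down, since L is
  -- torsion-free.
  determines : ∀ κ {a a′} y p q → Holds κ a y p q → Holds κ a′ y p q → Eqv N (ι a VF.∷ (ι ∘ y)) (ι a′ VF.∷ (ι ∘ y))
  determines (root f) {a} {a′} y p q h h′ = subst (λ z → Eqv N (ι a VF.∷ (ι ∘ y)) (z VF.∷ (ι ∘ y))) same (Eqv-refl (ι a VF.∷ (ι ∘ y)))
    where
    same : ι a ≡ ι a′
    same = ·-cancel K K≥1 (trans (solve [] (pos K · ι a ∷ val f (ι ∘ p) ∷ []) v₀ ((v₀ ⊞ v₁) ⊞ ⊟ v₁) (refl , refl , tt))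
      (trans (cong (_+ - val f (ι ∘ p)) (trans h (sym h′)))
             (solve [] (pos K · ι a′ ∷ val f (ι ∘ p) ∷ []) ((v₀ ⊞ v₁) ⊞ ⊟ v₁) v₀ (refl , refl , tt))))
  determines (near f g) {a} {a′} y p q (cut , quot d Gd e) (cut′ , quot d′ Gd′ e′) =
    extend (Eqv-refl (ι ∘ y)) (cut-determines f y p cut cut′)
      (sameDiv-coset Gd Gd′ (trans e (KK d)) (trans e′ (KK d′)) (λ _ _ _ _ _ _ _ _ → ⇔-refl))
    where
    KK : ∀ d → pos (K ℕ.* K) · d ≡ pos K · pos K · d
    KK d = trans (cong (_· d) (ℤₚ.pos-* K K)) (·-* (pos K) (pos K) d)
  determines (generic f r) {a} {a′} y p q (cut , avoid , quot d _ e) (cut′ , avoid′ , quot d′ _ e′) =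
    extend (Eqv-refl (ι ∘ y)) (cut-determines f y p cut cut′)
      (sameDiv-generic (ℤ.- r) (residue e) (residue e′) (avoids avoid) (avoids avoid′) (λ _ _ _ _ _ _ _ → ⇔-refl))
    where
    residue : ∀ {b d} → ι b + r · u ≡ pos K · d → ι b ≡ pos K · d + (ℤ.- r) · u
    residue {b} {d} e = trans (solve (r ∷ []) (ι b ∷ u ∷ []) v₀ ((v₀ ⊞ k₀ ⊡ v₁) ⊞ (:- k₀) ⊡ v₁) (refl , refl , tt)) (cong (_+ (ℤ.- r) · u) e)
    avoids : ∀ {b} → (∀ g → g ∈ forms m N₁ → ¬ Div true 1 (at g b y)) → ∀ g → Bounded N₁ g → ¬ G (at g b y)
    avoids {b} avoid g bg Gg with ∈-forms g bg
    ... | g′ , g′∈ , _ , eq = avoid g′ g′∈ (quot (at g′ b y) (subst (λ z → G (pos K · ι b + z)) (eq (ι ∘ y)) Gg) (sym (1· _)))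

  Description : ∀ {s} → (Fin s → Vector A m) → A → Set ℓ
  Description {s} B a = Σ Kind λ κ → κ ∈ kinds × Σ (Fin s) λ t₁ → Σ (Fin s) λ t₂ → ∀ t → Holds κ a (B t) (B t₁) (B t₂)

  module _ {s : ℕ} (B : Fin s → Vector A m) (t₀ : Fin s) (a : A) where

    Root : Set ℓ
    Root = Σ (Fin s) λ t → Σ (Form m) λ f → f ∈ forms m N₁ × at f a (B t) ≡ 𝟘

    Coset : Set ℓ
    Coset = Σ (Fin s) λ t → Σ (Form m) λ f → f ∈ forms m N₁ × G (at f a (B t))

    Nearest : Set ℓ
    Nearest = Σ (Fin s) λ t₁ → Σ (Form m) λ f → f ∈ forms m N₁ × (∀ t → Cut f a (B t) (B t₁))

    roots : List (Fin s × Form m)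
    roots = List.cartesianProduct (List.allFin s) (forms m N₁)

    position : Fin s × Form m → Carrier
    position (t , f) = - val f (ι ∘ B t)

    Left : Fin s × Form m → Set ℓ
    Left (t , f) = (f ∈ forms m N₁) × Pos (at f a (B t))

    -- The zero form at any tuple has its root at 0, and a > 0 once a itself is not a root.
    -- Nonemptiness of B enters here through t₀.
    left : ¬ Root → Σ (Fin s × Form m) λ tf → tf ∈ roots × Left tf
    left nr = listed (∈-forms (const ℤ.0ℤ) (bounded-const {m} ℤ.0ℤ z≤n))
      where
      listed : (Σ (Form m) λ f → f ∈ forms m N₁ × Bounded N₁ f × (∀ x → val (const ℤ.0ℤ) x ≡ val f x)) →
               Σ (Fin s × Form m) λ tf → tf ∈ roots × Left tf
      listed (f , f∈ , _ , e) = (t₀ , f) , ∈-cartesianProduct⁺ (∈-allFin t₀) f∈ , f∈ , subst Pos (sym at-f) (pos-scale K K≥1 (ι-≢0⇒Pos a≢0))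
        where
        at-f : at f a (B t₀) ≡ pos K · ι a
        at-f = trans (cong (pos K · ι a +_) (trans (sym (e (ι ∘ B t₀))) (val-const ℤ.0ℤ (ι ∘ B t₀)))) (idʳ _)
        a≢0 : a ≢ 0ᴬ
        a≢0 a≡0 = nr (t₀ , f , f∈ , trans at-f (trans (cong (λ b → pos K · ι b) a≡0) (trans (cong (pos K ·_) ι-0) (·-𝟘 (pos K)))))

    -- One maximum is taken over all tuples of B and all forms at once, so the chosen root serves
    -- every y in B.
    nearest : ¬ Root → Nearest
    nearest nr = build (argmax roots position Left (left nr))
      where
      build : (Σ (Fin s × Form m) λ tf → tf ∈ roots × Left tf × (∀ y → y ∈ roots → Left y → ¬ Pos (position y + - position tf))) → Nearest
      build ((t₁ , f) , _ , (f∈ , p) , max) = t₁ , f , f∈ , λ t → p , λ g g∈ →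
        (λ { (q , r) → max (t , g) (∈-cartesianProduct⁺ (∈-allFin t) g∈) (g∈ , q)
               (subst Pos (solve [] (val f (ι ∘ B t₁) ∷ val g (ι ∘ B t) ∷ []) (v₀ ⊞ ⊟ v₁) (⊟ v₁ ⊞ ⊟ (⊟ v₀)) (refl , refl , tt)) r) })
        , λ z → nr (t , g , g∈ , z)

    -- A shift by i u with i ≤ K² moves the given element of `G` into K² G, which is why the coset
    -- form is listed up to `N₂`.
    near-description : Nearest → Coset → Description B a
    near-description (t₁ , f , f∈ , cut) (t₂ , g , g∈ , Gg) = build (divisible% true (K ℕ.* K) (ℕₚ.*-mono-≤ K≥1 K≥1) Gg)
      where
      build : (Σ ℕ λ i → i ≤ K ℕ.* K × Div true (K ℕ.* K) (at g a (B t₂) + pos i · u)) → Description B a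
      build (i , i≤ , d) = listed (∈-forms g′ (bounded-+ g (const (pos i)) (forms-bounded g∈) (bounded-const {m} (pos i) i≤)))
        where
        g′ : Form m
        g′ = g +ᶠ const (pos i)
        listed : (Σ (Form m) λ h → h ∈ forms m N₂ × Bounded N₂ h × (∀ x → val g′ x ≡ val h x)) → Description B a
        listed (h , h∈ , _ , e) = near f h , near∈ f∈ h∈ , t₁ , t₂ , λ t → cut t , subst (Div true (K ℕ.* K))
          (trans (assoc _ _ _) (cong (pos K · ι a +_) (trans (sym (trans (val-+ g (const (pos i)) (ι ∘ B t₂))
             (cong (val g (ι ∘ B t₂) +_) (val-const (pos i) (ι ∘ B t₂))))) (e (ι ∘ B t₂))))) d

    generic-description : Nearest → ¬ Coset → Description B a
    generic-description (t₁ , f , f∈ , cut) nc = build (divisible% false K K≥1 {ι a} (lift tt))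
      where
      build : (Σ ℕ λ i → i ≤ K × Div false K (ι a + pos i · u)) → Description B a
      -- A generic description has one base point; t₁ also fills the second slot as a default.
      build (i , i≤ , d) = generic f (pos i) , generic∈ f∈ (∈-ints (pos i) i≤) , t₁ , t₁ ,
        λ t → cut t , (λ g g∈ e → nc (t , g , g∈ , Div⇒H e)) , d

    describe : Description B a
    describe = cases em
      where
      cases : Dec Root → Description B a
      cases (yes (t , f , f∈ , e)) = root f , root∈ f∈ , t , t , λ _ → e
      cases (no nr) = split em
        where
        split : Dec Coset → Description B a
        split (yes c) = near-description (nearest nr) c
        split (no nc) = generic-description (nearest nr) nc

-- Uniform definitions with two parameters

module Types {ℓ : Level} (em : ExcludedMiddle ℓ) (M : LpStr ℓ) (D : PairData M) (C : UniversalCover (LpStr.base M))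
             {m r : ℕ} (Δ : Fin r → Formula (suc m)) where
  open LpStr M renaming (Carrier to A)
  open UniversalCover C using (ι)
  open PairDensity em M D C using (coverPair)
  open OrderLemmas coverPair using (Eqv-mono)
  open BackAndForth em M D C
  open Semantics M
  open Renaming M

  N : ℕ
  N = suc (sum (List.tabulate (rank ∘ Δ)))

  open Descriptions em M D C N (s≤s z≤n) m

  rank≤N : ∀ j → rank (Δ j) ≤ N
  rank≤N j = ℕₚ.≤-trans (∈⇒≤sum (∈-tabulate⁺ {f = rank ∘ Δ} j)) (ℕₚ.n≤1+n _)

  object : Fin (suc (m ℕ.+ 2 ℕ.* m))
  object = zero

  parameter : Fin m → Fin (suc (m ℕ.+ 2 ℕ.* m))
  parameter i = suc (i Fin.↑ˡ (2 ℕ.* m))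

  base-point : Fin 2 → Fin m → Fin (suc (m ℕ.+ 2 ℕ.* m))
  base-point k i = suc (m Fin.↑ʳ Fin.combine k i)

  instantiate : Fin (suc m) → Fin (suc (m ℕ.+ 2 ℕ.* m))
  instantiate zero    = object
  instantiate (suc i) = parameter i

  describes : Kind → Formula (suc (m ℕ.+ 2 ℕ.* m))
  describes = kindᶠ object parameter (base-point zero) (base-point (suc zero))

  ψ : Fin (List.length kinds) → Fin r → Formula (m ℕ.+ 2 ℕ.* m)
  ψ i j = ∃ᶠ (describes (List.lookup kinds i) ∧ᶠ rename instantiate (Δ j))

  module _ {s : ℕ} (B : Fin s → Vector A m) (t₁ t₂ : Fin s) where

    base-points : Fin 2 → Fin s
    base-points zero       = t₁
    base-points (suc zero) = t₂

    env : A → Fin s → Vector A (suc (m ℕ.+ 2 ℕ.* m))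
    env a t = a VF.∷ (B t VF.++ VF.concat (B ∘ base-points))

    env-parameter : ∀ a t i → env a t (parameter i) ≡ B t i
    env-parameter a t i rewrite Finₚ.splitAt-↑ˡ m i (2 ℕ.* m) = refl

    env-base-point : ∀ a t k i → env a t (base-point k i) ≡ B (base-points k) i
    env-base-point a t k i rewrite Finₚ.splitAt-↑ʳ m (2 ℕ.* m) (Fin.combine k i) =
      cong (λ ki → B (base-points (proj₁ ki)) (proj₂ ki)) (Finₚ.remQuot-combine {2} {m} k i)

    env-instantiate : ∀ a t i → env a t (instantiate i) ≡ (a VF.∷ B t) i
    env-instantiate a t zero    = refl
    env-instantiate a t (suc i) = env-parameter a t i

    describes-correct : ∀ κ a t → Sat (describes κ) (env a t) ⇔ Holds κ a (B t) (B t₁) (B t₂)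
    describes-correct κ a t = kindᶠ-correct object parameter (base-point zero) (base-point (suc zero))
      refl (env-parameter a t) (env-base-point a t zero) (env-base-point a t (suc zero)) κ

    -- Forwards, a is its own witness. Backwards, a witness a′ may vary with t, but sharing the
    -- description at B t it is equivalent to a over B t, so Δ j transfers.
    ψ-defines : ∀ {κ} a → (∀ t → Holds κ a (B t) (B t₁) (B t₂)) → ∀ j t →
                Sat (Δ j) (a VF.∷ B t) ⇔ Sat (∃ᶠ (describes κ ∧ᶠ rename instantiate (Δ j))) (B t VF.++ VF.concat (B ∘ base-points))
    ψ-defines {κ} a holds j t = mk⇔ forth back
      where
      renamed : ∀ a → Sat (rename instantiate (Δ j)) (env a t) ⇔ Sat (Δ j) (a VF.∷ B t)
      renamed a = rename-correct instantiate (Δ j) (env-instantiate a t)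
      forth : Sat (Δ j) (a VF.∷ B t) → Sat (∃ᶠ (describes κ ∧ᶠ rename instantiate (Δ j))) (B t VF.++ VF.concat (B ∘ base-points))
      forth sat = a , from (describes-correct κ a t) (holds t) , from (renamed a) sat
      cons : ∀ a i → (ι a VF.∷ (ι ∘ B t)) i ≡ ι ((a VF.∷ B t) i)
      cons a zero    = refl
      cons a (suc i) = refl
      back : Sat (∃ᶠ (describes κ ∧ᶠ rename instantiate (Δ j))) (B t VF.++ VF.concat (B ∘ base-points)) → Sat (Δ j) (a VF.∷ B t)
      back (a′ , desc , sat) = to (transfer (Δ j) (Eqv-pointwise (cons a′) (cons a)
          (Eqv-mono {x = ι a′ VF.∷ (ι ∘ B t)} {x′ = ι a VF.∷ (ι ∘ B t)} (rank≤N j)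
            (determines κ (B t) (B t₁) (B t₂) (to (describes-correct κ a′ t) desc) (holds t)))))
        (to (renamed a′) sat)

  udtfs : UDTFS 2 Δ
  -- The first of the two distinct tuples shows that B is not empty.
  udtfs = List.length kinds , ψ , λ s B two q type → conclude B q (proj₂ type) (describe B (proj₁ two) (proj₁ type))
    where
    conclude : ∀ {s} (B : Fin s → Vector A m) (q : Fin r → Fin s → Set ℓ) {a} → (∀ j t → q j t ⇔ Sat (Δ j) (a VF.∷ B t)) → Description B a →
               Σ (Fin 2 → Fin s) λ b⃗ → Σ (Fin (List.length kinds)) λ i → ∀ j t → q j t ⇔ Sat (ψ i j) (B t VF.++ VF.concat (B ∘ b⃗))
    conclude B q {a} real (κ , κ∈ , t₁ , t₂ , holds) = base-points B t₁ t₂ , Any.index κ∈ , λ j t →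
      ⇔-trans (real j t) (subst (λ κ → Sat (Δ j) (a VF.∷ B t) ⇔ Sat (∃ᶠ (describes κ ∧ᶠ rename instantiate (Δ j))) (B t VF.++ VF.concat (B ∘ base-points B t₁ t₂)))
        (lookup-index κ∈) (ψ-defines B t₁ t₂ {κ} a holds j t))

-- From models of the theories to the data of a pair

pairData : ∀ {ℓ} {e₁ e₂ : PrimeSeq} (M : LpStr ℓ) → IsModelPair 0⃗ e₁ 0⃗ e₂ M → PairData M
pairData {ℓ} M ((oriented , regular-A , index-A , _) , _ , v0 , v+ , v- , ((orientedᴵ , regular-G , index-G , _) , dense , infinite)) = record
  { oriented = oriented ; V-0 = v0 ; V-+ = v+ ; V-neg = v- ; V-dense = dense ; V-index = infinite
  ; divides-p = divides-p ; regular = regular }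
  where
  open LpStr M renaming (Carrier to A)
  open OStrDefs base using (_<₀_) renaming (_·_ to _×ᴬ_)
  I : OStr ℓ
  I = induced M v0 v+ v-
  open OStrDefs I using () renaming (_·_ to _×ᴵ_)

  -- [p]A = p^0 leaves a single coset c + pA; it contains 0, hence is pA.
  divisible-of-index : ∀ (X : OStr ℓ) → OStrDefs.IsOrientedAbelianGroup X → ∀ p → OStrDefs.IndexIs X p (fin 0) →
                       ∀ x → Σ (OStr.Carrier X) λ y → OStrDefs._·_ X p y ≡ x
  divisible-of-index X orX p (c , _ , cover) x = combine (cover x) (cover (OStr.0ᴬ X))
    where
    open OStr X using () renaming (_+ᴬ_ to _+ˣ_; -ᴬ_ to -ˣ_; 0ᴬ to 0ˣ; Carrier to X′)
    open OStrDefs X using () renaming (_·_ to _×ˣ_)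
    gX : AbGroup ℓ
    gX = record { Carrier = X′ ; _+_ = _+ˣ_ ; -_ = -ˣ_ ; 𝟘 = 0ˣ
      ; assoc = proj₁ (proj₁ orX) ; comm = proj₁ (proj₂ (proj₁ orX))
      ; idˡ = proj₁ (proj₂ (proj₂ (proj₁ orX))) ; invˡ = proj₂ (proj₂ (proj₂ (proj₁ orX))) }
    module S = ScalarMult gX
    same : ∀ n y → n ×ˣ y ≡ n S.·ℕ y
    same zero    y = refl
    same (suc n) y = cong (y +ˣ_) (same n y)
    combine : (Σ (Fin 1) λ i → Σ X′ λ y → p ×ˣ y ≡ x +ˣ (-ˣ c i)) → (Σ (Fin 1) λ i → Σ X′ λ y → p ×ˣ y ≡ 0ˣ +ˣ (-ˣ c i)) → Σ X′ λ y → p ×ˣ y ≡ x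
    combine (zero , y , e) (zero , z , e′) = y +ˣ (-ˣ z) , trans (same p _) (trans (S.·-distrib (pos p) y (-ˣ z))
      (trans (cong₂ _+ˣ_ (trans (sym (same p y)) e) (trans (S.·-neg (pos p) z) (cong -ˣ_ (trans (sym (same p z)) e′))))
        (S.Solver.solve [] (x ∷ c zero ∷ [])
          ((S.Solver.var zero S.Solver.⊞ S.Solver.⊟ S.Solver.var (suc zero)) S.Solver.⊞ S.Solver.⊟ (S.Solver.∅ S.Solver.⊞ S.Solver.⊟ S.Solver.var (suc zero)))
          (S.Solver.var zero) (refl , refl , tt))))

  proj-× : ∀ n x → proj₁ (n ×ᴵ x) ≡ n ×ᴬ proj₁ x
  proj-× zero    x = refl
  proj-× (suc n) x = cong (proj₁ x +ᴬ_) (proj-× n x)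

  divides-p : ∀ h p → Prime p → ∀ a → OrAll V h a → Σ A λ b → OrAll V h b × p ×ᴬ b ≡ a
  divides-p false p pp a _ = proj₁ y , lift tt , proj₂ y
    where y = divisible-of-index base oriented p (index-A p pp) a
  divides-p true p pp a Va = proj₁ (proj₁ y) , proj₂ (proj₁ y) , trans (sym (proj-× p (proj₁ y))) (cong proj₁ (proj₂ y))
    where y = divisible-of-index I orientedᴵ p (index-G p pp) (a , Va)

  regular : ∀ h p → Prime p → ∀ a b → OrAll V h a → OrAll V h b → 𝒪 0ᴬ a b →
            Σ A λ c → OrAll V h c × 𝒪 a (p ×ᴬ c) b × (∀ i → 1 ≤ i → i ℕ.< p → 𝒪 0ᴬ (i ×ᴬ c) (suc i ×ᴬ c))
  regular false p pp a b _ _ o = build (regular-A p pp a b o)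
    where
    build : (Σ A λ c → 𝒪 a (p ×ᴬ c) b × (∀ i → 1 ≤ i → i ℕ.< p → (i ×ᴬ c) <₀ (suc i ×ᴬ c))) → _
    build (c , o′ , incr) = c , lift tt , o′ , λ i q r → proj₂ (incr i q r)
  regular true p pp a b Va Vb o = build (regular-G p pp (a , Va) (b , Vb) o)
    where
    build : _ → _
    build ((c , Vc) , o′ , incr) = c , Vc , subst (λ z → 𝒪 a z b) (proj-× p (c , Vc)) o′ ,
      λ i q r → subst₂ (𝒪 0ᴬ) (proj-× i (c , Vc)) (proj-× (suc i) (c , Vc)) (proj₂ (incr i q r))

vcProperty : ∀ {ℓ} → ExcludedMiddle ℓ → ∀ {e₁ e₂} → HasVCProperty ℓ 2 (IsModelPair 0⃗ e₁ 0⃗ e₂)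
vcProperty em M model Δ = Types.udtfs em M D (CoverLemmas.universalCover em (LpStr.base M) (PairData.oriented D)) Δ
  where
  D : PairData M
  D = pairData M model

theorem3p7 : ∀ {ℓ : Level} → ExcludedMiddle ℓ →
    HasVCProperty ℓ 2 (IsModelPair 0⃗ 0⃗ 0⃗ 0⃗)
    × HasVCProperty ℓ 2 (IsModelPair 0⃗ ∞⃗ 0⃗ 0⃗)
    × HasVCProperty ℓ 2 (IsModelPair 0⃗ ∞⃗ 0⃗ ∞⃗)
theorem3p7 em = vcProperty em , vcProperty em , vcProperty em
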